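{- Let $(\alpha, \beta)$ be an admissible pair and let $2 < k < j$ be integers. Then \[ r(C_{2k+1}, W_{2j}) \le \frac{3j + \beta}{1 - \alpha}. \]
   Context: For reals $\alpha \in [\frac14, 1)$ and $\beta > 0$, $(\alpha,\beta)$ is called an admissible pair if every $2$-connected non-bipartite graph $G$ on $n$ vertices with minimum degree $\delta(G) \ge \alpha n + \beta$ contains a cycle $C_t$ for every $t$ with $6 \le t \le c(G)$, where $c(G)$ (the circumference) is the length of a longest cycle of $G$. $C_n$ is the cycle on $n$ vertices and the wheel $W_m := C_m \ast K_1$ is obtained from $C_m$ by adding a new vertex adjacent to all vertices of the cycle. The Ramsey number $r(F,H)$ is the smallest integer $N$ such that every red-blue coloring of the edges of $K_N$ contains a red copy of $F$ or a blue copy of $H$.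
   Formalization: The numbers α and β of the admissible pair are taken to be rational rather than real; everything else is as stated. -}

module Defs where

open import Data.Bool using (Bool; true; false; _∧_; _∨_; if_then_else_)
open import Data.Nat as ℕ using (ℕ; zero; suc; _≡ᵇ_)
open import Data.Fin using (Fin; toℕ)
open import Data.List using (map; allFin)
open import Data.Nat.ListAction using (sum)
open import Data.Product using (Σ; ∃; ∃-syntax; _×_)
open import Data.Empty using (⊥)
open import Data.Unit using (⊤)
open import Data.Integer using (+_)
open import Data.Rational using (ℚ; _/_; _+_; _*_; _-_; _≤_; _<_; 0ℚ; 1ℚ)
open import Function.Definitions using (Injective)
open import Relation.Binary.PropositionalEquality using (_≡_; _≢_)
open import Relation.Nullary using (¬_)

record Graph (n : ℕ) : Set where
  field
    adj    : Fin n → Fin n → Bool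
    sym    : ∀ u v → adj u v ≡ adj v u
    irrefl : ∀ v → adj v v ≡ false
open Graph public

Adj : ∀ {n} → Graph n → Fin n → Fin n → Set
Adj G u v = adj G u v ≡ true

deg : ∀ {n} → Graph n → Fin n → ℕ
deg {n} G v = sum (map (λ u → if adj G v u then 1 else 0) (allFin n))

MinDegAtLeast : ∀ {n} → Graph n → ℚ → Set
MinDegAtLeast {n} G q = ∀ v → q ≤ (+ deg G v) / 1

data PathIn {n} (G : Graph n) (P : Fin n → Set) : Fin n → Fin n → Set where
  here : ∀ {u} → P u → PathIn G P u u
  step : ∀ {u v w} → P u → Adj G u v → PathIn G P v w → PathIn G P u w

Connected : ∀ {n} → Graph n → Set
Connected {n} G = ∀ (u v : Fin n) → PathIn G (λ _ → ⊤) u v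

TwoConnected : ∀ {n} → Graph n → Set
TwoConnected {n} G =
  (3 ℕ.≤ n) × Connected G ×
  (∀ (x u v : Fin n) → u ≢ x → v ≢ x → PathIn G (λ w → w ≢ x) u v)

Bipartite : ∀ {n} → Graph n → Set
Bipartite {n} G = Σ (Fin n → Bool) λ c → ∀ u v → Adj G u v → c u ≢ c v

cycAdj : (t : ℕ) → Fin t → Fin t → Bool
cycAdj t i j = nxt i j ∨ nxt j i
  where
  nxt : Fin t → Fin t → Bool
  nxt a b = (suc (toℕ a) ≡ᵇ toℕ b) ∨ ((toℕ b ≡ᵇ 0) ∧ (suc (toℕ a) ≡ᵇ t))

wheelAdj : (m : ℕ) → Fin (suc m) → Fin (suc m) → Bool
wheelAdj m Fin.zero Fin.zero = false
wheelAdj m Fin.zero (Fin.suc _) = true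
wheelAdj m (Fin.suc _) Fin.zero = true
wheelAdj m (Fin.suc i) (Fin.suc j) = cycAdj m i j

ContainsCopy : ∀ {m n} → (Fin m → Fin m → Bool) → (Fin n → Fin n → Set) → Set
ContainsCopy {m} {n} F E =
  Σ (Fin m → Fin n) λ f → Injective _≡_ _≡_ f × (∀ a b → F a b ≡ true → E (f a) (f b))

HasCycle : ∀ {n} → Graph n → ℕ → Set
HasCycle G t = (3 ℕ.≤ t) × ContainsCopy (cycAdj t) (Adj G)

-- (α,β) admissible.  "6 ≤ t ≤ c(G)" is written as: some cycle of length s ≥ t exists.
Admissible : ℚ → ℚ → Set
Admissible α β =
  ((+ 1) / 4 ≤ α) × (α < 1ℚ) × (0ℚ < β) ×
  (∀ (n : ℕ) (G : Graph n) → TwoConnected G → ¬ Bipartite G →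
     MinDegAtLeast G (α * ((+ n) / 1) + β) →
     ∀ (t s : ℕ) → 6 ℕ.≤ t → t ℕ.≤ s → HasCycle G s → HasCycle G t)

-- red/blue colourings of the edges of K_N (true = red, false = blue)
record Colouring (N : ℕ) : Set where
  field
    col    : Fin N → Fin N → Bool
    colSym : ∀ u v → col u v ≡ col v u
open Colouring public

RamseyProperty : ∀ {a b} → (Fin a → Fin a → Bool) → (Fin b → Fin b → Bool) → ℕ → Set
RamseyProperty F H N =
  ∀ (c : Colouring N) →
    ContainsCopy F (λ u v → col c u v ≡ true) ⊎′ ContainsCopy H (λ u v → col c u v ≡ false)
  where open import Data.Sum renaming (_⊎_ to _⊎′_)

-- r(F,H) ≤ X  (r = least N with the Ramsey property; r ≤ X iff some N ≤ X has it)
RamseyAtMost : ∀ {a b} → (Fin a → Fin a → Bool) → (Fin b → Fin b → Bool) → ℚ → Set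
RamseyAtMost F H X = ∃[ N ] (((+ N) / 1 ≤ X) × RamseyProperty F H N)

{-# OPTIONS --safe #-}
module Submission where

-- Let N be the integral part of the bound.  A ring of three copies of K₅ minus an edge has 13 vertices, minimum
-- degree 4, a Hamiltonian cycle and no cycle of length 6; so 13α + β > 4 for every admissible pair, and N ≥ 4j + 1.
-- Consider a colouring of K_N without a red C_{2k+1} and without a blue W_{2j}.
--
-- If every blue degree is at most 3j − 2, then the red graph meets the degree condition.  It is not bipartite, as
-- there is no blue K_{2j+1}.  If it is 2-connected, then admissibility leaves no red cycle longer than 2k; rotating a
-- longest red path gives a set I of at least j + 2 vertices with all their red neighbours in a set F of at most 2k,
-- and the complete blue bipartite graph between I and the complement of F yields a wheel.  If it is not 2-connected,
-- the sides of a separation are joined completely in blue, and the argument is repeated inside one of the sides.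
--
-- Otherwise the blue neighbourhood U of some vertex has at least 3j − 1 vertices, and no blue C_{2j}.  When a blue
-- cycle in U cannot be prolonged by two vertices, the blue neighbours on it of any two outside vertices are almost
-- never consecutive, so these two vertices have many common red neighbours.  Linking outside vertices through such
-- common neighbours produces a red C_{2k+1} as soon as they span a red edge; hence they form a blue clique, with few
-- blue edges to the cycle.  In this way U contains a complete red bipartite graph with parts of sizes j and j + 1,
-- and in K_N every other vertex is joined in blue to all of one of the parts, which forces a blue W_{2j}.
--
-- The Ramsey property is decidable, so the argument is by contradiction throughout, and existential results are
-- stated with a continuation into ⊥.

open import Defs

-- In the colouring of the complete graph on 4j vertices whose red graph is complete bipartite with
-- parts of size 2j, there is no red odd cycle, and the blue components are too small for a wheel.
-- So N ≥ 4j + 1 is indispensable, whereas α ≥ 1/4 and β > 0 alone give only N ≥ 4j: the last vertex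
-- has to come from admissibility itself, through a graph that rules out small α and β. The
-- threshold 3j - 2 comes from N + 1 exceeding the bound. With N = 3j + d this gives 1 + d ≥ α(N +
-- 1) + β, and blue degrees up to 3j - 2 leave red degrees of at least 1 + d. On a side of a
-- separation a vertex may lose one red neighbour, but the side has at least four vertices fewer
-- than N, and 4α ≥ 1 pays for the loss. The assumption k > 2 puts 2k + 1 into the range of
-- admissibility. In the blue neighbourhood the obstacle is a shortage by one: on a blue cycle of
-- length 2p two outside vertices are sure of p - 1 common red neighbours, while a red cycle of
-- length 2k + 1 with k ≤ p may need p. Most case distinctions there serve to find one pair with an
-- additional common neighbour.

module LinearArithmetic where
  open import Data.Nat
  open import Data.Nat.Properties
  open import Data.Empty using (⊥)
  open import Relation.Binary.PropositionalEquality

  infixr 6 _⊕_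
  _⊕_ : ∀ {a b c d} → a ≤ b → c ≤ d → a + c ≤ b + d
  _⊕_ = +-mono-≤

  infixr 7 _⊛_
  _⊛_ : ∀ k {a b} → a ≤ b → k * a ≤ k * b
  _⊛_ k = *-monoʳ-≤ k

  -- Linear arithmetic by certificate: the hypotheses are added up into l ≤ r, and
  -- the remaining semiring identity is left to the ring solver.
  conclude : ∀ {l r a b} e → l ≤ r → b + l ≡ a + r + e → a ≤ b
  conclude {l} {r} {a} {b} e l≤r eq = +-cancelʳ-≤ l a b (begin
    a + l     ≤⟨ +-monoʳ-≤ a l≤r ⟩
    a + r     ≤⟨ m≤m+n (a + r) e ⟩
    a + r + e ≡⟨ eq ⟨
    b + l     ∎)
    where open ≤-Reasoning

  refute : ∀ {l r} e → l ≤ r → l ≡ r + suc e → ⊥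
  refute {l} {r} e l≤r eq = <-irrefl refl (begin-strict
    r         <⟨ m<m+n r z<s ⟩
    r + suc e ≡⟨ eq ⟨
    l         ≤⟨ l≤r ⟩
    r         ∎)
    where open ≤-Reasoning

-- Two-coloured complete graphs: cycles, wheels, and the cases of large and small blue degrees

module Combinatorics where
  open LinearArithmetic
  open import Data.Bool using (Bool; true; false; not; _∧_; _∨_; T; if_then_else_)
  import Data.Bool.Properties as Bool
  open import Data.Empty using (⊥; ⊥-elim)
  open import Data.Fin using (Fin; toℕ)
  open import Data.Fin.Properties using (_≟_)
  open import Data.List using (List; []; _∷_; _++_; length; take; filter; allFin; lookup; map)
  open import Data.List.Membership.Propositional using (_∈_; _∉_; find)
  open import Data.List.Membership.Propositional.Properties using (∈-++⁺ˡ; ∈-++⁺ʳ; ∈-++⁻; ∈-filter⁻; ∈-filter⁺; ∈-allFin; ∈-lookup; ∈-map⁻; ∈-map⁺)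
  open import Data.List.Properties using (length-++; length-take; length-tabulate; length-map; ++-assoc; ++-identityʳ)
  open import Data.List.Relation.Binary.Permutation.Propositional using (_↭_; ↭-sym; ↭-refl; ↭-trans; ↭-reflexive)
  open import Data.List.Relation.Binary.Permutation.Propositional.Properties using (∈-resp-↭; ++-comm)
  open import Data.List.Relation.Unary.All as All using (All; []; _∷_)
  open import Data.List.Relation.Unary.All.Properties using (¬All⇒Any¬)
  open import Data.List.Relation.Unary.AllPairs using ([]; _∷_)
  open import Data.List.Relation.Unary.Any as Any using (here; there)
  open import Data.List.Relation.Unary.Any.Properties using (lookup-index)
  open import Data.List.Relation.Unary.Unique.Propositional using (Unique)
  open import Data.List.Relation.Unary.Unique.Propositional.Properties as Uniq using (Unique[x∷xs]⇒x∉xs; allFin⁺)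
  open import Data.Nat using (ℕ; zero; suc; _+_; _*_; _≤_; _<_; z≤n; s≤s; _≡ᵇ_)
  open import Data.Nat.ListAction using (sum)
  open import Data.Nat.Properties as ℕ using (≤-trans; ≤-refl; ≤-reflexive)
  open import Data.Nat.Tactic.RingSolver using (solve-∀)
  open import Data.Product using (Σ; ∃; _×_; _,_; proj₁; proj₂)
  open import Data.Sum using (_⊎_; inj₁; inj₂; [_,_]′)
  open import Data.Unit using (⊤; tt)
  open import Function using (_∘_)
  open import Function.Definitions using (Injective)
  open import Relation.Binary using (tri<; tri≈; tri>)
  open import Relation.Binary.PropositionalEquality using (_≡_; _≢_; refl; cong; cong₂; subst) renaming (sym to ≡-sym; trans to ≡-trans)
  open import Relation.Nullary using (¬_; Dec; yes; no)
  open import Relation.Nullary.Decidable using (_×-dec_; ¬?; ⌊_⌋)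

  private variable
    Elem : Set
    n : ℕ
    c : Colouring n
    b : Bool
    P Q : Fin n → Set

  -- Lists of vertices

  _#_ : List Elem → List Elem → Set
  xs # ys = ∀ {v} → v ∈ xs → v ∈ ys → ⊥

  Unique-∷ : ∀ {x : Elem} {xs} → x ∉ xs → Unique xs → Unique (x ∷ xs)
  Unique-∷ x∉ u = All.tabulate (λ y∈ e → x∉ (subst (_∈ _) (≡-sym e) y∈)) ∷ u

  Unique-tail : ∀ {x : Elem} {xs} → Unique (x ∷ xs) → Unique xs
  Unique-tail (_ ∷ u) = u

  Unique-++ : ∀ {xs ys : List Elem} → Unique xs → Unique ys → xs # ys → Unique (xs ++ ys)
  Unique-++ u v d = Uniq.++⁺ u v (λ (p , q) → d p q)

  Unique-++⁻ˡ : ∀ (xs : List Elem) {ys} → Unique (xs ++ ys) → Unique xs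
  Unique-++⁻ˡ [] u = []
  Unique-++⁻ˡ (x ∷ xs) u = Unique-∷ (λ x∈ → Unique[x∷xs]⇒x∉xs u (∈-++⁺ˡ x∈)) (Unique-++⁻ˡ xs (Unique-tail u))

  Unique-++⁻ʳ : ∀ (xs : List Elem) {ys} → Unique (xs ++ ys) → Unique ys
  Unique-++⁻ʳ [] u = u
  Unique-++⁻ʳ (x ∷ xs) u = Unique-++⁻ʳ xs (Unique-tail u)

  Unique-++⁻# : ∀ (xs : List Elem) {ys} → Unique (xs ++ ys) → xs # ys
  Unique-++⁻# (x ∷ xs) u (here refl) q = Unique[x∷xs]⇒x∉xs u (∈-++⁺ʳ xs q)
  Unique-++⁻# (x ∷ xs) u (there p) q = Unique-++⁻# xs (Unique-tail u) p q

  Unique-resp-↭ : ∀ {xs ys : List Elem} → xs ↭ ys → Unique xs → Unique ys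
  Unique-resp-↭ _↭_.refl u = u
  Unique-resp-↭ (_↭_.prep x p) u =
    Unique-∷ (λ x∈ → Unique[x∷xs]⇒x∉xs u (∈-resp-↭ (↭-sym p) x∈)) (Unique-resp-↭ p (Unique-tail u))
  Unique-resp-↭ (_↭_.swap x y p) ((x≢y ∷ x∉) ∷ y∉ ∷ u) =
    Unique-∷ (λ { (here e) → x≢y (≡-sym e)
                ; (there q) → All.lookup y∉ (∈-resp-↭ (↭-sym p) q) refl })
      (Unique-∷ (λ q → All.lookup x∉ (∈-resp-↭ (↭-sym p) q) refl) (Unique-resp-↭ p u))
  Unique-resp-↭ (_↭_.trans p q) u = Unique-resp-↭ q (Unique-resp-↭ p u)

  remove : Fin n → List (Fin n) → List (Fin n)
  remove x = filter (λ y → ¬? (y ≟ x))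

  infixl 5 _∖_
  _∖_ : List (Fin n) → List (Fin n) → List (Fin n)
  ys ∖ [] = ys
  ys ∖ (x ∷ xs) = remove x ys ∖ xs

  ∈-∖⁻ : ∀ {ys : List (Fin n)} xs {v} → v ∈ ys ∖ xs → v ∈ ys × v ∉ xs
  ∈-∖⁻ [] p = p , λ ()
  ∈-∖⁻ {ys = ys} (x ∷ xs) p with ∈-∖⁻ xs p
  ... | q , v∉ with ∈-filter⁻ (λ y → ¬? (y ≟ x)) {xs = ys} q
  ... | r , v≢ = r , λ { (here e) → v≢ e ; (there q) → v∉ q }

  ∈-∖⁺ : ∀ {ys : List (Fin n)} xs {v} → v ∈ ys → v ∉ xs → v ∈ ys ∖ xs
  ∈-∖⁺ [] p _ = p
  ∈-∖⁺ (x ∷ xs) p q =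
    ∈-∖⁺ xs (∈-filter⁺ (λ y → ¬? (y ≟ x)) p (λ e → q (here e))) (λ r → q (there r))

  Unique-∖ : ∀ {ys : List (Fin n)} xs → Unique ys → Unique (ys ∖ xs)
  Unique-∖ [] u = u
  Unique-∖ (x ∷ xs) u = Unique-∖ xs (Uniq.filter⁺ (λ y → ¬? (y ≟ x)) u)

  remove-∉ : ∀ {x : Fin n} ys → x ∉ ys → remove x ys ≡ ys
  remove-∉ [] _ = refl
  remove-∉ {x = x} (y ∷ ys) x∉ with y ≟ x
  ... | yes e = ⊥-elim (x∉ (here (≡-sym e)))
  ... | no _ = cong (y ∷_) (remove-∉ ys (λ p → x∉ (there p)))

  length-remove : ∀ {x : Fin n} ys → Unique ys → length ys ≤ suc (length (remove x ys))
  length-remove [] u = z≤n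
  length-remove {x = x} (y ∷ ys) u with y ≟ x
  ... | yes refl = s≤s (≤-reflexive (cong length (≡-sym (remove-∉ ys (Unique[x∷xs]⇒x∉xs u)))))
  ... | no _ = s≤s (length-remove ys (Unique-tail u))

  length-∖ : ∀ {ys : List (Fin n)} xs → Unique ys → length ys ≤ length xs + length (ys ∖ xs)
  length-∖ [] u = ≤-refl
  length-∖ {ys = ys} (x ∷ xs) u = ≤-trans (length-remove ys u)
    (s≤s (length-∖ xs (Uniq.filter⁺ (λ y → ¬? (y ≟ x)) u)))

  Unique-⊆-length : ∀ {xs ys : List (Fin n)} → Unique xs → (∀ {v} → v ∈ xs → v ∈ ys) → length xs ≤ length ys
  Unique-⊆-length {xs = xs} {ys} u sub with xs ∖ ys in e | length-∖ {ys = xs} ys u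
  ... | [] | le = subst (length xs ≤_) (ℕ.+-identityʳ _) le
  ... | z ∷ zs | le with ∈-∖⁻ {ys = xs} ys (subst (z ∈_) (≡-sym e) (here refl))
  ... | p , q = ⊥-elim (q (sub p))

  ∈-take : ∀ m {xs : List Elem} {v} → v ∈ take m xs → v ∈ xs
  ∈-take (suc m) {x ∷ xs} (here e) = here e
  ∈-take (suc m) {x ∷ xs} (there p) = there (∈-take m p)

  record Pick (n : ℕ) (K us : List (Fin n)) (q : ℕ) : Set where
    constructor mkPick
    field
      sel : List (Fin n)
      uniq : Unique sel
      sub : ∀ {v} → v ∈ sel → v ∈ K
      avoid : ∀ {v} → v ∈ sel → v ∉ us
      len : length sel ≡ q

  pick : ∀ {K : List (Fin n)} us q → Unique K → length us + q ≤ length K → Pick n K us q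
  pick {K = K} us q u le = mkPick (take q (K ∖ us)) (Uniq.take⁺ q (Unique-∖ us u))
    (λ p → proj₁ (∈-∖⁻ us (∈-take q p))) (λ p → proj₂ (∈-∖⁻ us (∈-take q p)))
    (≡-trans (length-take q (K ∖ us)) (ℕ.m≤n⇒m⊓n≡m
      (ℕ.+-cancelˡ-≤ (length us) q _ (≤-trans le (length-∖ us u)))))

  pick1 : ∀ {K : List (Fin n)} us → Unique K → length us < length K → ∃ λ v → v ∈ K × v ∉ us
  pick1 {K = K} us u lt with pick us 1 u (subst (_≤ length K) (ℕ.+-comm 1 (length us)) lt)
  ... | mkPick (v ∷ []) _ s a _ = v , s (here refl) , a (here refl)

  pick2 : ∀ {K : List (Fin n)} us → Unique K → length us + 2 ≤ length K →
    ∃ λ v → ∃ λ w → (v ∈ K × v ∉ us) × (w ∈ K × w ∉ us) × v ≢ w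
  pick2 us u le with pick us 2 u le
  ... | mkPick [] _ _ _ ()
  ... | mkPick (_ ∷ []) _ _ _ ()
  ... | mkPick (_ ∷ _ ∷ _ ∷ _) _ _ _ ()
  ... | mkPick (v ∷ w ∷ []) ((v≢w ∷ []) ∷ _) s a _ =
    v , w , (s (here refl) , a (here refl)) , (s (there (here refl)) , a (there (here refl))) , v≢w

  -- Paths, cliques and complete bipartite graphs

  Edge : Colouring n → Bool → Fin n → Fin n → Set
  Edge c b u v = col c u v ≡ b

  symE : ∀ {u v} → Edge c b u v → Edge c b v u
  symE {c = c} {u = u} {v} e = ≡-trans (colSym c v u) e

  data Path (c : Colouring n) (b : Bool) : Fin n → List (Fin n) → Fin n → Set where
    one  : ∀ a → Path c b a (a ∷ []) a
    cons : ∀ {a a′ xs z} → Edge c b a a′ → Path c b a′ xs z → Path c b a (a ∷ xs) z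

  Path-++ : ∀ {a xs y a′ ys z} → Path c b a xs y → Edge c b y a′ → Path c b a′ ys z → Path c b a (xs ++ ys) z
  Path-++ (one _) e q = cons e q
  Path-++ (cons e′ p) e q = cons e′ (Path-++ p e q)

  Path-snoc : ∀ {a xs y z} → Path c b a xs y → Edge c b y z → Path c b a (xs ++ z ∷ []) z
  Path-snoc p e = Path-++ p e (one _)

  -- `P` is a set known to contain the vertices, not the exact vertex set. Disjointness of paths to
  -- be joined is then argued with predicates instead of lists.
  record SPath (c : Colouring n) (b : Bool) (P : Fin n → Set) (a z : Fin n) (L : ℕ) : Set where
    constructor spath
    field
      {verts} : List (Fin n)
      path : Path c b a verts z
      uniq : Unique verts
      len  : length verts ≡ L
      all  : ∀ {v} → v ∈ verts → P v

  -- Closed paths with one or two vertices count as cycles here.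
  record HasCyc (c : Colouring n) (b : Bool) (L : ℕ) : Set₁ where
    constructor hasCyc
    field
      {Pr} : Fin n → Set
      {a z} : Fin n
      sp : SPath c b Pr a z L
      closing : Edge c b z a

  record CycIn (c : Colouring n) (b : Bool) (P : Fin n → Set) (L : ℕ) : Set where
    constructor cycIn
    field
      {a z} : Fin n
      sp : SPath c b P a z L
      closing : Edge c b z a

  toHasCyc : ∀ {L} → CycIn c b P L → HasCyc c b L
  toHasCyc (cycIn sp e) = hasCyc sp e

  start∈ : ∀ {a xs z} → Path c b a xs z → a ∈ xs
  start∈ (one _) = here refl
  start∈ (cons _ _) = here refl

  end∈ : ∀ {a xs z} → Path c b a xs z → z ∈ xs
  end∈ (one _) = here refl
  end∈ (cons _ p) = there (end∈ p)

  _∪_ : (Fin n → Set) → (Fin n → Set) → Fin n → Set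
  (P ∪ Q) v = P v ⊎ Q v

  point : ∀ {a} → P a → SPath c b P a a 1
  point {a = a} pa = spath (one a) ([] ∷ []) refl (λ { (here refl) → pa })

  weaken : ∀ {a z L} → (∀ {v} → P v → Q v) → SPath c b P a z L → SPath c b Q a z L
  weaken f (spath p u l al) = spath p u l (λ v∈ → f (al v∈))

  resize : ∀ {a z L M} → L ≡ M → SPath c b P a z L → SPath c b P a z M
  resize refl p = p

  endAt : ∀ {a z z′ L} → z ≡ z′ → SPath c b P a z L → SPath c b P a z′ L
  endAt refl p = p

  join : ∀ {a y a′ z L M} → SPath c b P a y L → Edge c b y a′ → SPath c b Q a′ z M →
    (∀ {v} → P v → Q v → ⊥) → SPath c b (P ∪ Q) a z (L + M)
  join (spath {xs} p u l al) e (spath {ys} q w m bl) dis =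
    spath (Path-++ p e q) (Unique-++ u w (λ v∈ w∈ → dis (al v∈) (bl w∈)))
      (≡-trans (length-++ xs) (≡-trans (cong (_+ length ys) l) (cong (_ +_) m)))
      (λ v∈ → [ (λ r → inj₁ (al r)) , (λ r → inj₂ (bl r)) ]′ (∈-++⁻ _ v∈))

  reversePath : ∀ {a xs z} → Path c b a xs z → ∃ λ ys → Path c b z ys a ×
    length ys ≡ length xs × (∀ {v} → v ∈ ys → v ∈ xs) × (Unique xs → Unique ys)
  reversePath (one a) = a ∷ [] , one a , refl , (λ p → p) , (λ u → u)
  reversePath {c = c} (cons {a} {a′} {xs} e p) with reversePath p
  ... | ys , q , l , sub , uq = ys ++ a ∷ [] , Path-snoc q (symE {c = c} e) ,
    ≡-trans (length-++ ys) (≡-trans (cong (_+ 1) l) (ℕ.+-comm _ 1)) ,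
    (λ v∈ → [ (λ r → there (sub r)) , (λ { (here refl) → here refl }) ]′ (∈-++⁻ ys v∈)) ,
    (λ u → Unique-++ (uq (Unique-tail u)) ([] ∷ [])
      (λ { v∈ (here refl) → Unique[x∷xs]⇒x∉xs u (sub v∈) }))

  reverseS : ∀ {a z L} → SPath c b P a z L → SPath c b P z a L
  reverseS (spath p u l al) with reversePath p
  ... | ys , q , m , sub , uq = spath q (uq u) (≡-trans m l) (λ v∈ → al (sub v∈))

  close1 : ∀ {a z v L} → SPath c b P a z L → Edge c b z v → Edge c b v a → ¬ P v → HasCyc c b (L + 1)
  close1 {P = P} {v = v} p e e′ ¬pv = hasCyc (join {Q = v ≡_} p e (point refl) (λ { pv refl → ¬pv pv })) e′

  Clique : Colouring n → Bool → List (Fin n) → Set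
  Clique c b K = ∀ {u v} → u ∈ K → v ∈ K → u ≢ v → Edge c b u v

  Complete : Colouring n → Bool → List (Fin n) → List (Fin n) → Set
  Complete c b A B = ∀ {u v} → u ∈ A → v ∈ B → Edge c b u v

  Complete-sym : ∀ {A B} → Complete c b A B → Complete c b B A
  Complete-sym {c = c} co p q = symE {c = c} (co q p)

  cliqueThrough : ∀ {K : List (Fin n)} {y y′} ms → Clique c b K → y ∈ K → y′ ∈ K →
    (∀ {v} → v ∈ ms → v ∈ K) → Unique (y ∷ y′ ∷ ms) →
    SPath c b (_∈ y ∷ y′ ∷ ms) y y′ (2 + length ms)
  cliqueThrough [] cl y∈ y′∈ sub u@((y≢ ∷ _) ∷ _) =
    spath (cons (cl y∈ y′∈ y≢) (one _)) u refl (λ p → p)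
  cliqueThrough {y = y} {y′} (m ∷ ms) cl y∈ y′∈ sub ((y≢y′ ∷ y≢m ∷ y∉) ∷ (y′≢m ∷ y′∉) ∷ (m∉ ∷ um)) =
    weaken wk (join (point {P = y ≡_} refl) (cl y∈ (sub (here refl)) y≢m)
      (cliqueThrough ms cl (sub (here refl)) y′∈ (λ p → sub (there p))
        (((λ e → y′≢m (≡-sym e)) ∷ m∉) ∷ y′∉ ∷ um))
      (λ { refl (here e) → y≢m e ; refl (there (here e)) → y≢y′ e
         ; refl (there (there p)) → All.lookup y∉ p refl }))
    where
    wk : ∀ {v} → (y ≡ v ⊎ v ∈ m ∷ y′ ∷ ms) → v ∈ y ∷ y′ ∷ m ∷ ms
    wk (inj₁ refl) = here refl
    wk (inj₂ (here e)) = there (there (here e))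
    wk (inj₂ (there (here e))) = there (here e)
    wk (inj₂ (there (there p))) = there (there (there p))

  cliquePath : ∀ {K : List (Fin n)} {y y′} us q → Clique c b K → Unique K → y ∈ K → y′ ∈ K → y ≢ y′ →
    y ∉ us → y′ ∉ us → length us + (2 + q) ≤ length K →
    SPath c b (λ v → v ∈ K × v ∉ us) y y′ (2 + q)
  cliquePath {K = K} {y} {y′} us q cl uK y∈ y′∈ y≢y′ y∉ y′∉ le
    with pick (y ∷ y′ ∷ us) q uK (conclude 0 le (arith (length us) (length K) q))
    where
    arith : ∀ u k q → k + (u + (2 + q)) ≡ 2 + u + q + k + 0
    arith = solve-∀
  ... | mkPick ms um sub av refl =
    weaken (λ { (here refl) → y∈ , y∉ ; (there (here refl)) → y′∈ , y′∉
              ; (there (there p)) → sub p , λ r → av p (there (there r)) })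
      (cliqueThrough ms cl y∈ y′∈ sub
        (Unique-∷ (λ { (here e) → y≢y′ e ; (there p) → av p (here refl) })
          (Unique-∷ (λ p → av p (there (here refl))) um)))

  cliqueCycIn : ∀ {K : List (Fin n)} L → Clique c b K → Unique K → 2 + L ≤ length K → CycIn c b (_∈ K) (2 + L)
  cliqueCycIn {K = []} L cl u ()
  cliqueCycIn {K = _ ∷ []} L cl u (s≤s ())
  cliqueCycIn {c = c} {K = x ∷ y ∷ K} L cl u@((x≢y ∷ _) ∷ _) le =
    cycIn (weaken proj₁ (cliquePath [] L cl u (here refl) (there (here refl)) x≢y (λ ()) (λ ()) le))
      (symE {c = c} (cl (here refl) (there (here refl)) x≢y))

  cliqueCycle : ∀ {K : List (Fin n)} L → Clique c b K → Unique K → 2 + L ≤ length K → HasCyc c b (2 + L)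
  cliqueCycle L cl u le = toHasCyc (cliqueCycIn L cl u le)

  zigThrough : ∀ {A B : List (Fin n)} {a₀ b₀} as bs → Complete c b A B → length as ≡ length bs →
    (∀ {v} → v ∈ a₀ ∷ as → v ∈ A) → (∀ {v} → v ∈ b₀ ∷ bs → v ∈ B) →
    Unique (a₀ ∷ as) → Unique (b₀ ∷ bs) → A # B →
    SPath c b (λ v → v ∈ a₀ ∷ as ⊎ v ∈ b₀ ∷ bs) a₀ b₀ (2 + 2 * length as)
  zigThrough [] [] co refl sa sb ua ub d =
    spath (cons (co (sa (here refl)) (sb (here refl))) (one _))
      (Unique-∷ (λ { (here refl) → d (sa (here refl)) (sb (here refl)) }) ub) refl
      (λ { (here e) → inj₁ (here e) ; (there p) → inj₂ p })
  zigThrough {n} {c} {b} {a₀ = a₀} {b₀} (x ∷ as) (y ∷ bs) co l sa sb ua ub@((b≢y ∷ b∉) ∷ ubs) d =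
    resize (arith (length as)) (weaken wk
      (join (join {P = a₀ ≡_} {Q = y ≡_} (point refl) (co (sa (here refl)) (sb (there (here refl)))) (point refl)
               (λ { refl refl → d (sa (here refl)) (sb (there (here refl))) }))
            (symE {c = c} (co (sa (there (here refl))) (sb (there (here refl)))))
            (zigThrough as bs co (ℕ.suc-injective l) (λ p → sa (there p))
               (λ { (here e) → sb (here e) ; (there p) → sb (there (there p)) })
               (Unique-tail ua) (b∉ ∷ Unique-tail ubs) d)
            dis))
    where
    arith : ∀ t → 2 + (2 + 2 * t) ≡ 2 + 2 * (1 + t)
    arith = solve-∀
    dis : ∀ {v} → (a₀ ≡ v ⊎ y ≡ v) → (v ∈ x ∷ as ⊎ v ∈ b₀ ∷ bs) → ⊥
    dis (inj₁ refl) (inj₁ p) = Unique[x∷xs]⇒x∉xs ua p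
    dis (inj₁ refl) (inj₂ (here e)) = d (sa (here refl)) (sb (here e))
    dis (inj₁ refl) (inj₂ (there p)) = d (sa (here refl)) (sb (there (there p)))
    dis (inj₂ refl) (inj₁ p) = d (sa (there p)) (sb (there (here refl)))
    dis (inj₂ refl) (inj₂ (here e)) = b≢y (≡-sym e)
    dis (inj₂ refl) (inj₂ (there p)) = Unique[x∷xs]⇒x∉xs ubs p
    wk : ∀ {v} → ((a₀ ≡ v ⊎ y ≡ v) ⊎ (v ∈ x ∷ as ⊎ v ∈ b₀ ∷ bs)) → v ∈ a₀ ∷ x ∷ as ⊎ v ∈ b₀ ∷ y ∷ bs
    wk (inj₁ (inj₁ refl)) = inj₁ (here refl)
    wk (inj₁ (inj₂ refl)) = inj₂ (there (here refl))
    wk (inj₂ (inj₁ p)) = inj₁ (there p)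
    wk (inj₂ (inj₂ (here e))) = inj₂ (here e)
    wk (inj₂ (inj₂ (there p))) = inj₂ (there (there p))

  -- us is a list of vertices to be avoided.
  zigzag : ∀ {A B : List (Fin n)} {a₀ b₀} us t → Complete c b A B → Unique A → Unique B → A # B →
    a₀ ∈ A → b₀ ∈ B → a₀ ∉ us → b₀ ∉ us → length us + (1 + t) ≤ length A → length us + (1 + t) ≤ length B →
    SPath c b (λ v → (v ∈ A ⊎ v ∈ B) × v ∉ us) a₀ b₀ (2 + 2 * t)
  zigzag {A = A} {B} {a₀} {b₀} us t co uA uB d a∈ b∈ a∉ b∉ la lb
    with pick (a₀ ∷ us) t uA (subst (_≤ length A) (ℕ.+-suc (length us) t) la)
       | pick (b₀ ∷ us) t uB (subst (_≤ length B) (ℕ.+-suc (length us) t) lb)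
  ... | mkPick as ua sa va refl | mkPick bs ub sb vb lbs =
    weaken (λ { (inj₁ (here refl)) → inj₁ a∈ , a∉
              ; (inj₁ (there p)) → inj₁ (sa p) , λ r → va p (there r)
              ; (inj₂ (here refl)) → inj₂ b∈ , b∉
              ; (inj₂ (there p)) → inj₂ (sb p) , λ r → vb p (there r) })
      (zigThrough as bs co (≡-sym lbs) (λ { (here refl) → a∈ ; (there p) → sa p })
         (λ { (here refl) → b∈ ; (there p) → sb p })
         (Unique-∷ (λ p → va p (here refl)) ua) (Unique-∷ (λ p → vb p (here refl)) ub) d)

  bipCycIn : ∀ {A B : List (Fin n)} t → Complete c b A B → Unique A → Unique B → A # B →
    1 + t ≤ length A → 1 + t ≤ length B → CycIn c b (λ v → v ∈ A ⊎ v ∈ B) (2 + 2 * t)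
  bipCycIn {A = []} t co uA uB d () lb
  bipCycIn {A = _ ∷ _} {[]} t co uA uB d la ()
  bipCycIn {c = c} {A = a ∷ A} {y ∷ B} t co uA uB d la lb =
    cycIn (weaken proj₁ (zigzag [] t co uA uB d (here refl) (here refl) (λ ()) (λ ()) la lb))
      (symE {c = c} (co (here refl) (here refl)))

  bipCycle : ∀ {A B : List (Fin n)} t → Complete c b A B → Unique A → Unique B → A # B →
    1 + t ≤ length A → 1 + t ≤ length B → HasCyc c b (2 + 2 * t)
  bipCycle t co uA uB d la lb = toHasCyc (bipCycIn t co uA uB d la lb)

  bipCycle+vertex : ∀ {A B : List (Fin n)} {x a₀ b₀} t → Complete c b A B → Unique A → Unique B → A # B →
    a₀ ∈ A → b₀ ∈ B → x ∉ A → x ∉ B → Edge c b x a₀ → Edge c b x b₀ →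
    1 + t ≤ length A → 1 + t ≤ length B → HasCyc c b (2 + 2 * t + 1)
  bipCycle+vertex {c = c} t co uA uB d a∈ b∈ x∉A x∉B e e′ la lb =
    close1 (zigzag [] t co uA uB d a∈ b∈ (λ ()) (λ ()) la lb) (symE {c = c} e′) e
      (λ { (inj₁ p , _) → x∉A p ; (inj₂ p , _) → x∉B p })

  -- The vertex `y′` is withheld from `B`; a zigzag that ends in `y` is closed through the edge
  -- `y y′`. Hence `B` needs one vertex more than `A`.
  bipCycle+edge : ∀ {A B : List (Fin n)} {y y′} t → Complete c b A B → Unique A → Unique B → A # B →
    y ∈ B → y′ ∈ B → y ≢ y′ → Edge c b y y′ → 1 + t ≤ length A → 2 + t ≤ length B →
    HasCyc c b (2 + 2 * t + 1)
  bipCycle+edge {A = []} t co uA uB d y∈ y′∈ y≢ e () lb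
  bipCycle+edge {c = c} {A = a ∷ A} {B} {y} {y′} t co uA uB d y∈ y′∈ y≢ e la lb
    = close1 (zigzag {B = B ∖ (y′ ∷ [])} [] t (λ p q → co p (proj₁ (∈-∖⁻ (y′ ∷ []) q))) uA (Unique-∖ (y′ ∷ []) uB)
          (λ p q → d p (proj₁ (∈-∖⁻ (y′ ∷ []) q))) (here refl) (∈-∖⁺ (y′ ∷ []) y∈ (λ { (here e) → y≢ e }))
          (λ ()) (λ ()) la (ℕ.+-cancelˡ-≤ 1 _ _ (≤-trans lb (length-∖ (y′ ∷ []) uB))))
        e (symE {c = c} (co (here refl) y′∈))
        (λ { (inj₁ p , _) → d p y′∈ ; (inj₂ p , _) → proj₂ (∈-∖⁻ {ys = B} (y′ ∷ []) p) (here refl) })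

  -- Surgery on a cycle

  seg : {A : Set} → (ℕ → A) → ℕ → ℕ → List A
  seg f i zero = []
  seg f i (suc n) = f i ∷ seg f (suc i) n

  module _ {A : Set} (f : ℕ → A) where

    length-seg : ∀ i n → length (seg f i n) ≡ n
    length-seg i zero = refl
    length-seg i (suc n) = cong suc (length-seg (suc i) n)

    seg-++ : ∀ i m n → seg f i (m + n) ≡ seg f i m ++ seg f (m + i) n
    seg-++ i zero n = refl
    seg-++ i (suc m) n = cong (f i ∷_) (≡-trans (seg-++ (suc i) m n)
      (cong (λ t → seg f (suc i) m ++ seg f t n) (ℕ.+-suc m i)))

    ∈-seg⁺ : ∀ i n t → t < n → f (t + i) ∈ seg f i n
    ∈-seg⁺ i (suc n) zero _ = here refl
    ∈-seg⁺ i (suc n) (suc t) (s≤s lt) =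
      there (subst (λ s → f s ∈ seg f (suc i) n) (ℕ.+-suc t i) (∈-seg⁺ (suc i) n t lt))

    ∈-seg⁻ : ∀ i n {v} → v ∈ seg f i n → ∃ λ t → t < n × v ≡ f (t + i)
    ∈-seg⁻ i (suc n) (here e) = 0 , s≤s z≤n , e
    ∈-seg⁻ i (suc n) (there p) with ∈-seg⁻ (suc i) n p
    ... | t , lt , e = suc t , s≤s lt , ≡-trans e (cong f (ℕ.+-suc t i))

  -- A cycle as a periodic sequence: arcs are segments from any starting index, and no modular
  -- arithmetic is needed where they pass the end of the list.
  record Cyc (c : Colouring n) (b : Bool) (L : ℕ) : Set where
    field
      at   : ℕ → Fin n
      edge : ∀ i → Edge c b (at i) (at (suc i))
      per  : ∀ i → at (L + i) ≡ at i
      uniq₀ : Unique (seg at 0 L)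

    verts : List (Fin n)
    verts = seg at 0 L

    rotate : ∀ i → seg at i L ↭ verts
    rotate zero = ↭-refl
    rotate (suc i) = ↭-trans (once L refl) (rotate i)
      where
      once : ∀ M → M ≡ L → seg at (suc i) M ↭ seg at i M
      once zero _ = ↭-refl
      once (suc M) e = ↭-trans (↭-reflexive (≡-trans (cong (seg at (suc i)) (ℕ.+-comm 1 M)) (≡-trans (seg-++ at (suc i) M 1)
          (cong (λ v → seg at (suc i) M ++ v ∷ []) (≡-trans (cong at (ℕ.+-suc M i)) (≡-trans (cong (λ K → at (K + i)) e) (per i)))))))
        (++-comm (seg at (suc i) M) (at i ∷ []))

    uniq : ∀ i → Unique (seg at i L)
    uniq i = Unique-resp-↭ (↭-sym (rotate i)) uniq₀

    on : ∀ i M {v} → M ≤ L → v ∈ seg at i M → v ∈ verts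
    on i M {v} le p with ℕ.m≤n⇒∃[o]m+o≡n le
    ... | k , e = ∈-resp-↭ (rotate i) (subst (v ∈_) (≡-trans (≡-sym (seg-++ at i M k)) (cong (seg at i) e)) (∈-++⁺ˡ p))

    index : ∀ {v} → v ∈ verts → ∃ λ t → t < L × v ≡ at t
    index p with ∈-seg⁻ at 0 L p
    ... | t , lt , e = t , lt , ≡-trans e (cong at (ℕ.+-identityʳ t))

    at∈ : ∀ t → t < L → at t ∈ verts
    at∈ t lt = subst (λ s → at s ∈ verts) (ℕ.+-identityʳ t) (∈-seg⁺ at 0 L t lt)

    segPath : ∀ i d → Path c b (at i) (seg at i (suc d)) (at (d + i))
    segPath i zero = one _
    segPath i (suc d) = cons (edge i) (subst (λ s → Path c b (at (suc i)) (seg at (suc i) (suc d)) (at s)) (ℕ.+-suc d i) (segPath (suc i) d))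

    arc : ∀ i d → suc d ≤ L → SPath c b (_∈ seg at i (suc d)) (at i) (at (d + i)) (suc d)
    arc i d le = spath (segPath i d) prefix (length-seg at i (suc d)) (λ p → p)
      where
      prefix : Unique (seg at i (suc d))
      prefix with ℕ.m≤n⇒∃[o]m+o≡n le
      ... | k , e = Unique-++⁻ˡ (seg at i (suc d)) {seg at (suc d + i) k}
        (subst Unique (≡-trans (cong (seg at i) (≡-sym e)) (seg-++ at i (suc d) k)) (uniq i))

  open Cyc public using (at; edge; per; uniq₀; verts; on; index; at∈; arc)

  -- Traversal of the remaining vertices, restarting from a₀ ∷ as at the end.
  walk : {A : Set} → A → List A → List A → ℕ → A
  walk a₀ as [] zero = a₀
  walk a₀ as [] (suc i) = walk a₀ as as i
  walk a₀ as (x ∷ xs) zero = x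
  walk a₀ as (x ∷ xs) (suc i) = walk a₀ as xs i

  module _ {A : Set} (a₀ : A) (as : List A) where

    walk-restart : ∀ i → walk a₀ as [] i ≡ walk a₀ as (a₀ ∷ as) i
    walk-restart zero = refl
    walk-restart (suc i) = refl

    walk-past : ∀ xs i → walk a₀ as xs (length xs + i) ≡ walk a₀ as [] i
    walk-past [] i = refl
    walk-past (x ∷ xs) i = walk-past xs i

    seg-walk : ∀ (f : ℕ → A) i xs → (∀ t → f (t + i) ≡ walk a₀ as xs t) → seg f i (length xs) ≡ xs
    seg-walk f i [] h = refl
    seg-walk f i (x ∷ xs) h = cong₂ _∷_ (h 0)
      (seg-walk f (suc i) xs (λ t → ≡-trans (cong f (ℕ.+-suc t i)) (h (suc t))))

  walk-edge : ∀ {a₀ as z} → Path c b a₀ (a₀ ∷ as) z → Edge c b z a₀ →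
    ∀ i {x xs} → Path c b x xs z → Edge c b (walk a₀ as xs i) (walk a₀ as xs (suc i))
  walk-edge p e zero (one _) = e
  walk-edge p e zero (cons e′ (one _)) = e′
  walk-edge p e zero (cons e′ (cons _ _)) = e′
  walk-edge {c = c} {b = b} {a₀} {as} p e (suc i) (one _) =
    subst (λ v → Edge c b v (walk a₀ as as i)) (≡-sym (walk-restart a₀ as i)) (walk-edge p e i p)
  walk-edge p e (suc i) (cons _ q) = walk-edge p e i q

  toCyc : ∀ {L} → HasCyc c b L → Cyc c b L
  toCyc (hasCyc (spath p u refl _) e) = go p u e
    where
    go : ∀ {a xs z} → Path c b a xs z → Unique xs → Edge c b z a → Cyc c b (length xs)
    go {a = a} (one a) u e = record
      { at = λ _ → a ; edge = λ _ → e ; per = λ _ → refl ; uniq₀ = u }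
    go {a = a} {xs = a ∷ as} p@(cons _ _) u e = record
      { at = walk a as (a ∷ as)
      ; edge = λ i → walk-edge p e i p
      ; per = λ i → ≡-trans (walk-past a as (a ∷ as) i) (walk-restart a as i)
      ; uniq₀ = subst Unique (≡-sym (seg-walk a as (walk a as (a ∷ as)) 0 (a ∷ as)
          (λ t → cong (walk a as (a ∷ as)) (ℕ.+-identityʳ t)))) u
      }

  record Split (i l L : ℕ) : Set where
    constructor mkSplit
    field
      d e : ℕ
      l≡ : l ≡ suc d + i
      L≡ : L ≡ suc d + suc e

  splitAt : ∀ {i l L} → i < l → l < L → Split i l L
  splitAt {i} {l} {L} i<l l<L with ℕ.m≤n⇒∃[o]m+o≡n i<l
  ... | d , refl with ℕ.m≤n⇒∃[o]m+o≡n (≤-trans (s≤s (s≤s (ℕ.m≤n+m d i))) l<L)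
  ... | e , refl = mkSplit d e (cong suc (ℕ.+-comm i d)) (≡-sym (cong suc (ℕ.+-suc d e)))

  module Surgery {c : Colouring n} {b : Bool} {L : ℕ} (C : Cyc c b L) where

    OnC : Fin n → Set
    OnC v = v ∈ verts C

    -- The two arcs that remain when the edges following the positions `i` and `l` are deleted.
    record Halves (i l : ℕ) : Set₁ where
      field
        {First Second} : Fin n → Set
        {d e} : ℕ
        first  : SPath c b First (at C (suc i)) (at C l) (suc d)
        second : SPath c b Second (at C (suc l)) (at C i) (suc e)
        onP : ∀ {v} → First v → OnC v
        onQ : ∀ {v} → Second v → OnC v
        dis : ∀ {v} → First v → Second v → ⊥
        total : suc d + suc e ≡ L

    halves : ∀ {i l} → i < l → l < L → Halves i l
    halves {i} i<l l<L with splitAt i<l l<L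
    ... | mkSplit d e refl refl = record
      { first = endAt (cong (at C) (ℕ.+-suc d i))
          (arc C (suc i) d (ℕ.m≤m+n (suc d) (suc e)))
      ; second = endAt (≡-trans (cong (at C) (arith d e i)) (per C i))
          (arc C (2 + d + i) e (ℕ.m≤n+m (suc e) (suc d)))
      ; onP = on C (suc i) (suc d) (ℕ.m≤m+n (suc d) (suc e))
      ; onQ = on C (2 + d + i) (suc e) (ℕ.m≤n+m (suc e) (suc d))
      ; dis = Unique-++⁻# (seg (at C) (suc i) (suc d))
          (subst Unique (≡-trans (seg-++ (at C) (suc i) (suc d) (suc e))
             (cong (λ t → seg (at C) (suc i) (suc d) ++ seg (at C) t (suc e)) (ℕ.+-suc (suc d) i))) (Cyc.uniq C (suc i)))
      ; total = refl }
      where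
      arith : ∀ d e i → e + (2 + d + i) ≡ suc d + suc e + i
      arith = solve-∀

    module _ {u w : Fin n} (u∉ : ¬ OnC u) (w∉ : ¬ OnC w) (u≢w : u ≢ w) where

      -- The first arc is run backwards: u, position l down to i + 1, then w, position l + 1 round
      -- to i, and back to u.
      cross : ∀ {i l} → i < l → l < L → Edge c b u (at C i) → Edge c b u (at C l) →
        Edge c b w (at C (suc i)) → Edge c b w (at C (suc l)) → HasCyc c b (2 + L)
      cross i<l l<L ui ul wi wl with halves i<l l<L
      ... | h = hasCyc (resize (arith d e L total)
          (join (join (join {P = u ≡_} {Q = First} (point refl) ul (reverseS first) (λ { refl p → u∉ (onP p) }))
                  (symE {c = c} wi) (point {P = w ≡_} refl)
                  (λ { (inj₁ refl) refl → u≢w refl ; (inj₂ p) refl → w∉ (onP p) }))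
            wl second
            (λ { (inj₁ (inj₁ refl)) q → u∉ (onQ q) ; (inj₁ (inj₂ p)) q → dis p q ; (inj₂ refl) q → w∉ (onQ q) })))
          (symE {c = c} ui)
        where
        open Halves h
        arith′ : ∀ d e → 1 + suc d + 1 + suc e ≡ 2 + (suc d + suc e)
        arith′ = solve-∀
        arith : ∀ d e L → suc d + suc e ≡ L → 1 + suc d + 1 + suc e ≡ 2 + L
        arith d e L refl = arith′ d e

      insertBoth : ∀ {i l} → i < l → l < L → Edge c b u (at C i) → Edge c b u (at C (suc i)) →
        Edge c b w (at C l) → Edge c b w (at C (suc l)) → HasCyc c b (2 + L)
      insertBoth i<l l<L ui ui′ wl wl′ with halves i<l l<L
      ... | h = hasCyc (resize (arith d e L total)
          (join (join (join {Q = w ≡_} first (symE {c = c} wl) (point refl) (λ { p refl → w∉ (onP p) }))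
                  wl′ second (λ { (inj₁ p) q → dis p q ; (inj₂ refl) q → w∉ (onQ q) }))
            (symE {c = c} ui) (point {P = u ≡_} refl)
            (λ { (inj₁ (inj₁ p)) refl → u∉ (onP p) ; (inj₁ (inj₂ refl)) refl → u≢w refl
               ; (inj₂ q) refl → u∉ (onQ q) })))
          ui′
        where
        open Halves h
        arith′ : ∀ d e → suc d + 1 + suc e + 1 ≡ 2 + (suc d + suc e)
        arith′ = solve-∀
        arith : ∀ d e L → suc d + suc e ≡ L → suc d + 1 + suc e + 1 ≡ 2 + L
        arith d e L refl = arith′ d e

      insertEdge : ∀ {i} → 1 ≤ L → Edge c b u w → Edge c b u (at C i) → Edge c b w (at C (suc i)) → HasCyc c b (2 + L)
      insertEdge {i} (s≤s {n = M} z≤n) uw ui wi = hasCyc (resize (arith M)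
          (join (join {Q = u ≡_} ring (symE {c = c} ui) (point refl) (λ { p refl → u∉ (onC p) }))
            uw (point {P = w ≡_} refl)
            (λ { (inj₁ p) refl → w∉ (onC p) ; (inj₂ refl) refl → u≢w refl })))
          wi
        where
        arith : ∀ M → suc M + 1 + 1 ≡ 2 + suc M
        arith = solve-∀
        onC : ∀ {v} → v ∈ seg (at C) (suc i) (suc M) → OnC v
        onC = on C (suc i) (suc M) ≤-refl
        ring : SPath c b (_∈ seg (at C) (suc i) (suc M)) (at C (suc i)) (at C i) (suc M)
        ring = endAt (≡-trans (cong (at C) (ℕ.+-suc M i)) (per C i)) (arc C (suc i) M ≤-refl)

    module _ {K : List (Fin n)} (clique : Clique c b K) (uK : Unique K) (K∉ : ∀ {v} → v ∈ K → ¬ OnC v) where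

      private
        attach : ∀ {P : Fin n → Set} {y y′ v v′ M q} → SPath c b P v v′ M → (∀ {x} → P x → OnC x) →
          y ∈ K → y′ ∈ K → y ≢ y′ → Edge c b y v → Edge c b y′ v′ → 2 + q ≤ length K → M + (2 + q) ≡ 2 + L → HasCyc c b (2 + L)
        attach {q = q} sp onP y∈ y′∈ y≢y′ e e′ le eq = hasCyc (resize eq
          (join sp (symE {c = c} e′) (cliquePath [] q clique uK y′∈ y∈ (λ r → y≢y′ (≡-sym r)) (λ ()) (λ ()) le)
            (λ p (k , _) → K∉ k (onP p)))) e

        ordered : ∀ {y y′ i l} → 2 + L ≤ 2 * length K → y ∈ K → y′ ∈ K → y ≢ y′ → i < l → l < L →
          Edge c b y (at C i) → Edge c b y′ (at C l) → HasCyc c b (2 + L)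
        ordered {y} {y′} {i} le y∈ y′∈ y≢y′ i<l l<L yi y′l with splitAt i<l l<L
        ... | mkSplit d e refl refl with ℕ.≤-total e d
        -- The arc between the attachments has `2 + d` vertices, so the clique has to supply
        -- `2 + e`; as e ≤ d this is at most half of the new length.
        ... | inj₁ e≤d = attach (arc C i (suc d) (s≤s (ℕ.m<m+n d (s≤s z≤n))))
                (on C i (2 + d) (s≤s (ℕ.m<m+n d (s≤s z≤n)))) y∈ y′∈ y≢y′ yi y′l
                (ℕ.*-cancelˡ-≤ 2 (conclude 0 (le ⊕ e≤d) (arith₁ d e (length K)))) (arith₂ d e)
          where
          arith₁ : ∀ d e k → 2 * k + (2 + (suc d + suc e) + e) ≡ 2 * (2 + e) + (2 * k + d) + 0
          arith₁ = solve-∀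
          arith₂ : ∀ d e → 2 + d + (2 + e) ≡ 2 + (suc d + suc e)
          arith₂ = solve-∀
        ... | inj₂ d≤e = attach (endAt (≡-trans (cong (at C) (arith₃ d e i)) (per C i)) (arc C (suc d + i) (suc e) bound))
                (on C (suc d + i) (2 + e) bound)
                y′∈ y∈ (λ r → y≢y′ (≡-sym r)) y′l yi
                (ℕ.*-cancelˡ-≤ 2 (conclude 0 (le ⊕ d≤e) (arith₁ d e (length K)))) (arith₂ d e)
          where
          bound : 2 + e ≤ suc d + suc e
          bound = s≤s (ℕ.m≤n+m (suc e) d)
          arith₁ : ∀ d e k → 2 * k + (2 + (suc d + suc e) + d) ≡ 2 * (2 + d) + (2 * k + e) + 0
          arith₁ = solve-∀
          arith₂ : ∀ d e → 2 + e + (2 + d) ≡ 2 + (suc d + suc e)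
          arith₂ = solve-∀
          arith₃ : ∀ d e i → suc e + (suc d + i) ≡ suc d + suc e + i
          arith₃ = solve-∀

      -- The longer of the two arcs between the attachments is completed through K.
      twoEdges : ∀ {y y′ v v′} → 2 + L ≤ 2 * length K → y ∈ K → y′ ∈ K → y ≢ y′ →
        OnC v → OnC v′ → v ≢ v′ → Edge c b y v → Edge c b y′ v′ → HasCyc c b (2 + L)
      twoEdges le y∈ y′∈ y≢y′ p p′ v≢v′ e e′ with index C p | index C p′
      ... | i , i<L , refl | l , l<L , refl with ℕ.<-cmp i l
      ... | tri< i<l _ _ = ordered le y∈ y′∈ y≢y′ i<l l<L e e′
      ... | tri≈ _ refl _ = ⊥-elim (v≢v′ refl)
      ... | tri> _ _ l<i = ordered le y′∈ y∈ (λ r → y≢y′ (≡-sym r)) l<i i<L e′ e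

  -- Common neighbours on a cycle that cannot be prolonged by two

  bit : Bool → ℕ
  bit true = 1
  bit false = 0

  count : (ℕ → Bool) → ℕ → ℕ → ℕ
  count h i zero = 0
  count h i (suc n) = bit (h i) + count h (suc i) n

  count-not : ∀ h i n → count h i n + count (not ∘ h) i n ≡ n
  count-not h i zero = refl
  count-not h i (suc n) with h i
  ... | true = cong suc (count-not h (suc i) n)
  ... | false = ≡-trans (ℕ.+-suc _ _) (cong suc (count-not h (suc i) n))

  count-suc : ∀ h i n → count (h ∘ suc) i n ≡ count h (suc i) n
  count-suc h i zero = refl
  count-suc h i (suc n) = cong (bit (h (suc i)) +_) (count-suc h (suc i) n)

  count-snoc : ∀ h i n → bit (h i) + count h (suc i) n ≡ count h i n + bit (h (n + i))
  count-snoc h i zero = ℕ.+-comm (bit (h i)) 0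
  count-snoc h i (suc n) = ≡-trans (cong (bit (h i) +_) (count-snoc h (suc i) n))
    (≡-trans (≡-sym (ℕ.+-assoc (bit (h i)) _ _))
      (cong (λ t → bit (h i) + count h (suc i) n + bit (h t)) (ℕ.+-suc n i)))

  count-rotate : ∀ h i n → h (n + i) ≡ h i → count (h ∘ suc) i n ≡ count h i n
  count-rotate h i n e = ≡-trans (count-suc h i n) (ℕ.+-cancelˡ-≡ (bit (h i)) _ _
    (≡-trans (count-snoc h i n) (≡-trans (ℕ.+-comm _ (bit (h (n + i)))) (cong (λ x → bit x + count h i n) e))))

  count-cong-≤ : ∀ {h g k l : ℕ → Bool} → (∀ t → bit (h t) ≤ bit (g t) + bit (k t) + bit (l t)) →
    ∀ i n → count h i n ≤ count g i n + count k i n + count l i n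
  count-cong-≤ f i zero = z≤n
  count-cong-≤ {h} {g} {k} {l} f i (suc n) = conclude 0 (f i ⊕ count-cong-≤ {h} {g} {k} {l} f (suc i) n)
    (arith (bit (g i)) (count g (suc i) n) (bit (k i)) (count k (suc i) n) (bit (l i)) (count l (suc i) n) (bit (h i)) (count h (suc i) n))
    where
    arith : ∀ g gs k ks l ls h hs → g + gs + (k + ks) + (l + ls) + (h + hs) ≡ h + hs + (g + k + l + (gs + ks + ls)) + 0
    arith = solve-∀

  adjacent gap : (ℕ → Bool) → ℕ → Bool
  adjacent X t = X t ∧ X (suc t)
  gap X t = not (X t) ∧ not (X (suc t))

  -- Locally this is a truth table. Summed once around a cycle it says that L plus the number of
  -- gaps equals the number of adjacencies plus twice the number of positions outside `X`, so few
  -- adjacencies force many positions outside `X`.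
  count-balance : ∀ X i n → count X i n + count (gap X) i n ≡ count (adjacent X) i n + count (not ∘ X ∘ suc) i n
  count-balance X i zero = refl
  count-balance X i (suc n) = ≡-trans (arith (bit (X i)) _ (bit (gap X i)) _)
    (≡-trans (cong₂ _+_ (local (X i) (X (suc i))) (count-balance X (suc i) n))
      (arith (bit (adjacent X i)) (bit (not (X (suc i)))) (count (adjacent X) (suc i) n) _))
    where
    arith : ∀ a b c d → a + b + (c + d) ≡ a + c + (b + d)
    arith = solve-∀
    local : ∀ x y → bit x + bit (not x ∧ not y) ≡ bit (x ∧ y) + bit (not y)
    local true true = refl
    local true false = refl
    local false true = refl
    local false false = refl

  count≡0 : ∀ h i n → (∀ {a} → i ≤ a → a < n + i → h a ≡ true → ⊥) → count h i n ≤ 0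
  count≡0 h i zero f = z≤n
  count≡0 h i (suc n) f with h i in e
  ... | true = ⊥-elim (f ≤-refl (s≤s (ℕ.m≤n+m i n)) e)
  ... | false = count≡0 h (suc i) n (λ {a} le lt → f (ℕ.<⇒≤ le) (subst (a <_) (ℕ.+-suc n i) lt))

  count≤1 : ∀ h i n → (∀ {a b} → i ≤ a → a < b → b < n + i → h a ≡ true → h b ≡ true → ⊥) → count h i n ≤ 1
  count≤1 h i zero f = z≤n
  count≤1 h i (suc n) f with h i in e
  ... | true = s≤s (count≡0 h (suc i) n (λ {a} le lt ha → f ≤-refl le (subst (a <_) (ℕ.+-suc n i) lt) e ha))
  ... | false = count≤1 h (suc i) n (λ {a} {b} le ab lt → f (ℕ.<⇒≤ le) ab (subst (b <_) (ℕ.+-suc n i) lt))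

  count≥1 : ∀ h i n t → t < n → h (t + i) ≡ true → 1 ≤ count h i n
  count≥1 h i (suc n) zero _ e rewrite e = s≤s z≤n
  count≥1 h i (suc n) (suc t) (s≤s lt) e = ≤-trans
    (count≥1 h (suc i) n t lt (subst (λ s → h s ≡ true) (≡-sym (ℕ.+-suc t i)) e)) (ℕ.m≤n+m _ (bit (h i)))

  module _ {A : Set} (f : ℕ → A) (h : ℕ → Bool) where

    select : ℕ → ℕ → List A
    select i zero = []
    select i (suc n) with h i
    ... | true = f i ∷ select (suc i) n
    ... | false = select (suc i) n

    length-select : ∀ i n → length (select i n) ≡ count h i n
    length-select i zero = refl
    length-select i (suc n) with h i
    ... | true = cong suc (length-select (suc i) n)
    ... | false = length-select (suc i) n

    select⊆ : ∀ i n {v} → v ∈ select i n → v ∈ seg f i n × ∃ λ t → h t ≡ true × v ≡ f t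
    select⊆ i (suc n) p with h i in e
    select⊆ i (suc n) (here refl) | true = here refl , i , e , refl
    select⊆ i (suc n) (there p) | true with select⊆ (suc i) n p
    ... | q , r = there q , r
    select⊆ i (suc n) p | false with select⊆ (suc i) n p
    ... | q , r = there q , r

    Unique-select : ∀ i n → Unique (seg f i n) → Unique (select i n)
    Unique-select i zero u = []
    Unique-select i (suc n) u with h i
    ... | true = Unique-∷ (λ p → Unique[x∷xs]⇒x∉xs u (proj₁ (select⊆ (suc i) n p))) (Unique-select (suc i) n (Unique-tail u))
    ... | false = Unique-select (suc i) n (Unique-tail u)

  same : Bool → Bool → Bool
  same true y = y
  same false y = not y

  same-true : ∀ x y → same x y ≡ true → y ≡ x
  same-true true true _ = refl
  same-true false false _ = refl

  same-false : ∀ x y → same x y ≡ false → y ≡ not x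
  same-false true false _ = refl
  same-false false true _ = refl

  ∧-true : ∀ {x y} → x ∧ y ≡ true → x ≡ true × y ≡ true
  ∧-true {true} {true} _ = refl , refl

  ∨-true : ∀ {x y} → x ∨ y ≡ true → x ≡ true ⊎ y ≡ true
  ∨-true {true} _ = inj₁ refl
  ∨-true {false} e = inj₂ e

  ∨-false : ∀ {x y} → x ∨ y ≡ false → x ≡ false × y ≡ false
  ∨-false {false} {false} _ = refl , refl

  not-true : ∀ {x} → not x ≡ true → x ≡ false
  not-true {false} _ = refl

  record Common (c : Colouring n) (b : Bool) (P : Fin n → Set) (u w : Fin n) (t : ℕ) : Set where
    constructor common
    field
      {nbrs} : List (Fin n)
      uniq : Unique nbrs
      onP  : ∀ {v} → v ∈ nbrs → P v
      toU  : ∀ {v} → v ∈ nbrs → Edge c b u v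
      toW  : ∀ {v} → v ∈ nbrs → Edge c b w v
      size : t ≤ length nbrs

  common-≤ : ∀ {P : Fin n → Set} {u w s t} → s ≤ t → Common c b P u w t → Common c b P u w s
  common-≤ le (common u p e f s) = common u p e f (≤-trans le s)

  -- Parity lets every count below be one too small before doubling is undone.
  halve : ∀ {t l} → 2 * t ≤ 1 + 2 * l → t ≤ l
  halve {t} {l} le with ℕ.≤-total t l
  ... | inj₁ h = h
  ... | inj₂ h with ℕ.m≤n⇒m<n∨m≡n h
  ... | inj₂ refl = ≤-refl
  ... | inj₁ lt = ⊥-elim (refute 0 (le ⊕ 2 ⊛ lt) (arith t l))
    where
    arith : ∀ t l → 2 * t + 2 * suc l ≡ 1 + 2 * l + 2 * t + suc 0
    arith = solve-∀

  module CommonNbrs {c : Colouring n} {b : Bool} {L : ℕ} (C : Cyc c b L) (none : ¬ HasCyc c b (2 + L)) where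
    open Surgery C

    Touch : Fin n → ℕ → Set
    Touch u t = Edge c b u (at C t)

    -- At such a position u could be inserted into the cycle.
    Own : Fin n → ℕ → Set
    Own u t = Touch u t × Touch u (suc t)

    touch : Fin n → ℕ → Bool
    touch u t = same b (col c u (at C t))

    touch⁻ : ∀ {u t} → touch u t ≡ true → Touch u t
    touch⁻ = same-true b _

    -- Insertions at two different positions do not interfere, so together they would prolong the
    -- cycle by two.
    own-unique : ∀ {u w i l} → ¬ OnC u → ¬ OnC w → u ≢ w → i < L → l < L → Own u i → Own w l → l ≡ i
    own-unique {i = i} {l} u∉ w∉ u≢w i<L l<L (ui , ui′) (wl , wl′) with ℕ.<-cmp i l
    ... | tri< i<l _ _ = ⊥-elim (none (insertBoth u∉ w∉ u≢w i<l l<L ui ui′ wl wl′))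
    ... | tri≈ _ e _ = ≡-sym e
    ... | tri> _ _ l<i = ⊥-elim (none (insertBoth w∉ u∉ (λ e → u≢w (≡-sym e)) l<i i<L wl wl′ ui ui′))

    module _ {u w : Fin n} (u∉ : ¬ OnC u) (w∉ : ¬ OnC w) (u≢w : u ≢ w) where
      private
        X cross₁ cross₂ own : ℕ → Bool
        X t = touch u t ∨ touch w t
        cross₁ t = touch u t ∧ touch w (suc t)
        cross₂ t = touch w t ∧ touch u (suc t)
        own t = (touch u t ∧ touch u (suc t)) ∨ (touch w t ∧ touch w (suc t))

        lt : ∀ {b} → b < L + 0 → b < L
        lt {b} = subst (b <_) (ℕ.+-identityʳ L)

        cross₁≤1 : count cross₁ 0 L ≤ 1
        cross₁≤1 = count≤1 cross₁ 0 L λ _ a<b b<L p q → none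
          (cross u∉ w∉ u≢w a<b (lt b<L) (touch⁻ (proj₁ (∧-true p))) (touch⁻ (proj₁ (∧-true q)))
            (touch⁻ (proj₂ (∧-true p))) (touch⁻ (proj₂ (∧-true q))))

        cross₂≤1 : count cross₂ 0 L ≤ 1
        cross₂≤1 = count≤1 cross₂ 0 L λ _ a<b b<L p q → none
          (cross w∉ u∉ (λ e → u≢w (≡-sym e)) a<b (lt b<L) (touch⁻ (proj₁ (∧-true p))) (touch⁻ (proj₁ (∧-true q)))
            (touch⁻ (proj₂ (∧-true p))) (touch⁻ (proj₂ (∧-true q))))

        -- Two consecutive touched positions are touched by u and then w, by w and then u, or both
        -- by the same vertex. Only the last kind lets a single vertex be inserted.
        pairs : ∀ t → bit (adjacent X t) ≤ bit (cross₁ t) + bit (cross₂ t) + bit (own t)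
        pairs t = local (touch u t) (touch w t) (touch u (suc t)) (touch w (suc t))
          where
          local : ∀ x y x′ y′ → bit ((x ∨ y) ∧ (x′ ∨ y′)) ≤ bit (x ∧ y′) + bit (y ∧ x′) + bit ((x ∧ x′) ∨ (y ∧ y′))
          local false false _ _ = z≤n
          local true _ false false = z≤n
          local false true false false = z≤n
          local true true true true = s≤s z≤n
          local true true true false = s≤s z≤n
          local true true false true = s≤s z≤n
          local true false true true = s≤s z≤n
          local true false true false = s≤s z≤n
          local true false false true = s≤s z≤n
          local false true true true = s≤s z≤n
          local false true true false = s≤s z≤n
          local false true false true = s≤s z≤n

        free : List (Fin n)
        free = select (at C) (not ∘ X) 0 L

        -- `count-balance` with the adjacencies sorted into their three kinds. The next lemmas
        -- differ only in which kinds they can exclude and whether a gap is known.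
        budget : L + count (gap X) 0 L ≤ count cross₁ 0 L + count cross₂ 0 L + count own 0 L + 2 * length free
        budget = conclude 0 (count-cong-≤ {adjacent X} {cross₁} {cross₂} {own} pairs 0 L
            ⊕ ≤-reflexive (count-balance X 0 L)
            ⊕ ≤-reflexive (≡-sym (count-not X 0 L))
            ⊕ ≤-reflexive (count-rotate (not ∘ X) 0 L (cong not (cong₂ (λ x y → touch′ u x ∨ touch′ w y) per₀ per₀)))
            ⊕ 2 ⊛ ≤-reflexive (≡-sym (length-select (at C) (not ∘ X) 0 L)))
          (arith L (count (gap X) 0 L) (count (adjacent X) 0 L) (count X 0 L) (count (not ∘ X) 0 L) (count (not ∘ X ∘ suc) 0 L)
            (count cross₁ 0 L) (count cross₂ 0 L) (count own 0 L) (length free))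
          where
          touch′ : Fin n → Fin n → Bool
          touch′ u v = same b (col c u v)
          per₀ : at C (L + 0) ≡ at C 0
          per₀ = per C 0
          arith : ∀ L g a x n′ r c₁ c₂ o f →
            c₁ + c₂ + o + 2 * f + (a + (x + g + (L + (r + 2 * n′)))) ≡ L + g + (c₁ + c₂ + o + (a + r + (x + n′ + (n′ + 2 * f)))) + 0
          arith = solve-∀

        finish : ∀ {t} → 2 * t ≤ 1 + 2 * length free → Common c (not b) OnC u w t
        finish le = common (Unique-select (at C) (not ∘ X) 0 L (uniq₀ C))
          (λ p → proj₁ (select⊆ (at C) (not ∘ X) 0 L p))
          (λ p → edge-to p (λ e → proj₁ (∨-false e)))
          (λ p → edge-to p (λ e → proj₂ (∨-false e)))
          (halve le)
          where
          edge-to : ∀ {v x} → v ∈ free → (∀ {t} → X t ≡ false → touch x t ≡ false) → Edge c (not b) x v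
          edge-to p f with proj₂ (select⊆ (at C) (not ∘ X) 0 L p)
          ... | t , e , refl = same-false b _ (f (not-true e))

        no-own : (∀ {t} → t < L → ¬ Own u t × ¬ Own w t) → count own 0 L ≤ 0
        no-own h = count≡0 own 0 L λ _ a<L e → [ (λ p → proj₁ (h (lt a<L)) (touch⁻ (proj₁ (∧-true p)) , touch⁻ (proj₂ (∧-true p))))
          , (λ p → proj₂ (h (lt a<L)) (touch⁻ (proj₁ (∧-true p)) , touch⁻ (proj₂ (∧-true p)))) ]′ (∨-true e)

        OwnOnly : ℕ → Set
        OwnOnly i = ∀ {t} → t < L → Own u t ⊎ Own w t → t ≡ i

        own≤1 : ∀ {i} → OwnOnly i → count own 0 L ≤ 1
        own≤1 h = count≤1 own 0 L λ _ a<b b<L p q →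
            ℕ.<⇒≢ a<b (≡-trans (h (ℕ.<-trans a<b (lt b<L)) (get p)) (≡-sym (h (lt b<L) (get q))))
          where
          get : ∀ {t} → own t ≡ true → Own u t ⊎ Own w t
          get e = [ (λ p → inj₁ (touch⁻ (proj₁ (∧-true p)) , touch⁻ (proj₂ (∧-true p))))
                  , (λ p → inj₂ (touch⁻ (proj₁ (∧-true p)) , touch⁻ (proj₂ (∧-true p)))) ]′ (∨-true e)

      common-general : ∀ {t} i → (∀ {t} → t < L → Own u t ⊎ Own w t → t ≡ i) → 2 * t + 2 ≤ L → Common c (not b) OnC u w t
      common-general {t} i h le = finish (conclude 0
          (le ⊕ ≤-trans (ℕ.m≤m+n L _) budget ⊕ cross₁≤1 ⊕ cross₂≤1 ⊕ own≤1 h)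
          (arith t L (count cross₁ 0 L) (count cross₂ 0 L) (count own 0 L) (length free)))
        where
        arith : ∀ t L a b o f → 1 + 2 * f + (2 * t + 2 + (L + (a + (b + o)))) ≡ 2 * t + (L + (a + b + o + 2 * f + (1 + (1 + 1)))) + 0
        arith = solve-∀

      common-ownless : ∀ {t} → (∀ {t} → t < L → ¬ Own u t × ¬ Own w t) → 2 * t + 1 ≤ L → Common c (not b) OnC u w t
      common-ownless {t} h le = finish (conclude 0
          (le ⊕ ≤-trans (ℕ.m≤m+n L _) budget ⊕ cross₁≤1 ⊕ cross₂≤1 ⊕ no-own h)
          (arith t L (count cross₁ 0 L) (count cross₂ 0 L) (count own 0 L) (length free)))
        where
        arith : ∀ t L a b o f → 1 + 2 * f + (2 * t + 1 + (L + (a + (b + o)))) ≡ 2 * t + (L + (a + b + o + 2 * f + (1 + (1 + 0)))) + 0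
        arith = solve-∀

      -- The edge `u w` would turn any crossing adjacency into an insertion of both vertices, so
      -- only the owned position is left.
      common-adjacent : ∀ {t} i → Edge c b u w → (∀ {t} → t < L → Own u t ⊎ Own w t → t ≡ i) → 2 * t ≤ L → Common c (not b) OnC u w t
      common-adjacent {t} i uw h le = finish (conclude 0
          (le ⊕ ≤-trans (ℕ.m≤m+n L _) budget
            ⊕ count≡0 cross₁ 0 L (λ _ a<L p → none (insertEdge u∉ w∉ u≢w (pos a<L) uw (touch⁻ (proj₁ (∧-true p))) (touch⁻ (proj₂ (∧-true p)))))
            ⊕ count≡0 cross₂ 0 L (λ _ a<L p → none (insertEdge w∉ u∉ (λ e → u≢w (≡-sym e)) (pos a<L) (symE {c = c} uw)
                (touch⁻ (proj₁ (∧-true p))) (touch⁻ (proj₂ (∧-true p)))))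
            ⊕ own≤1 h)
          (arith t L (count cross₁ 0 L) (count cross₂ 0 L) (count own 0 L) (length free)))
        where
        pos : ∀ {a} → a < L + 0 → 1 ≤ L
        pos a<L = ≤-trans (s≤s z≤n) (lt a<L)
        arith : ∀ t L a b o f → 1 + 2 * f + (2 * t + (L + (a + (b + o)))) ≡ 2 * t + (L + (a + b + o + 2 * f + (0 + (0 + 1)))) + 0
        arith = solve-∀

      -- Two crossing adjacencies may occur, but the gap at `i` makes up for one of them.
      common-gap : ∀ {t} i → i < L → ¬ Touch u i → ¬ Touch u (suc i) → ¬ Touch w i → ¬ Touch w (suc i) →
        (∀ {t} → t < L → ¬ Own u t × ¬ Own w t) → 2 * t ≤ L → Common c (not b) OnC u w t
      common-gap {t} i i<L u₁ u₂ w₁ w₂ h le = finish (conclude 0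
          (le ⊕ budget ⊕ cross₁≤1 ⊕ cross₂≤1 ⊕ no-own h ⊕ count≥1 (gap X) 0 L i i<L isGap)
          (arith t L (count cross₁ 0 L) (count cross₂ 0 L) (count own 0 L) (length free) (count (gap X) 0 L)))
        where
        untouched : ∀ {x s} → ¬ Touch x s → touch x s ≡ false
        untouched {x} {s} f with touch x s in e
        ... | true = ⊥-elim (f (touch⁻ e))
        ... | false = refl
        isGap : gap X (i + 0) ≡ true
        isGap rewrite ℕ.+-identityʳ i | untouched u₁ | untouched u₂ | untouched w₁ | untouched w₂ = refl
        arith : ∀ t L a b o f g → 1 + 2 * f + (2 * t + (L + g + (a + (b + (o + 1))))) ≡ 2 * t + (L + (a + b + o + 2 * f + (1 + (1 + (0 + g))))) + 0
        arith = solve-∀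

      -- A second crossing position besides i is excluded, so all adjacencies sit at i.
      common-own : ∀ {t} i → i < L → Own u i → Own w i → (∀ {t} → t < L → Own u t ⊎ Own w t → t ≡ i) → 2 * t ≤ L → Common c (not b) OnC u w t
      common-own {t} i i<L (u₁ , u₂) (w₁ , w₂) h le = finish (conclude 0
          (le ⊕ ≤-trans (ℕ.m≤m+n L _) (≤-reflexive balance) ⊕ one-adjacency ⊕ 2 ⊛ ≤-reflexive (≡-sym (length-select (at C) (not ∘ X) 0 L)))
          (arith t L (count (adjacent X) 0 L) (count (not ∘ X) 0 L) (length free)))
        where
        X-per : X (L + 0) ≡ X 0
        X-per = cong (λ v → same b (col c u v) ∨ same b (col c w v)) (per C 0)
        balance : L + count (gap X) 0 L ≡ count (adjacent X) 0 L + 2 * count (not ∘ X) 0 L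
        balance = ≡-trans (cong (_+ count (gap X) 0 L) (≡-sym (count-not X 0 L)))
          (≡-trans (swap (count X 0 L) (count (not ∘ X) 0 L) (count (gap X) 0 L))
            (≡-trans (cong (_+ count (not ∘ X) 0 L) (≡-trans (count-balance X 0 L)
               (cong (count (adjacent X) 0 L +_) (count-rotate (not ∘ X) 0 L (cong not X-per)))))
               (double (count (adjacent X) 0 L) (count (not ∘ X) 0 L))))
          where
          swap : ∀ x n g → x + n + g ≡ x + g + n
          swap = solve-∀
          double : ∀ a n → a + n + n ≡ a + 2 * n
          double = solve-∀
        at-i : ∀ {a} → a < L → adjacent X a ≡ true → a ≡ i
        at-i {a} a<L e with ∧-true e
        ... | p , q with ∨-true p | ∨-true q
        ... | inj₁ x | inj₁ y = h a<L (inj₁ (touch⁻ x , touch⁻ y))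
        ... | inj₂ x | inj₂ y = h a<L (inj₂ (touch⁻ x , touch⁻ y))
        at-i {a} a<L e | p , q | inj₁ x | inj₂ y with ℕ.<-cmp a i
        ... | tri< a<i _ _ = ⊥-elim (none (cross u∉ w∉ u≢w a<i i<L (touch⁻ x) u₁ (touch⁻ y) w₂))
        ... | tri≈ _ e′ _ = e′
        ... | tri> _ _ i<a = ⊥-elim (none (cross u∉ w∉ u≢w i<a a<L u₁ (touch⁻ x) w₂ (touch⁻ y)))
        at-i {a} a<L e | p , q | inj₂ x | inj₁ y with ℕ.<-cmp a i
        ... | tri< a<i _ _ = ⊥-elim (none (cross w∉ u∉ (λ r → u≢w (≡-sym r)) a<i i<L (touch⁻ x) w₁ (touch⁻ y) u₂))
        ... | tri≈ _ e′ _ = e′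
        ... | tri> _ _ i<a = ⊥-elim (none (cross w∉ u∉ (λ r → u≢w (≡-sym r)) i<a a<L w₁ (touch⁻ x) u₂ (touch⁻ y)))
        one-adjacency : count (adjacent X) 0 L ≤ 1
        one-adjacency = count≤1 (adjacent X) 0 L λ _ a<b b<L p q →
          ℕ.<⇒≢ a<b (≡-trans (at-i (ℕ.<-trans a<b (lt b<L)) p) (≡-sym (at-i (lt b<L) q)))
        arith : ∀ t L a m f → 1 + 2 * f + (2 * t + (L + (a + 2 * m))) ≡ 2 * t + (L + (a + 2 * m + (1 + 2 * f))) + 0
        arith = solve-∀

  -- Paths linked through common neighbours

  module Linking (c : Colouring n) (b : Bool) (P : Fin n → Set) where

    -- `us` lists the vertices of the pool `P` already on the path. A new connecting vertex has to
    -- avoid only these, so its existence depends on the length of `us` alone.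
    record Chain (R : Fin n → Set) (a z : Fin n) (M : ℕ) (us : List (Fin n)) : Set where
      constructor chain
      field
        sp   : SPath c b R a z M
        used : ∀ {v} → R v → P v → v ∈ us

    endR : ∀ {R : Fin n → Set} {a z M} → SPath c b R a z M → R z
    endR (spath p _ _ al) = al (end∈ p)

    block : ∀ {R : Fin n → Set} {a z M} → SPath c b R a z M → (∀ {v} → R v → ¬ P v) → Chain R a z M []
    block sp off = chain sp (λ r p → ⊥-elim (off r p))

    fresh : ∀ {u w us t} → Common c b P u w t → length us < t → ∃ λ x → P x × Edge c b u x × Edge c b w x × x ∉ us
    fresh {us = us} (common un onP toU toW size) lt with pick1 us un (≤-trans lt size)
    ... | x , x∈ , x∉ = x , onP x∈ , toU x∈ , toW x∈ , x∉

    attach : ∀ {R : Fin n → Set} {a z M us s t} → Chain R a z M us → ¬ R s → ¬ P s → Common c b P s a t → length us < t →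
      ∃ λ x → P x × Chain (((s ≡_) ∪ (x ≡_)) ∪ R) s z (2 + M) (x ∷ us)
    attach {R = R} {us = us} {s = s} (chain sp used) ¬Rs ¬Ps cm lt with fresh cm lt
    ... | x , Px , sx , ax , x∉ = x , Px , chain
      (join (join {P = s ≡_} {Q = x ≡_} (point refl) sx (point refl) (λ { refl refl → ¬Ps Px }))
        (symE {c = c} ax) sp (λ { (inj₁ refl) r → ¬Rs r ; (inj₂ refl) r → x∉ (used r Px) }))
      (λ { (inj₁ (inj₁ refl)) p → ⊥-elim (¬Ps p) ; (inj₁ (inj₂ refl)) _ → here refl ; (inj₂ r) p → there (used r p) })

    closeChain : ∀ {R : Fin n → Set} {a z M us t} → Chain R a z M us → Common c b P a z t → length us < t → HasCyc c b (M + 1)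
    closeChain (chain sp used) cm lt with fresh cm lt
    ... | x , Px , ax , zx , x∉ = close1 sp zx (symE {c = c} ax) (λ r → x∉ (used r Px))

    module _ {D : Fin n → Set} {t : ℕ} (D∌P : ∀ {v} → D v → ¬ P v)
             (commons : ∀ {u w} → D u → D w → u ≢ w → Common c b P u w t) where

      record Linked (R : Fin n → Set) (z : Fin n) (M : ℕ) (us ss : List (Fin n)) : Set₁ where
        field
          {R′} : Fin n → Set
          {a} : Fin n
          {us′} : List (Fin n)
          linked : Chain R′ a z (M + 2 * length ss) us′
          a∈D : D a
          a≢z : a ≢ z
          R′⊆ : ∀ {v} → R′ v → R v ⊎ v ∈ ss ⊎ P v
          len : length us′ ≡ length us + length ss

      link : ∀ {R : Fin n → Set} {a z M us} ss → Chain R a z M us → D a → a ≢ z → Unique ss →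
        (∀ {s} → s ∈ ss → D s) → (∀ {s} → s ∈ ss → ¬ R s) → length us + length ss ≤ t → Linked R z M us ss
      link {M = M} {us} [] ch Da a≢z _ _ _ _ = record
        { linked = chain (resize (≡-sym (ℕ.+-identityʳ M)) (Chain.sp ch)) (Chain.used ch) ; a∈D = Da ; a≢z = a≢z
        ; R′⊆ = inj₁ ; len = ≡-sym (ℕ.+-identityʳ (length us)) }
      link {R} {a} {z} {M} {us} (s ∷ ss) ch Da a≢z u Dss ¬R le
        with attach ch (¬R (here refl)) (D∌P (Dss (here refl)))
               (commons (Dss (here refl)) Da (λ { refl → ¬R (here refl) (start (Chain.sp ch)) }))
               (≤-trans (s≤s (ℕ.m≤m+n _ (length ss))) (subst (_≤ t) (ℕ.+-suc (length us) (length ss)) le))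
        where
        start : ∀ {a z M} → SPath c b R a z M → R a
        start (spath p _ _ al) = al (start∈ p)
      ... | x , Px , ch′ with link {us = x ∷ us} ss ch′ (Dss (here refl)) (λ { refl → ¬R (here refl) (endR (Chain.sp ch)) })
             (Unique-tail u) (λ p → Dss (there p))
             (λ { p (inj₁ (inj₁ refl)) → Unique[x∷xs]⇒x∉xs u p ; p (inj₁ (inj₂ refl)) → D∌P (Dss (there p)) Px
                ; p (inj₂ r) → ¬R (there p) r })
             (subst (_≤ t) (ℕ.+-suc (length us) (length ss)) le)
      ... | record { linked = chain sp used ; a∈D = Da′ ; a≢z = ne ; R′⊆ = sub ; len = l } = record
        { linked = chain (resize (arith M (length ss)) sp) used ; a∈D = Da′ ; a≢z = ne
        ; R′⊆ = λ r → sort (sub r)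
        ; len = ≡-trans l (≡-sym (ℕ.+-suc (length us) (length ss))) }
        where
        arith : ∀ M k → 2 + M + 2 * k ≡ M + 2 * suc k
        arith = solve-∀
        sort : ∀ {v} → (((s ≡_) ∪ (x ≡_)) ∪ R) v ⊎ v ∈ ss ⊎ P v → R v ⊎ v ∈ s ∷ ss ⊎ P v
        sort (inj₁ (inj₁ (inj₁ refl))) = inj₂ (inj₁ (here refl))
        sort (inj₁ (inj₁ (inj₂ refl))) = inj₂ (inj₂ Px)
        sort (inj₁ (inj₂ r)) = inj₁ r
        sort (inj₂ (inj₁ p)) = inj₂ (inj₁ (there p))
        sort (inj₂ (inj₂ p)) = inj₂ (inj₂ p)

      closeLinked : ∀ {R : Fin n → Set} {a z M us} ss → Chain R a z M us → D a → D z → a ≢ z → Unique ss →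
        (∀ {s} → s ∈ ss → D s) → (∀ {s} → s ∈ ss → ¬ R s) → length us + length ss < t → HasCyc c b (M + 2 * length ss + 1)
      closeLinked {us = us} ss ch Da Dz a≢z u Dss ¬R lt with link {us = us} ss ch Da a≢z u Dss ¬R (ℕ.<⇒≤ lt)
      ... | record { linked = ch′ ; a∈D = Da′ ; a≢z = ne ; len = l } =
        closeChain ch′ (commons Da′ Dz ne) (subst (_< t) (≡-sym l) lt)

      -- The closing pair is fixed in advance as `s` and `z`, so that only this pair must offer a
      -- common neighbour beyond those guaranteed to all pairs.
      closeVia : ∀ {R : Fin n → Set} {a z M us s} ss → Chain R a z M us → D a → D s → a ≢ z → ¬ R s → Unique (s ∷ ss) →
        (∀ {s} → s ∈ ss → D s) → (∀ {s} → s ∈ ss → ¬ R s) → length us + length ss < t →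
        Common c b P s z (2 + (length us + length ss)) → HasCyc c b (2 + (M + 2 * length ss) + 1)
      closeVia {us = us} {s} ss ch Da Ds a≢z ¬Rs u Dss ¬R lt special
        with link {us = us} ss ch Da a≢z (Unique-tail u) Dss ¬R (ℕ.<⇒≤ lt)
      ... | record { R′ = R′ ; a = a′ ; linked = ch′ ; a∈D = Da′ ; R′⊆ = sub ; len = l } =
        finish (attach ch′ ¬R′s (D∌P Ds) (commons Ds Da′ (λ { refl → ¬R′s (start (Chain.sp ch′)) })) (subst (_< t) (≡-sym l) lt))
        where
        ¬R′s : ¬ R′ s
        ¬R′s r with sub r
        ... | inj₁ q = ¬Rs q
        ... | inj₂ (inj₁ q) = Unique[x∷xs]⇒x∉xs u q
        ... | inj₂ (inj₂ q) = D∌P Ds q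
        start : ∀ {a z M} → SPath c b R′ a z M → R′ a
        start (spath p _ _ al) = al (start∈ p)
        finish : (∃ λ x → P x × Chain _ s _ _ (x ∷ _)) → HasCyc c b _
        finish (_ , _ , ch″) = closeChain ch″ special (s≤s (≤-reflexive (cong suc l)))

  data TwoEdges (c : Colouring n) (b : Bool) (Z : List (Fin n)) : Set where
    cherry   : ∀ {x y z} → x ∈ Z → y ∈ Z → z ∈ Z → Unique (x ∷ y ∷ z ∷ []) → Edge c b x y → Edge c b y z → TwoEdges c b Z
    matching : ∀ {x y z w} → x ∈ Z → y ∈ Z → z ∈ Z → w ∈ Z → Unique (x ∷ y ∷ z ∷ w ∷ []) → Edge c b x y → Edge c b z w → TwoEdges c b Z

  otherEdge : ∀ {c : Colouring n} b {u v} → ¬ Edge c b u v → Edge c (not b) u v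
  otherEdge {c = c} true {u} {v} ne with col c u v
  ... | true = ⊥-elim (ne refl)
  ... | false = refl
  otherEdge {c = c} false {u} {v} ne with col c u v
  ... | false = ⊥-elim (ne refl)
  ... | true = refl

  -- With at most one edge in Z, deleting one of its ends leaves a clique of the other colour.
  fewEdges : ∀ {c : Colouring n} b Z → Unique Z → (TwoEdges c b Z → ⊥) →
    (∀ Z′ → Unique Z′ → (∀ {v} → v ∈ Z′ → v ∈ Z) → length Z ≤ 1 + length Z′ → Clique c (not b) Z′ → ⊥) → ⊥
  fewEdges {c = c} b Z uZ no-two k = k Z uZ (λ p → p) (ℕ.n≤1+n _)
    λ x∈ y∈ x≢y → otherEdge {c = c} b λ xy →
      k (Z ∖ (_ ∷ [])) (Unique-∖ (_ ∷ []) uZ) (λ p → proj₁ (∈-∖⁻ (_ ∷ []) p)) (length-∖ (_ ∷ []) uZ)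
        λ {u} {v} u∈ v∈ u≢v → otherEdge {c = c} b λ uv → second x∈ y∈ x≢y xy (∈-∖⁻ (_ ∷ []) u∈) (∈-∖⁻ (_ ∷ []) v∈) u≢v uv
    where
    second : ∀ {x y u v} → x ∈ Z → y ∈ Z → x ≢ y → Edge c b x y → u ∈ Z × u ∉ x ∷ [] → v ∈ Z × v ∉ x ∷ [] → u ≢ v → Edge c b u v → ⊥
    second {x} {y} {u} {v} x∈ y∈ x≢y xy (u∈ , u∉) (v∈ , v∉) u≢v uv with u ≟ y | v ≟ y
    ... | yes refl | _ = no-two (cherry x∈ u∈ v∈ ((x≢y ∷ (λ r → v∉ (here (≡-sym r))) ∷ []) ∷ (u≢v ∷ []) ∷ [] ∷ []) xy uv)
    ... | no _ | yes refl = no-two (cherry x∈ v∈ u∈ ((x≢y ∷ (λ r → u∉ (here (≡-sym r))) ∷ []) ∷ ((λ r → u≢v (≡-sym r)) ∷ []) ∷ [] ∷ []) xy (symE {c = c} uv))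
    ... | no u≢y | no v≢y = no-two (matching x∈ y∈ u∈ v∈
        ((x≢y ∷ (λ r → u∉ (here (≡-sym r))) ∷ (λ r → v∉ (here (≡-sym r))) ∷ []) ∷ ((λ r → u≢y (≡-sym r)) ∷ (λ r → v≢y (≡-sym r)) ∷ []) ∷ (u≢v ∷ []) ∷ [] ∷ []) xy uv)

  -- Edges of a bipartite graph of which no two are disjoint form a star. `starOther` removes a
  -- centre in `Y`, `starless` a centre in `B`.
  module Matchless {c : Colouring n} (b : Bool) {Y B : List (Fin n)} (uB : Unique B)
    (none : ∀ {y y′ v v′} → y ∈ Y → y′ ∈ Y → y ≢ y′ → v ∈ B → v′ ∈ B → v ≢ v′ → Edge c b y v → Edge c b y′ v′ → ⊥) where

    starOther : ∀ {y v v′} → y ∈ Y → v ∈ B → v′ ∈ B → v ≢ v′ → Edge c b y v → Edge c b y v′ →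
      Complete c (not b) (Y ∖ (y ∷ [])) B
    starOther {y} {v} {v′} y∈ v∈ v′∈ v≢v′ e e′ {a} {x} a∈ x∈ with ∈-∖⁻ (y ∷ []) a∈
    ... | aY , a∉ = otherEdge {c = c} b excluded
      where
      excluded : Edge c b a x → ⊥
      excluded f with x ≟ v
      ... | yes refl = none y∈ aY (λ r → a∉ (here (≡-sym r))) v′∈ x∈ (λ r → v≢v′ (≡-sym r)) e′ f
      ... | no x≢v = none y∈ aY (λ r → a∉ (here (≡-sym r))) v∈ x∈ (λ r → x≢v (≡-sym r)) e f

    starless : (∀ {y v v′} → y ∈ Y → v ∈ B → v′ ∈ B → v ≢ v′ → Edge c b y v → Edge c b y v′ → ⊥) →
      (∀ B′ → Unique B′ → (∀ {v} → v ∈ B′ → v ∈ B) → Complete c (not b) Y B′ → length B ≤ 1 + length B′ → ⊥) → ⊥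
    starless noStar k = k B uB (λ q → q)
      (λ {_} {v} a∈ v∈ → otherEdge {c = c} b λ e → k (B ∖ (v ∷ [])) (Unique-∖ (v ∷ []) uB) (λ q → proj₁ (∈-∖⁻ (v ∷ []) q))
        (λ a′∈ v′∈ → otherEdge {c = c} b λ e′ → other a∈ v∈ e a′∈ (∈-∖⁻ (v ∷ []) v′∈) e′)
        (length-∖ (v ∷ []) uB))
      (ℕ.n≤1+n _)
      where
      other : ∀ {a v a′ v′} → a ∈ Y → v ∈ B → Edge c b a v → a′ ∈ Y → v′ ∈ B × v′ ∉ v ∷ [] → Edge c b a′ v′ → ⊥
      other {a} {v} {a′} a∈ v∈ e a′∈ (v′∈ , v′∉) e′ with a ≟ a′
      ... | yes refl = noStar a∈ v∈ v′∈ (λ r → v′∉ (here (≡-sym r))) e e′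
      ... | no a≢a′ = none a∈ a′∈ a≢a′ v∈ v′∈ (λ r → v′∉ (here (≡-sym r))) e e′

  -- Prolonging a blue cycle

  pattern blue = false
  pattern red = true

  red? : ∀ (c : Colouring n) u v → Edge c red u v ⊎ Edge c blue u v
  red? c u v with col c u v
  ... | true = inj₁ refl
  ... | false = inj₂ refl

  ¬blue⇒red : ∀ (c : Colouring n) {u v} → ¬ Edge c blue u v → Edge c red u v
  ¬blue⇒red c {u} {v} f with red? c u v
  ... | inj₁ e = e
  ... | inj₂ e = ⊥-elim (f e)

  ¬red⇒blue : ∀ (c : Colouring n) {u v} → ¬ Edge c red u v → Edge c blue u v
  ¬red⇒blue c {u} {v} f with red? c u v
  ... | inj₁ e = ⊥-elim (f e)
  ... | inj₂ e = e

  -- The blue cycle has length 2p with p = 1 + `p′`, and the forbidden red one has length 2k + 1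
  -- with k = 2 + `k′` ≤ p.
  module Grow (c : Colouring n) {p′ k′ : ℕ} (k≤p : suc k′ ≤ p′) (C : Cyc c blue (2 * suc p′))
    (noBlue : ¬ HasCyc c blue (2 + 2 * suc p′)) (noRed : ¬ HasCyc c red (2 * (2 + k′) + 1)) where

    open Surgery C
    open CommonNbrs C noBlue

    p : ℕ
    p = suc p′

    module Inside (Y : List (Fin n)) (uY : Unique Y) (Y∉ : ∀ {v} → v ∈ Y → ¬ OnC v) (i : ℕ)
      (ownY : ∀ {u t} → u ∈ Y → t < 2 * p → Own u t → t ≡ i) (size : suc p ≤ length Y) where

      ownPair : ∀ {u w} → u ∈ Y → w ∈ Y → ∀ {t} → t < 2 * p → Own u t ⊎ Own w t → t ≡ i
      ownPair u∈ w∈ t< = [ ownY u∈ t< , ownY w∈ t< ]′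

      -- For k = p this is one short: a red cycle of length 2k + 1 with exactly one edge inside `Y`
      -- has k connecting vertices.
      commons : ∀ {u w} → u ∈ Y → w ∈ Y → u ≢ w → Common c red OnC u w p′
      commons u∈ w∈ u≢w = common-general (Y∉ u∈) (Y∉ w∈) u≢w i (ownPair u∈ w∈) (≤-reflexive (arith p′))
        where
        arith : ∀ q → 2 * q + 2 ≡ 2 * suc q
        arith = solve-∀

      blueCommons : ∀ {u w} → u ∈ Y → w ∈ Y → u ≢ w → Edge c blue u w → Common c red OnC u w p
      blueCommons u∈ w∈ u≢w e = common-adjacent (Y∉ u∈) (Y∉ w∈) u≢w i e (ownPair u∈ w∈) ≤-refl

      -- The special pair (s , y′) supplies the last of the 2 + k′ connecting vertices.
      redCycle : ∀ {P : Fin n → Set} {y y′ s} → (∀ {v} → v ∈ Y → ¬ P v) →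
        (∀ {u w} → u ∈ Y → w ∈ Y → u ≢ w → Common c red P u w p′) →
        y ∈ Y → y′ ∈ Y → s ∈ Y → Unique (y ∷ y′ ∷ s ∷ []) → Edge c red y y′ → Common c red P s y′ p → ⊥
      redCycle {P} {y} {y′} {s} off cm y∈ y′∈ s∈ ((y≢y′ ∷ y≢s ∷ []) ∷ (y′≢s ∷ []) ∷ _) e special
        with pick (y ∷ y′ ∷ s ∷ []) k′ uY (≤-trans (s≤s (s≤s k≤p)) size)
      ... | mkPick ss us sub av refl = noRed (subst (HasCyc c red) (arith k′)
        (closeVia off cm ss (block edge₀ (λ { (here refl) → off y∈ ; (there (here refl)) → off y′∈ }))
          y∈ s∈ y≢y′ (λ { (here r) → y≢s (≡-sym r) ; (there (here r)) → y′≢s (≡-sym r) })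
          (Unique-∷ (λ q → av q (there (there (here refl)))) us) sub
          (λ q → λ { (here r) → av q (here r) ; (there (here r)) → av q (there (here r)) })
          k≤p (common-≤ (s≤s k≤p) special)))
        where
        open Linking c red P
        edge₀ : SPath c red (_∈ y ∷ y′ ∷ []) y y′ 2
        edge₀ = spath (cons e (one _)) ((y≢y′ ∷ []) ∷ [] ∷ []) refl (λ q → q)
        arith : ∀ k → 2 + (2 + 2 * k) + 1 ≡ 2 * (2 + k) + 1
        arith = solve-∀

      -- Were `s y′` blue, `blueCommons` would make it the special pair of `redCycle`.
      redAround : ∀ {y y′ s} → y ∈ Y → y′ ∈ Y → s ∈ Y → Unique (y ∷ y′ ∷ s ∷ []) → Edge c red y y′ → Edge c red s y′
      redAround y∈ y′∈ s∈ u@(_ ∷ (y′≢s ∷ []) ∷ _) e = ¬blue⇒red c λ f →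
        redCycle Y∉ commons y∈ y′∈ s∈ u e (blueCommons s∈ y′∈ (λ r → y′≢s (≡-sym r)) f)

      -- One red edge is contagious: `redAround` carries the colour to all edges at y, and from
      -- these to every edge of `Y`.
      redClique : ∀ {y y′} → y ∈ Y → y′ ∈ Y → y ≢ y′ → Edge c red y y′ → Clique c red Y
      redClique {y} {y′} y∈ y′∈ y≢y′ e = all
        where
        fromY : ∀ {u} → u ∈ Y → u ≢ y → Edge c red u y
        fromY {u} u∈ u≢y with u ≟ y′
        ... | yes refl = symE {c = c} e
        ... | no u≢y′ = redAround y′∈ y∈ u∈
          (((λ r → y≢y′ (≡-sym r)) ∷ (λ r → u≢y′ (≡-sym r)) ∷ []) ∷ ((λ r → u≢y (≡-sym r)) ∷ []) ∷ [] ∷ []) (symE {c = c} e)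
        all : Clique c red Y
        all {u} {v} u∈ v∈ u≢v with u ≟ y | v ≟ y
        ... | yes refl | _ = symE {c = c} (fromY v∈ (λ r → u≢v (≡-sym r)))
        ... | no u≢y | yes refl = fromY u∈ u≢y
        ... | no u≢y | no v≢y = redAround y∈ v∈ u∈
          (((λ r → v≢y (≡-sym r)) ∷ (λ r → u≢y (≡-sym r)) ∷ []) ∷ ((λ r → u≢v (≡-sym r)) ∷ []) ∷ [] ∷ []) (symE {c = c} (fromY v∈ v≢y))

      -- Four clique vertices in a row reduce the connecting vertices to k - 1, so that every pair
      -- is good enough. The price is k + 2 vertices in `Y` instead of k + 1.
      largeRedClique : Clique c red Y → 4 + k′ ≤ length Y → ⊥
      largeRedClique cl le with pick [] (4 + k′) uY le
      ... | mkPick [] _ _ _ ()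
      ... | mkPick (_ ∷ []) _ _ _ ()
      ... | mkPick (_ ∷ _ ∷ []) _ _ _ ()
      ... | mkPick (_ ∷ _ ∷ _ ∷ []) _ _ _ ()
      ... | mkPick (y₁ ∷ y₂ ∷ y₃ ∷ y₄ ∷ ss) ((n₁₂ ∷ n₁₃ ∷ n₁₄ ∷ n₁) ∷ (n₂₃ ∷ n₂₄ ∷ n₂) ∷ (n₃₄ ∷ n₃) ∷ n₄ ∷ us) sub _ refl =
        noRed (subst (HasCyc c red) (arith k′) (closeLinked Y∉ commons ss
          (block (cliqueThrough (y₃ ∷ y₄ ∷ []) cl (sub (here refl)) (sub (there (here refl)))
              (λ { (here refl) → sub (there (there (here refl))) ; (there (here refl)) → sub (there (there (there (here refl)))) })
              ((n₁₂ ∷ n₁₃ ∷ n₁₄ ∷ []) ∷ (n₂₃ ∷ n₂₄ ∷ []) ∷ (n₃₄ ∷ []) ∷ [] ∷ []))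
            (λ r → Y∉ (sub (inBlock r))))
          (sub (here refl)) (sub (there (here refl))) n₁₂ us (λ q → sub (there (there (there (there q)))))
          (λ { q (here refl) → notIn n₁ q ; q (there (here refl)) → notIn n₂ q
             ; q (there (there (here refl))) → notIn n₃ q ; q (there (there (there (here refl)))) → notIn n₄ q })
          k≤p))
        where
        open Linking c red OnC
        notIn : ∀ {x} → All (x ≢_) ss → x ∉ ss
        notIn al q = All.lookup al q refl
        inBlock : ∀ {v} → v ∈ y₁ ∷ y₂ ∷ y₃ ∷ y₄ ∷ [] → v ∈ y₁ ∷ y₂ ∷ y₃ ∷ y₄ ∷ ss
        inBlock (here e) = here e
        inBlock (there (here e)) = there (here e)
        inBlock (there (there (here e))) = there (there (here e))
        inBlock (there (there (there (here e)))) = there (there (there (here e)))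
        arith : ∀ k → 4 + 2 * k + 1 ≡ 2 * (2 + k) + 1
        arith = solve-∀

      -- Two vertices of Y in the same colour to the deleted vertex y₀ are special:
      -- either y₀ joins the pool, or both avoid the ends of the edge of C owned by y₀.
      module _ {y₀ : Fin n} (y₀∉C : ¬ OnC y₀) (y₀∉Y : y₀ ∉ Y) (i<L : i < 2 * p) (own₀ : Own y₀ i) where

        Pool : Fin n → Set
        Pool v = OnC v ⊎ y₀ ≡ v

        offPool : ∀ {v} → v ∈ Y → ¬ Pool v
        offPool v∈ (inj₁ q) = Y∉ v∈ q
        offPool v∈ (inj₂ refl) = y₀∉Y v∈

        widen : ∀ {u w t} → Common c red OnC u w t → Common c red Pool u w t
        widen (common un on e f s) = common un (λ q → inj₁ (on q)) e f s

        adjoin : ∀ {u w t} → Edge c red u y₀ → Edge c red w y₀ → Common c red OnC u w t → Common c red Pool u w (suc t)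
        adjoin e f (common un on g h s) = common (Unique-∷ (λ q → y₀∉C (on q)) un)
          (λ { (here refl) → inj₂ refl ; (there q) → inj₁ (on q) })
          (λ { (here refl) → e ; (there q) → g q }) (λ { (here refl) → f ; (there q) → h q }) (s≤s s)

        special : ∀ {u w} → u ∈ Y → w ∈ Y → u ≢ w → ∀ x → Edge c x u y₀ → Edge c x w y₀ → Common c red Pool u w p
        special u∈ w∈ u≢w true e f = adjoin e f (commons u∈ w∈ u≢w)
        special {u} {w} u∈ w∈ u≢w false e f = widen (common-gap (Y∉ u∈) (Y∉ w∈) u≢w i i<L
            (no₁ u∈ e) (no₂ u∈ e) (no₁ w∈ f) (no₂ w∈ f)
            (λ t< → (λ o → ownless u∈ e t< o) , (λ o → ownless w∈ f t< o)) ≤-refl)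
          where
          ≢y₀ : ∀ {v} → v ∈ Y → v ≢ y₀
          ≢y₀ v∈ refl = y₀∉Y v∈
          no₁ : ∀ {v} → v ∈ Y → Edge c blue v y₀ → ¬ Touch v i
          no₁ v∈ e t = noBlue (insertEdge (Y∉ v∈) y₀∉C (≢y₀ v∈) (s≤s z≤n) e t (proj₂ own₀))
          no₂ : ∀ {v} → v ∈ Y → Edge c blue v y₀ → ¬ Touch v (suc i)
          no₂ v∈ e t = noBlue (insertEdge y₀∉C (Y∉ v∈) (λ r → ≢y₀ v∈ (≡-sym r)) (s≤s z≤n) (symE {c = c} e) (proj₁ own₀) t)
          ownless : ∀ {v t} → v ∈ Y → Edge c blue v y₀ → t < 2 * p → ¬ Own v t
          ownless v∈ e t< o with ownY v∈ t< o
          ... | refl = no₁ v∈ e (proj₁ o)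

        -- Among three vertices two have the same colour to `y₀`. They are the special pair, and the
        -- fourth vertex `x` provides the red edge.
        tightRedClique : Clique c red Y → 4 ≤ length Y → ⊥
        tightRedClique cl le with pick [] 4 uY le
        ... | mkPick [] _ _ _ ()
        ... | mkPick (_ ∷ []) _ _ _ ()
        ... | mkPick (_ ∷ _ ∷ []) _ _ _ ()
        ... | mkPick (_ ∷ _ ∷ _ ∷ []) _ _ _ ()
        ... | mkPick (_ ∷ _ ∷ _ ∷ _ ∷ _ ∷ _) _ _ _ ()
        ... | mkPick (x ∷ y₁ ∷ y₂ ∷ y₃ ∷ []) ((x₁ ∷ x₂ ∷ x₃ ∷ []) ∷ (n₁₂ ∷ n₁₃ ∷ []) ∷ (n₂₃ ∷ []) ∷ _) sub _ refl =
          choose (col c y₁ y₀) (col c y₂ y₀) (col c y₃ y₀) refl refl refl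
          where
          ∈x = sub (here refl)
          ∈₁ = sub (there (here refl))
          ∈₂ = sub (there (there (here refl)))
          ∈₃ = sub (there (there (there (here refl))))
          use : ∀ {u w} → u ∈ Y → w ∈ Y → u ≢ w → x ≢ u → x ≢ w → ∀ z → Edge c z u y₀ → Edge c z w y₀ → ⊥
          use u∈ w∈ u≢w x≢u x≢w z e f = redCycle offPool (λ a b r → widen (commons a b r)) ∈x w∈ u∈
            ((x≢w ∷ x≢u ∷ []) ∷ ((λ r → u≢w (≡-sym r)) ∷ []) ∷ [] ∷ []) (cl ∈x w∈ x≢w) (special u∈ w∈ u≢w z e f)
          choose : ∀ a₁ a₂ a₃ → col c y₁ y₀ ≡ a₁ → col c y₂ y₀ ≡ a₂ → col c y₃ y₀ ≡ a₃ → ⊥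
          choose true true _ e₁ e₂ _ = use ∈₁ ∈₂ n₁₂ x₁ x₂ true e₁ e₂
          choose false false _ e₁ e₂ _ = use ∈₁ ∈₂ n₁₂ x₁ x₂ false e₁ e₂
          choose true false true e₁ _ e₃ = use ∈₁ ∈₃ n₁₃ x₁ x₃ true e₁ e₃
          choose false true false e₁ _ e₃ = use ∈₁ ∈₃ n₁₃ x₁ x₃ false e₁ e₃
          choose true false false _ e₂ e₃ = use ∈₂ ∈₃ n₂₃ x₂ x₃ false e₂ e₃
          choose false true true _ e₂ e₃ = use ∈₂ ∈₃ n₂₃ x₂ x₃ true e₂ e₃

    module _ (Y : List (Fin n)) (uY : Unique Y) (Y∉ : ∀ {v} → v ∈ Y → ¬ OnC v) (blueY : Clique c blue Y) (size : suc p ≤ length Y) where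

      matchless : ∀ {y y′ v v′} → y ∈ Y → y′ ∈ Y → y ≢ y′ → OnC v → OnC v′ → v ≢ v′ → Edge c blue y v → Edge c blue y′ v′ → ⊥
      matchless y∈ y′∈ y≢y′ v∈ v′∈ v≢v′ e e′ =
        noBlue (twoEdges blueY uY Y∉ (conclude 0 (2 ⊛ size) (arith p (length Y))) y∈ y′∈ y≢y′ v∈ v′∈ v≢v′ e e′)
        where
        arith : ∀ p y → 2 * y + 2 * suc p ≡ 2 + 2 * p + 2 * y + 0
        arith = solve-∀

      open Matchless {c = c} blue {Y} {verts C} (uniq₀ C) matchless public

      -- All blue edges between `Y` and the cycle meet y, so `A₀` is joined to the cycle in red. A
      -- red edge on the cycle would then close a red odd cycle, so the cycle spans a blue clique.
      -- Next, `y₀` is red to `A₀`, hence blue to the cycle, and y closes up a path through the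
      -- resulting blue clique on 2p + 1 vertices.
      ownStar : ∀ {y₀ y v v′ i} → ¬ OnC y₀ → y₀ ∉ Y → i < 2 * p → Own y₀ i →
        y ∈ Y → OnC v → OnC v′ → v ≢ v′ → Edge c blue y v → Edge c blue y v′ → ⊥
      ownStar {y₀} {y} {v} {v′} {i} y₀∉C y₀∉Y i<L own₀ y∈ v∈ v′∈ v≢v′ e e′ =
        noBlue (subst (HasCyc c blue) (arith₃ p′) (close1
          (cliquePath [] (1 + 2 * p′) blueK (Unique-∷ y₀∉C (uniq₀ C)) (there v∈) (there v′∈) v≢v′ (λ ()) (λ ())
            (≤-reflexive (≡-trans (arith₄ p′) (cong suc (≡-sym (length-seg (at C) 0 (2 * p)))))))
          (symE {c = c} e′) e (λ { (here refl , _) → y₀∉Y y∈ ; (there q , _) → Y∉ y∈ q })))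
        where
        A₀ : List (Fin n)
        A₀ = Y ∖ (y ∷ [])
        uA₀ : Unique A₀
        uA₀ = Unique-∖ (y ∷ []) uY
        A₀#C : A₀ # verts C
        A₀#C q r = Y∉ (proj₁ (∈-∖⁻ (y ∷ []) q)) r
        k≤A₀ : 2 + k′ ≤ length A₀
        k≤A₀ = ℕ.+-cancelˡ-≤ 1 _ _ (≤-trans (s≤s (s≤s k≤p)) (≤-trans size (length-∖ (y ∷ []) uY)))
        redA₀ : Complete c red A₀ (verts C)
        redA₀ = starOther y∈ v∈ v′∈ v≢v′ e e′
        arith₁ : ∀ k → 2 + 2 * suc k + 1 ≡ 2 * (2 + k) + 1
        arith₁ = solve-∀
        arith₃ : ∀ p → 2 + (1 + 2 * p) + 1 ≡ 2 + 2 * suc p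
        arith₃ = solve-∀
        arith₄ : ∀ p → 2 + (1 + 2 * p) ≡ suc (2 * suc p)
        arith₄ = solve-∀
        big : 2 + suc k′ ≤ length (verts C)
        big = ≤-trans (conclude 1 (2 ⊛ k≤p ⊕ ℕ.m≤m+n 1 k′) (arith k′ p′)) (≤-reflexive (≡-sym (length-seg (at C) 0 (2 * p))))
          where
          arith : ∀ k q → 2 * suc q + (2 * suc k + 1) ≡ 2 + suc k + (2 * q + (1 + k)) + 1
          arith = solve-∀
        blueC : Clique c blue (verts C)
        blueC x∈ z∈ x≢z = ¬red⇒blue c λ f → noRed (subst (HasCyc c red) (arith₁ k′)
          (bipCycle+edge (suc k′) redA₀ uA₀ (uniq₀ C) A₀#C x∈ z∈ x≢z f k≤A₀ big))
        redToA₀ : ∀ {a} → a ∈ A₀ → Edge c red y₀ a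
        redToA₀ {a} a∈ = ¬blue⇒red c λ f → detour f
          where
          a∈Y = proj₁ (∈-∖⁻ (y ∷ []) a∈)
          ya : Edge c blue y a
          ya = blueY y∈ a∈Y (λ { refl → proj₂ (∈-∖⁻ {ys = Y} (y ∷ []) a∈) (here refl) })
          -- The path y₀, a, y is closed through 2p - 1 vertices of the blue clique on the cycle,
          -- from x to the position owned by y₀; this gives length 2p + 2.
          through : Edge c blue y₀ a → ∀ {x} → OnC x → x ≢ at C i → Edge c blue y x → ⊥
          through f x∈ x≢ yx = noBlue (subst (HasCyc c blue) (length≡ p″ p≡) (hasCyc (join
              (join (join {P = y₀ ≡_} {Q = a ≡_} (point refl) f (point refl) (λ { refl refl → y₀∉Y a∈Y }))
                (symE {c = c} ya) (point {P = y ≡_} refl)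
                (λ { (inj₁ refl) refl → y₀∉Y y∈ ; (inj₂ refl) refl → proj₂ (∈-∖⁻ {ys = Y} (y ∷ []) a∈) (here refl) }))
              yx
              (cliquePath [] (1 + 2 * p″) blueC (uniq₀ C) x∈ (at∈ C i i<L) x≢ (λ ()) (λ ())
                (≤-trans (bound≤ p″ p≡) (≤-reflexive (≡-sym (length-seg (at C) 0 (2 * p))))))
              (λ { (inj₁ (inj₁ refl)) (q , _) → y₀∉C q ; (inj₁ (inj₂ refl)) (q , _) → Y∉ a∈Y q ; (inj₂ refl) (q , _) → Y∉ y∈ q }))
            (symE {c = c} (proj₁ own₀))))
            where
            p″ : ℕ
            p″ = proj₁ (ℕ.m≤n⇒∃[o]m+o≡n (≤-trans (s≤s z≤n) k≤p))
            p≡ : suc p″ ≡ p′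
            p≡ = proj₂ (ℕ.m≤n⇒∃[o]m+o≡n (≤-trans (s≤s z≤n) k≤p))
            bound≤ : ∀ q → 1 + q ≡ p′ → 2 + (1 + 2 * q) ≤ 2 * suc p′
            bound≤ q refl = conclude 1 (z≤n {0}) (arith q)
              where
              arith : ∀ q → 2 * suc (suc q) + 0 ≡ 2 + (1 + 2 * q) + 0 + 1
              arith = solve-∀
            length≡ : ∀ q → 1 + q ≡ p′ → 1 + 1 + 1 + (2 + (1 + 2 * q)) ≡ 2 + 2 * suc p′
            length≡ q refl = arith q
              where
              arith : ∀ q → 1 + 1 + 1 + (2 + (1 + 2 * q)) ≡ 2 + 2 * suc (suc q)
              arith = solve-∀
          detour : Edge c blue y₀ a → ⊥
          detour f with v ≟ at C i
          ... | yes refl = through f v′∈ (λ r → v≢v′ (≡-sym r)) e′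
          ... | no v≢ = through f v∈ v≢ e
        blueC₀ : ∀ {x} → OnC x → Edge c blue y₀ x
        blueC₀ x∈ = ¬red⇒blue c λ f → closeUp f
          where
          closeUp : Edge c red y₀ _ → ⊥
          closeUp f with pick1 [] uA₀ (≤-trans (s≤s z≤n) k≤A₀)
          ... | a , a∈ , _ = noRed (subst (HasCyc c red) (arith₁ k′) (bipCycle+vertex (suc k′) redA₀ uA₀ (uniq₀ C) A₀#C a∈ x∈
            (λ q → y₀∉Y (proj₁ (∈-∖⁻ (y ∷ []) q))) y₀∉C (redToA₀ a∈) f k≤A₀ (≤-trans (ℕ.n≤1+n _) big)))
        blueK : Clique c blue (y₀ ∷ verts C)
        blueK (here refl) (here refl) ne = ⊥-elim (ne refl)
        blueK (here refl) (there q) _ = blueC₀ q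
        blueK (there q) (here refl) _ = symE {c = c} (blueC₀ q)
        blueK (there q) (there r) ne = blueC q r ne

    -- If some vertex of `Y` owns a position, it is set aside, and by `own-unique` the others can
    -- own only that position. The continuation tolerates the loss of one vertex on each side; after
    -- an owner has been set aside, a star centred in `Y` would cost a second one, which `ownStar`
    -- prevents.
    grow : ∀ Y → Unique Y → (∀ {v} → v ∈ Y → ¬ OnC v) → 2 + p ≤ length Y → 3 ≤ p ⊎ 3 + p ≤ length Y →
      (∀ A B → Unique A → Unique B → A # B → Complete c red A B → Clique c blue A →
        length Y ≤ 1 + length A → 2 * p ≤ 1 + length B → ⊥) → ⊥
    grow Y uY Y∉ size room k = withoutOwn λ u∈ t< own → withOwn u∈ t< own
      where
      cycle≤ : ∀ {l} → length (verts C) ≤ l → 2 * p ≤ l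
      cycle≤ {l} = subst (_≤ l) (length-seg (at C) 0 (2 * p))
      withoutOwn : (∀ {u t} → u ∈ Y → t < 2 * p → Own u t → ⊥) → ⊥
      withoutOwn none = starless Y uY Y∉ blueY size′
        (λ {y} y∈ v∈ v′∈ v≢v′ e e′ → k (Y ∖ (y ∷ [])) (verts C) (Unique-∖ (y ∷ []) uY) (uniq₀ C)
          (λ q r → Y∉ (proj₁ (∈-∖⁻ (y ∷ []) q)) r)
          (starOther Y uY Y∉ blueY size′ y∈ v∈ v′∈ v≢v′ e e′)
          (λ q r → blueY (proj₁ (∈-∖⁻ (y ∷ []) q)) (proj₁ (∈-∖⁻ (y ∷ []) r)))
          (length-∖ (y ∷ []) uY) (cycle≤ (ℕ.n≤1+n _)))
        (λ B uB B⊆ co le → k Y B uY uB (λ q r → Y∉ q (B⊆ r)) co blueY (ℕ.n≤1+n _) (cycle≤ le))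
        where
        size′ : suc p ≤ length Y
        size′ = ≤-trans (ℕ.n≤1+n _) size
        open Inside Y uY Y∉ 0 (λ u∈ t< o → ⊥-elim (none u∈ t< o)) size′
        blueY : Clique c blue Y
        blueY x∈ y∈ x≢y = ¬red⇒blue c λ e → largeRedClique (redClique x∈ y∈ x≢y e) (≤-trans (s≤s (s≤s (s≤s k≤p))) size)
      withOwn : ∀ {u i} → u ∈ Y → i < 2 * p → Own u i → ⊥
      withOwn {u} {i} u∈ i<L own = starless Y′ uY′ Y′∉ blueY′ size′
        (λ y∈ → ownStar Y′ uY′ Y′∉ blueY′ size′ (Y∉ u∈) u∉ i<L own y∈)
        (λ B uB B⊆ co le → k Y′ B uY′ uB (λ q r → Y′∉ q (B⊆ r)) co blueY′ shrink (cycle≤ le))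
        where
        Y′ : List (Fin n)
        Y′ = Y ∖ (u ∷ [])
        uY′ : Unique Y′
        uY′ = Unique-∖ (u ∷ []) uY
        Y′⊆ : ∀ {v} → v ∈ Y′ → v ∈ Y
        Y′⊆ q = proj₁ (∈-∖⁻ (u ∷ []) q)
        Y′∉ : ∀ {v} → v ∈ Y′ → ¬ OnC v
        Y′∉ q = Y∉ (Y′⊆ q)
        u∉ : u ∉ Y′
        u∉ q = proj₂ (∈-∖⁻ {ys = Y} (u ∷ []) q) (here refl)
        shrink : length Y ≤ 1 + length Y′
        shrink = length-∖ (u ∷ []) uY
        size′ : suc p ≤ length Y′
        size′ = ℕ.+-cancelˡ-≤ 1 _ _ (≤-trans size shrink)
        ownOnly : ∀ {w t} → w ∈ Y′ → t < 2 * p → Own w t → t ≡ i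
        ownOnly w∈ t< o = own-unique (Y∉ u∈) (Y′∉ w∈) (λ { refl → u∉ w∈ }) i<L t< own o
        open Inside Y′ uY′ Y′∉ i ownOnly size′
        noRedClique : 3 ≤ p ⊎ 3 + p ≤ length Y → Clique c red Y′ → ⊥
        noRedClique (inj₁ 3≤p) cl = tightRedClique (Y∉ u∈) u∉ i<L own cl (≤-trans (s≤s 3≤p) size′)
        noRedClique (inj₂ le) cl = largeRedClique cl
          (≤-trans (s≤s (s≤s (s≤s k≤p))) (ℕ.+-cancelˡ-≤ 1 _ _ (≤-trans le shrink)))
        blueY′ : Clique c blue Y′
        blueY′ x∈ y∈ x≢y = ¬red⇒blue c λ e → noRedClique room (redClique x∈ y∈ x≢y e)

  -- Blue cycles from a red odd cycle

  -- With k = 3 + k′, a red cycle of length 2k − 1 forces a blue one of length 2k or a red one of length 2k + 1.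
  module Descend (c : Colouring n) {k′ : ℕ} (C : Cyc c red (5 + 2 * k′))
    (noRed : ¬ HasCyc c red (2 + (5 + 2 * k′))) (noBlue : ¬ HasCyc c blue (6 + 2 * k′)) where

    open Surgery C
    open CommonNbrs C noRed
    open Linking c blue OnC

    private
      length-C : length (verts C) ≡ 5 + 2 * k′
      length-C = length-seg (at C) 0 (5 + 2 * k′)

      noBipartite : ∀ {A B} → Complete c blue A B → Unique A → Unique B → A # B → 3 + k′ ≤ length A → 3 + k′ ≤ length B → ⊥
      noBipartite co uA uB d la lb = noBlue (subst (HasCyc c blue) (arith k′) (bipCycle (2 + k′) co uA uB d la lb))
        where
        arith : ∀ k → 2 + 2 * (2 + k) ≡ 6 + 2 * k
        arith = solve-∀

      -- Two disjoint red edges to the cycle would prolong it by two through the clique. Thus they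
      -- form a star, and without its centre a large complete blue bipartite graph remains.
      noRedClique : ∀ Z → Unique Z → (∀ {v} → v ∈ Z → ¬ OnC v) → Clique c red Z → 4 + k′ ≤ length Z → ⊥
      noRedClique Z uZ Z∉ redZ size = starless
          (λ {y} y∈ v∈ v′∈ v≢v′ e e′ → noBipartite (starOther y∈ v∈ v′∈ v≢v′ e e′) (Unique-∖ (y ∷ []) uZ) (uniq₀ C)
            (λ q r → Z∉ (proj₁ (∈-∖⁻ (y ∷ []) q)) r) (ℕ.+-cancelˡ-≤ 1 _ _ (≤-trans size (length-∖ (y ∷ []) uZ)))
            (≤-trans (conclude (2 + k′) (z≤n {0}) (arith₁ k′)) (≤-reflexive (≡-sym length-C))))
          (λ B uB B⊆ co le → noBipartite co uZ uB (λ q r → Z∉ q (B⊆ r)) (≤-trans (ℕ.n≤1+n _) size)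
            (conclude (1 + k′) (≤-trans (≤-reflexive (≡-sym length-C)) le) (arith₂ k′ (length B))))
        where
        arith₁ : ∀ k → 5 + 2 * k + 0 ≡ 3 + k + 0 + (2 + k)
        arith₁ = solve-∀
        arith₂ : ∀ k l → l + (5 + 2 * k) ≡ 3 + k + (1 + l) + (1 + k)
        arith₂ = solve-∀
        arith₃ : ∀ k l → 2 * l + 2 * (4 + k) ≡ 2 + (5 + 2 * k) + 2 * l + 1
        arith₃ = solve-∀
        noMatching : ∀ {y y′ v v′} → y ∈ Z → y′ ∈ Z → y ≢ y′ → OnC v → OnC v′ → v ≢ v′ → Edge c red y v → Edge c red y′ v′ → ⊥
        noMatching y∈ y′∈ y≢y′ v∈ v′∈ v≢v′ e e′ =
          noRed (twoEdges redZ uZ Z∉ (conclude 1 (2 ⊛ size) (arith₃ k′ (length Z))) y∈ y′∈ y≢y′ v∈ v′∈ v≢v′ e e′)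
        open Matchless {c = c} red {Z} {verts C} (uniq₀ C) noMatching

      module _ (Z : List (Fin n)) (uZ : Unique Z) (Z∉ : ∀ {v} → v ∈ Z → ¬ OnC v) (size : 5 + k′ ≤ length Z)
        (commons : ∀ {u w} → u ∈ Z → w ∈ Z → u ≢ w → Common c blue OnC u w (2 + k′)) where

        -- With only k - 1 connecting vertices per pair, a blue cycle of length 2k takes k + 1
        -- vertices from `Z`; exactly two of its edges then lie inside `Z`.
        noTwoEdges : TwoEdges c blue Z → ⊥
        noTwoEdges (cherry {x} {y} {z} x∈ y∈ z∈ u@((x≢y ∷ x≢z ∷ []) ∷ _) xy yz)
          with pick (x ∷ y ∷ z ∷ []) (1 + k′) uZ (≤-trans (ℕ.n≤1+n _) size)
        ... | mkPick ss us sub av eq = noBlue (subst (HasCyc c blue) (≡-trans (cong (λ l → 3 + 2 * l + 1) eq) (arith k′))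
          (closeLinked Z∉ commons ss (block {R = _∈ x ∷ y ∷ z ∷ []} (spath (cons xy (cons yz (one _))) u refl (λ q → q))
              (λ { (here refl) → Z∉ x∈ ; (there (here refl)) → Z∉ y∈ ; (there (there (here refl))) → Z∉ z∈ }))
            x∈ z∈ x≢z us sub av (s≤s (≤-reflexive eq))))
          where
          arith : ∀ k → 3 + 2 * (1 + k) + 1 ≡ 6 + 2 * k
          arith = solve-∀
        noTwoEdges (matching {x} {y} {z} {w} x∈ y∈ z∈ w∈ ((x≢y ∷ x≢z ∷ x≢w ∷ []) ∷ (y≢z ∷ y≢w ∷ []) ∷ (z≢w ∷ []) ∷ _) xy zw)
          with pick (x ∷ y ∷ z ∷ w ∷ []) k′ uZ (≤-trans (ℕ.n≤1+n _) size)
             | attach {us = []} (block {R = _∈ y ∷ x ∷ []}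
                 (spath (cons (symE {c = c} xy) (one _)) (((λ r → x≢y (≡-sym r)) ∷ []) ∷ [] ∷ []) refl (λ q → q))
                 (λ { (here refl) → Z∉ y∈ ; (there (here refl)) → Z∉ x∈ }))
               (λ { (here r) → y≢z (≡-sym r) ; (there (here r)) → x≢z (≡-sym r) }) (Z∉ z∈)
               (commons z∈ y∈ (λ r → y≢z (≡-sym r))) (s≤s z≤n)
        ... | mkPick ss us sub av eq | t , Pt , chain sp used = noBlue (subst (HasCyc c blue) (≡-trans (cong (λ l → 5 + 2 * l + 1) eq) (arith k′))
          (closeLinked Z∉ commons ss
            (chain (join {P = w ≡_} (point refl) (symE {c = c} zw) sp
                (λ { refl (inj₁ (inj₁ refl)) → z≢w refl ; refl (inj₁ (inj₂ refl)) → Z∉ w∈ Pt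
                   ; refl (inj₂ (here r)) → y≢w (≡-sym r) ; refl (inj₂ (there (here r))) → x≢w (≡-sym r) }))
              (λ { (inj₁ refl) q → ⊥-elim (Z∉ w∈ q) ; (inj₂ r) q → used r q }))
            w∈ x∈ (λ r → x≢w (≡-sym r)) us sub
            (λ { q (inj₁ refl) → av q (there (there (there (here refl)))) ; q (inj₂ (inj₁ (inj₁ refl))) → av q (there (there (here refl)))
               ; q (inj₂ (inj₁ (inj₂ refl))) → Z∉ (sub q) Pt ; q (inj₂ (inj₂ (here refl))) → av q (there (here refl))
               ; q (inj₂ (inj₂ (there (here refl)))) → av q (here refl) })
            (s≤s (s≤s (≤-reflexive eq)))))
          where
          arith : ∀ k → 5 + 2 * k + 1 ≡ 6 + 2 * k
          arith = solve-∀

        manyCommons : ⊥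
        manyCommons = fewEdges blue Z uZ noTwoEdges λ Z′ uZ′ sub le redZ′ →
          noRedClique Z′ uZ′ (λ q → Z∉ (sub q)) redZ′ (ℕ.+-cancelˡ-≤ 1 _ _ (≤-trans size le))

      touch? : ∀ u t → Dec (Touch u t)
      touch? u t = col c u (at C t) Bool.≟ red

      bound : ∀ {t} → t ≤ 2 + k′ → 2 * t + 1 ≤ 5 + 2 * k′
      bound {t} le = conclude 0 (2 ⊛ le) (arith t k′)
        where
        arith : ∀ t k → 5 + 2 * k + 2 * t ≡ 2 * t + 1 + 2 * (2 + k) + 0
        arith = solve-∀

    module _ (Z : List (Fin n)) (uZ : Unique Z) (Z∉ : ∀ {v} → v ∈ Z → ¬ OnC v) (size : 6 + k′ ≤ length Z) where

      private
        -- If there is at most one owner, it can be deleted. This deletion is why `6 + k′` vertices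
        -- are required where `manyCommons` needs `5 + k′`.
        fewOwn : (∀ {u w i l} → u ∈ Z → w ∈ Z → u ≢ w → i < 5 + 2 * k′ → l < 5 + 2 * k′ → Own u i → Own w l → ⊥) → ⊥
        fewOwn noTwo = manyCommons Z uZ Z∉ (≤-trans (ℕ.n≤1+n _) size) λ u∈ w∈ u≢w →
            common-ownless (Z∉ u∈) (Z∉ w∈) u≢w (λ t< → (λ o → oneOwn u∈ t< o) , (λ o → oneOwn w∈ t< o)) (bound ≤-refl)
          where
          oneOwn : ∀ {z i} → z ∈ Z → i < 5 + 2 * k′ → Own z i → ⊥
          oneOwn {z} z∈ i< own = manyCommons (Z ∖ (z ∷ [])) (Unique-∖ (z ∷ []) uZ) (λ q → Z∉ (proj₁ (∈-∖⁻ (z ∷ []) q)))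
              (ℕ.+-cancelˡ-≤ 1 _ _ (≤-trans size (length-∖ (z ∷ []) uZ)))
              λ u∈ w∈ u≢w → common-ownless (Z∉ (proj₁ (∈-∖⁻ (z ∷ []) u∈))) (Z∉ (proj₁ (∈-∖⁻ (z ∷ []) w∈))) u≢w
                (λ t< → (λ o → others (∈-∖⁻ (z ∷ []) u∈) t< o) , (λ o → others (∈-∖⁻ (z ∷ []) w∈) t< o)) (bound ≤-refl)
            where
            others : ∀ {u t} → u ∈ Z × u ∉ z ∷ [] → t < 5 + 2 * k′ → Own u t → ⊥
            others (u∈ , u∉) t< o = noTwo z∈ u∈ (λ r → u∉ (here (≡-sym r))) i< t< own o

        module TwoOwn {a₁ a₂ : Fin n} {i : ℕ} (a₁∈ : a₁ ∈ Z) (a₂∈ : a₂ ∈ Z) (a₁≢a₂ : a₁ ≢ a₂) (i< : i < 5 + 2 * k′)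
          (own₁ : Own a₁ i) (own₂ : Own a₂ i) where

          -- A second owner is needed to bind the first one: a vertex might own several positions,
          -- and `own-unique` compares distinct vertices only.
          only : ∀ {x t} → x ∈ Z → t < 5 + 2 * k′ → Own x t → t ≡ i
          only {x} x∈ t< o with x ≟ a₁
          ... | yes refl = own-unique (Z∉ a₂∈) (Z∉ x∈) (λ r → a₁≢a₂ (≡-sym r)) i< t< own₂ o
          ... | no x≢a₁ = own-unique (Z∉ a₁∈) (Z∉ x∈) (λ r → x≢a₁ (≡-sym r)) i< t< own₁ o

          onlyPair : ∀ {u w t} → u ∈ Z → w ∈ Z → t < 5 + 2 * k′ → Own u t ⊎ Own w t → t ≡ i
          onlyPair u∈ w∈ t< = [ only u∈ t< , only w∈ t< ]′

          not-own : ∀ {x t} → x ∈ Z → ¬ Own x i → t < 5 + 2 * k′ → ¬ Own x t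
          not-own x∈ ¬o t< o with only x∈ t< o
          ... | refl = ¬o o

          ownBlue : ∀ {u w} → u ∈ Z → w ∈ Z → u ≢ w → Own u i → Own w i → Edge c blue u w
          ownBlue u∈ w∈ u≢w (ui , _) (_ , wi) = ¬red⇒blue c λ f → noRed (insertEdge (Z∉ u∈) (Z∉ w∈) u≢w (s≤s z≤n) f ui wi)

          weak : ∀ {u w} → u ∈ Z → w ∈ Z → u ≢ w → Common c blue OnC u w (1 + k′)
          weak u∈ w∈ u≢w = common-general (Z∉ u∈) (Z∉ w∈) u≢w i (onlyPair u∈ w∈) (conclude 1 (z≤n {0}) (arith k′))
            where
            arith : ∀ k → 5 + 2 * k + 0 ≡ 2 * (1 + k) + 2 + 0 + 1
            arith = solve-∀

          bothOwn : ∀ {u w} → u ∈ Z → w ∈ Z → u ≢ w → Own u i → Own w i → Common c blue OnC u w (2 + k′)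
          bothOwn u∈ w∈ u≢w o o′ = common-own (Z∉ u∈) (Z∉ w∈) u≢w i i< o o′ (onlyPair u∈ w∈) (≤-trans (ℕ.m≤m+n _ 1) (bound ≤-refl))

          neitherOwn : ∀ {u w} → u ∈ Z → w ∈ Z → u ≢ w → ¬ Own u i → ¬ Own w i → Common c blue OnC u w (2 + k′)
          neitherOwn u∈ w∈ u≢w o o′ = common-ownless (Z∉ u∈) (Z∉ w∈) u≢w (λ t< → not-own u∈ o t< , not-own w∈ o′ t<) (bound ≤-refl)

          mixedRed : ∀ {u w} → u ∈ Z → w ∈ Z → u ≢ w → Edge c red u w → Common c blue OnC u w (2 + k′)
          mixedRed u∈ w∈ u≢w e = common-adjacent (Z∉ u∈) (Z∉ w∈) u≢w i e (onlyPair u∈ w∈) (≤-trans (ℕ.m≤m+n _ 1) (bound ≤-refl))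

          -- The ends of the path u′ , u , w are of both kinds, so one of them is special with any further vertex.
          mixedBlue′ : ∀ {u′ u w} → u′ ∈ Z → u ∈ Z → w ∈ Z → u′ ≢ u → Own u′ i → Own u i → ¬ Own w i → Edge c blue u w → ⊥
          mixedBlue′ {u′} {u} {w} u′∈ u∈ w∈ u′≢u o′ o ¬o e with pick (u′ ∷ u ∷ w ∷ []) (1 + k′) uZ (≤-trans (ℕ.m≤n+m _ 2) size)
          ... | mkPick [] _ _ _ ()
          ... | mkPick (s ∷ ss) us sub av eq = decide (touch? s i ×-dec touch? s (suc i))
            where
            u′≢w : u′ ≢ w
            u′≢w refl = ¬o o′
            u≢w : u ≢ w
            u≢w refl = ¬o o
            s∈ : s ∈ Z
            s∈ = sub (here refl)
            u′u : Edge c blue u′ u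
            u′u = ownBlue u′∈ u∈ u′≢u o′ o
            s≢u′ : s ≢ u′
            s≢u′ refl = av (here refl) (here refl)
            s≢w : s ≢ w
            s≢w refl = av (here refl) (there (there (here refl)))
            Trio : Fin n → Set
            Trio v = v ∈ u′ ∷ u ∷ w ∷ []
            trio : SPath c blue Trio u′ w 3
            trio = spath (cons u′u (cons e (one _))) ((u′≢u ∷ u′≢w ∷ []) ∷ (u≢w ∷ []) ∷ [] ∷ []) refl (λ q → q)
            trio∉ : ∀ {v} → Trio v → ¬ OnC v
            trio∉ (here refl) = Z∉ u′∈
            trio∉ (there (here refl)) = Z∉ u∈
            trio∉ (there (there (here refl))) = Z∉ w∈
            len : length ss ≡ k′
            len = ℕ.suc-injective eq
            arith : ∀ k → 2 + (3 + 2 * k) + 1 ≡ 6 + 2 * k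
            arith = solve-∀
            finish : ∀ {a z} → SPath c blue Trio a z 3 → a ∈ Z → a ≢ z → Common c blue OnC s z (2 + k′) → ⊥
            finish path a∈ a≢z special = noBlue (subst (HasCyc c blue) (≡-trans (cong (λ l → 2 + (3 + 2 * l) + 1) len) (arith k′))
              (closeVia Z∉ weak ss (block path trio∉) a∈ s∈ a≢z (av (here refl)) us (λ q → sub (there q)) (λ q → av (there q))
                (s≤s (≤-reflexive len)) (common-≤ (s≤s (s≤s (≤-reflexive len))) special)))
            decide : Dec (Own s i) → ⊥
            decide (yes os) = finish (reverseS trio) w∈ (λ r → u′≢w (≡-sym r)) (bothOwn s∈ u′∈ s≢u′ os o′)
            decide (no ns) = finish trio u′∈ u′≢w (neitherOwn s∈ w∈ s≢w ns ¬o)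

          mixedBlue : ∀ {u w} → u ∈ Z → w ∈ Z → Own u i → ¬ Own w i → Edge c blue u w → ⊥
          mixedBlue {u} u∈ w∈ o ¬o e with a₁ ≟ u
          ... | yes refl = mixedBlue′ a₂∈ u∈ w∈ (λ r → a₁≢a₂ (≡-sym r)) own₂ o ¬o e
          ... | no a₁≢u = mixedBlue′ a₁∈ u∈ w∈ a₁≢u own₁ o ¬o e

          contradiction : ⊥
          contradiction = manyCommons Z uZ Z∉ (≤-trans (ℕ.n≤1+n _) size) λ {u} {w} u∈ w∈ u≢w →
              decide u∈ w∈ u≢w (touch? u i ×-dec touch? u (suc i)) (touch? w i ×-dec touch? w (suc i))
            where
            decide : ∀ {u w} → u ∈ Z → w ∈ Z → u ≢ w → Dec (Own u i) → Dec (Own w i) → Common c blue OnC u w (2 + k′)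
            decide u∈ w∈ u≢w (yes o) (yes o′) = bothOwn u∈ w∈ u≢w o o′
            decide u∈ w∈ u≢w (no o) (no o′) = neitherOwn u∈ w∈ u≢w o o′
            decide u∈ w∈ u≢w (yes o) (no o′) = mixedRed u∈ w∈ u≢w (¬blue⇒red c (mixedBlue u∈ w∈ o o′))
            decide u∈ w∈ u≢w (no o) (yes o′) = mixedRed u∈ w∈ u≢w (symE {c = c} (¬blue⇒red c (mixedBlue w∈ u∈ o′ o)))

      descend : ⊥
      descend = fewOwn λ u∈ w∈ u≢w i< l< o o′ → at-same u∈ w∈ u≢w i< o o′ (own-unique (Z∉ u∈) (Z∉ w∈) u≢w i< l< o o′)
        where
        at-same : ∀ {u w i l} → u ∈ Z → w ∈ Z → u ≢ w → i < 5 + 2 * k′ → Own u i → Own w l → l ≡ i → ⊥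
        at-same u∈ w∈ u≢w i< o o′ refl = TwoOwn.contradiction u∈ w∈ u≢w i< o o′

  -- A bipartite red subgraph

  nbrsIn : Colouring n → Bool → Fin n → List (Fin n) → List (Fin n)
  nbrsIn c b u = filter (λ v → col c u v Bool.≟ b)

  nbrsIn⊆ : ∀ (c : Colouring n) b u xs {v} → v ∈ nbrsIn c b u xs → v ∈ xs × Edge c b u v
  nbrsIn⊆ c b u xs = ∈-filter⁻ (λ v → col c u v Bool.≟ b)

  Unique-nbrsIn : ∀ (c : Colouring n) b u {xs} → Unique xs → Unique (nbrsIn c b u xs)
  Unique-nbrsIn c b u = Uniq.filter⁺ (λ v → col c u v Bool.≟ b)

  filter-split : ∀ {A : Set} (f : A → Bool) xs →
    length (filter (λ v → f v Bool.≟ true) xs) + length (filter (λ v → f v Bool.≟ false) xs) ≡ length xs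
  filter-split f [] = refl
  filter-split f (x ∷ xs) with f x
  ... | true = cong suc (filter-split f xs)
  ... | false = ≡-trans (ℕ.+-suc _ _) (cong suc (filter-split f xs))

  nbrsIn-split : ∀ (c : Colouring n) u xs → length (nbrsIn c red u xs) + length (nbrsIn c blue u xs) ≡ length xs
  nbrsIn-split c u = filter-split (col c u)

  length-allFin : ∀ n → length (allFin n) ≡ n
  length-allFin n = length-tabulate (λ i → i)

  quadrilateral : ∀ {c : Colouring n} {b x y z w} → Unique (x ∷ y ∷ z ∷ w ∷ []) →
    Edge c b x y → Edge c b y z → Edge c b z w → Edge c b w x → HasCyc c b 4
  quadrilateral u xy yz zw wx = hasCyc {Pr = _} (spath (cons xy (cons yz (cons zw (one _)))) u refl (λ q → q)) wx

  -- The red neighbours of x span no red path on four vertices.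
  fiveRed : ∀ (c : Colouring n) x R → ¬ HasCyc c red 5 → ¬ HasCyc c blue 4 → Unique R → length R ≡ 5 → x ∉ R →
    (∀ {v} → v ∈ R → Edge c red x v) → ⊥
  fiveRed c x R noRed noBlue uR len x∉ xR = fewEdges red R uR two
      λ Z uZ sub le cl → noBlue (cliqueCycle 2 cl uZ (ℕ.+-cancelˡ-≤ 1 _ _ (≤-trans (≤-reflexive (≡-sym len)) le)))
    where
    noPath : ∀ {a b d e} → a ∈ R → b ∈ R → d ∈ R → e ∈ R → Unique (a ∷ b ∷ d ∷ e ∷ []) →
      Edge c red a b → Edge c red b d → Edge c red d e → ⊥
    noPath a∈ b∈ d∈ e∈ u ab bd de = noRed (close1 {P = _∈ _ ∷ _ ∷ _ ∷ _ ∷ []} (spath (cons ab (cons bd (cons de (one _)))) u refl (λ q → q))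
      (symE {c = c} (xR e∈)) (xR a∈)
      (λ { (here refl) → x∉ a∈ ; (there (here refl)) → x∉ b∈ ; (there (there (here refl))) → x∉ d∈ ; (there (there (there (here refl)))) → x∉ e∈ }))
    two : TwoEdges c red R → ⊥
    two (cherry {a} {b} {d} a∈ b∈ d∈ ((a≢b ∷ a≢d ∷ []) ∷ (b≢d ∷ []) ∷ _) ab bd)
      with pick (a ∷ b ∷ d ∷ []) 2 uR (≤-reflexive (≡-sym len))
    ... | mkPick [] _ _ _ ()
    ... | mkPick (_ ∷ []) _ _ _ ()
    ... | mkPick (_ ∷ _ ∷ _ ∷ _) _ _ _ ()
    ... | mkPick (v ∷ w ∷ []) ((v≢w ∷ []) ∷ _) sub av _ = noBlue (quadrilateral
        (((λ r → av v∈ (here (≡-sym r))) ∷ a≢d ∷ (λ r → av w∈ (here (≡-sym r))) ∷ []) ∷ ((λ r → av v∈ (there (there (here r)))) ∷ v≢w ∷ [])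
          ∷ ((λ r → av w∈ (there (there (here (≡-sym r))))) ∷ []) ∷ [] ∷ [])
        (toA v∈) (symE {c = c} (toD v∈)) (toD w∈) (symE {c = c} (toA w∈)))
      where
      v∈ : v ∈ v ∷ w ∷ []
      v∈ = here refl
      w∈ : w ∈ v ∷ w ∷ []
      w∈ = there (here refl)
      toA : ∀ {t} → t ∈ v ∷ w ∷ [] → Edge c blue a t
      toA t∈ = ¬red⇒blue c λ e → noPath (sub t∈) a∈ b∈ d∈
        (((λ r → av t∈ (here r)) ∷ (λ r → av t∈ (there (here r))) ∷ (λ r → av t∈ (there (there (here r)))) ∷ []) ∷ (a≢b ∷ a≢d ∷ []) ∷ (b≢d ∷ []) ∷ [] ∷ [])
        (symE {c = c} e) ab bd
      toD : ∀ {t} → t ∈ v ∷ w ∷ [] → Edge c blue d t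
      toD t∈ = ¬red⇒blue c λ e → noPath a∈ b∈ d∈ (sub t∈)
        ((a≢b ∷ a≢d ∷ (λ r → av t∈ (here (≡-sym r))) ∷ []) ∷ (b≢d ∷ (λ r → av t∈ (there (here (≡-sym r)))) ∷ []) ∷ ((λ r → av t∈ (there (there (here (≡-sym r))))) ∷ []) ∷ [] ∷ [])
        ab bd e
    two (matching {a} {b} {d} {e} a∈ b∈ d∈ e∈ ((a≢b ∷ a≢d ∷ a≢e ∷ []) ∷ (b≢d ∷ b≢e ∷ []) ∷ (d≢e ∷ []) ∷ _) ab de) =
      noBlue (quadrilateral
        ((a≢d ∷ a≢b ∷ a≢e ∷ []) ∷ ((λ r → b≢d (≡-sym r)) ∷ d≢e ∷ []) ∷ (b≢e ∷ []) ∷ [] ∷ [])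
        (¬red⇒blue c λ f → noPath b∈ a∈ d∈ e∈ (((λ r → a≢b (≡-sym r)) ∷ b≢d ∷ b≢e ∷ []) ∷ (a≢d ∷ a≢e ∷ []) ∷ (d≢e ∷ []) ∷ [] ∷ []) (symE {c = c} ab) f de)
        (symE {c = c} (¬red⇒blue c λ f → noPath a∈ b∈ d∈ e∈ ((a≢b ∷ a≢d ∷ a≢e ∷ []) ∷ (b≢d ∷ b≢e ∷ []) ∷ (d≢e ∷ []) ∷ [] ∷ []) ab f de))
        (¬red⇒blue c λ f → noPath a∈ b∈ e∈ d∈ ((a≢b ∷ a≢e ∷ a≢d ∷ []) ∷ (b≢e ∷ b≢d ∷ []) ∷ ((λ r → d≢e (≡-sym r)) ∷ []) ∷ [] ∷ []) ab f (symE {c = c} de))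
        (symE {c = c} (¬red⇒blue c λ f → noPath b∈ a∈ e∈ d∈ (((λ r → a≢b (≡-sym r)) ∷ b≢e ∷ b≢d ∷ []) ∷ (a≢e ∷ a≢d ∷ []) ∷ ((λ r → d≢e (≡-sym r)) ∷ []) ∷ [] ∷ []) (symE {c = c} ab) f (symE {c = c} de))))

  -- By `fiveRed` a vertex has at most four red neighbours in a set that avoids it. So x has at
  -- least six blue neighbours, and a suitable second vertex w shares two of them.
  fourCycle : ∀ (c : Colouring n) → 11 ≤ n → ¬ HasCyc c red 5 → ¬ HasCyc c blue 4 → ⊥
  fourCycle {n} c le noRed noBlue with pick1 [] (allFin⁺ n) (≤-trans (≤-trans (s≤s z≤n) le) (≤-reflexive (≡-sym (length-allFin n))))
  ... | x , _ , _ = [ (λ small → outer small (pick1 (x ∷ M) (allFin⁺ n) (≤-trans (s≤s (s≤s small)) (≤-trans (ℕ.m≤n+m 9 2) le′)))) , (λ large → inner large (pick1 [] uM (≤-trans (s≤s z≤n) large))) ]′ (ℕ.≤-total (length M) 7)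
    where
    le′ : 11 ≤ length (allFin n)
    le′ = ≤-trans le (≤-reflexive (≡-sym (length-allFin n)))
    few : ∀ u {xs} → Unique xs → u ∉ xs → length xs ≤ 4 + length (nbrsIn c blue u xs)
    few u {xs} uxs u∉ with ℕ.≤-<-connex 5 (length (nbrsIn c red u xs))
    ... | inj₂ lt = ≤-trans (≤-reflexive (≡-sym (nbrsIn-split c u xs))) (ℕ.+-monoˡ-≤ _ (ℕ.≤-pred lt))
    ... | inj₁ le₅ with pick [] 5 (Unique-nbrsIn c red u uxs) le₅
    ... | mkPick R uR sub _ len = ⊥-elim (fiveRed c u R noRed noBlue uR len
        (λ q → u∉ (proj₁ (nbrsIn⊆ c red u xs (sub q)))) (λ q → proj₂ (nbrsIn⊆ c red u xs (sub q))))
    rest : List (Fin n)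
    rest = allFin n ∖ (x ∷ [])
    x∉rest : x ∉ rest
    x∉rest q = proj₂ (∈-∖⁻ {ys = allFin n} (x ∷ []) q) (here refl)
    M : List (Fin n)
    M = nbrsIn c blue x rest
    uM : Unique M
    uM = Unique-nbrsIn c blue x (Unique-∖ (x ∷ []) (allFin⁺ n))
    6≤M : 6 ≤ length M
    6≤M = ℕ.+-cancelˡ-≤ 4 _ _ (≤-trans (ℕ.+-cancelˡ-≤ 1 _ _ (≤-trans le′ (length-∖ (x ∷ []) (allFin⁺ n))))
      (few x (Unique-∖ (x ∷ []) (allFin⁺ n)) x∉rest))
    meet : ∀ w M′ → w ≢ x → Unique M′ → (∀ {v} → v ∈ M′ → v ∈ M) → w ∉ M′ → 6 ≤ length M′ → ⊥
    meet w M′ w≢x uM′ sub w∉ le₆ with pick [] 2 (Unique-nbrsIn c blue w uM′) (ℕ.+-cancelˡ-≤ 4 _ _ (≤-trans le₆ (few w uM′ w∉)))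
    ... | mkPick [] _ _ _ ()
    ... | mkPick (_ ∷ []) _ _ _ ()
    ... | mkPick (_ ∷ _ ∷ _ ∷ _) _ _ _ ()
    ... | mkPick (y ∷ z ∷ []) ((y≢z ∷ []) ∷ _) sel _ _ = noBlue (quadrilateral
        ((x≢ y∈ ∷ (λ r → w≢x (≡-sym r)) ∷ x≢ z∈ ∷ []) ∷ ((λ { refl → w∉ (proj₁ y∈) }) ∷ y≢z ∷ []) ∷ ((λ { refl → w∉ (proj₁ z∈) }) ∷ []) ∷ [] ∷ [])
        (proj₂ (inM y∈)) (symE {c = c} (proj₂ y∈)) (proj₂ z∈) (symE {c = c} (proj₂ (inM z∈))))
      where
      y∈ : y ∈ M′ × Edge c blue w y
      y∈ = nbrsIn⊆ c blue w M′ (sel (here refl))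
      z∈ : z ∈ M′ × Edge c blue w z
      z∈ = nbrsIn⊆ c blue w M′ (sel (there (here refl)))
      inM : ∀ {v} → v ∈ M′ × Edge c blue w v → v ∈ rest × Edge c blue x v
      inM (v∈ , _) = nbrsIn⊆ c blue x rest (sub v∈)
      x≢ : ∀ {v} → v ∈ M′ × Edge c blue w v → x ≢ v
      x≢ v∈ refl = x∉rest (proj₁ (inM v∈))
    inner : 7 ≤ length M → (∃ λ w → w ∈ M × w ∉ []) → ⊥
    inner large (w , w∈ , _) = meet w (M ∖ (w ∷ [])) (λ { refl → x∉rest (proj₁ (nbrsIn⊆ c blue x rest w∈)) })
      (Unique-∖ (w ∷ []) uM) (λ q → proj₁ (∈-∖⁻ (w ∷ []) q)) (λ q → proj₂ (∈-∖⁻ {ys = M} (w ∷ []) q) (here refl))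
      (ℕ.+-cancelˡ-≤ 1 _ _ (≤-trans large (length-∖ (w ∷ []) uM)))
    outer : length M ≤ 7 → (∃ λ w → w ∈ allFin n × w ∉ x ∷ M) → ⊥
    outer _ (w , _ , w∉) = meet w M (λ r → w∉ (here r)) uM (λ q → q) (λ q → w∉ (there q)) 6≤M

  -- With m = j - 1 the forbidden blue cycle has length 2j, and there are at least 3j - 1 vertices.
  -- The colouring meant is the restriction to a blue neighbourhood.
  module Stable (c : Colouring n) {m : ℕ} (3≤m : 3 ≤ m) (3m+2≤n : 3 * m + 2 ≤ n) (noBlue : ¬ HasCyc c blue (2 + 2 * m))
    (k : ∀ A B → Unique A → Unique B → A # B → Complete c red A B → 1 + m ≤ length A → 2 + m ≤ length B → ⊥) where

    outside : ∀ {b L} → Cyc c b L → List (Fin n)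
    outside C = allFin n ∖ verts C

    Unique-outside : ∀ {b L} (C : Cyc c b L) → Unique (outside C)
    Unique-outside C = Unique-∖ (verts C) (allFin⁺ n)

    outside∉ : ∀ {b L} (C : Cyc c b L) {v} → v ∈ outside C → v ∉ verts C
    outside∉ C q = proj₂ (∈-∖⁻ {ys = allFin n} (verts C) q)

    length-outside : ∀ {b L} (C : Cyc c b L) → n ≤ L + length (outside C)
    length-outside {L = L} C = subst (n ≤_) (cong (_+ length (outside C)) (length-seg (at C) 0 L))
      (≤-trans (≤-reflexive (≡-sym (length-allFin n))) (length-∖ (verts C) (allFin⁺ n)))

    -- Either p = m, or A is the larger part.
    conclusion : ∀ {p y A B} → 3 ≤ p → p ≤ m → n ≤ 2 * p + y → Unique A → Unique B → A # B → Complete c red A B → length A ≤ 1 + 2 * p →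
      y ≤ 1 + length A → 2 * p ≤ 1 + length B → ⊥
    conclusion {p} {y} {A} {B} 3≤p p≤m le uA uB d co small yA pB with ℕ.m≤n⇒m<n∨m≡n p≤m
    ... | inj₂ refl = k A B uA uB d co
        (conclude 0 (3m+2≤n ⊕ le ⊕ yA) (arith₁ p n y (length A)))
        (conclude 0 (3≤m ⊕ pB) (arith₂ p (length B)))
      where
      arith₁ : ∀ p n y a → a + (3 * p + 2 + (n + y)) ≡ 1 + p + (n + (2 * p + y + (1 + a))) + 0
      arith₁ = solve-∀
      arith₂ : ∀ p b → b + (3 + 2 * p) ≡ 2 + p + (p + (1 + b)) + 0
      arith₂ = solve-∀
    ... | inj₁ p<m = k B A uB uA (λ q r → d r q) (Complete-sym {c = c} co)
        (ℕ.*-cancelˡ-≤ 4 (conclude 0 (2 ⊛ half ⊕ 4 ⊛ pB ⊕ 2 ⊛ (3≤p ⊕ p<m)) (arith₃ p m (length B))))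
        (conclude 1 (3m+2≤n ⊕ le ⊕ yA ⊕ 2 ⊛ p<m) (arith₄ p m n y (length A)))
      where
      -- The bound `small` on the blue clique gives n ≤ 4p + 2, so p cannot be far below m.
      half : 3 * m ≤ 4 * p
      half = conclude 0 (3m+2≤n ⊕ le ⊕ yA ⊕ small) (arith p m n y (length A))
        where
        arith : ∀ p m n y a → 4 * p + (3 * m + 2 + (n + (y + a))) ≡ 3 * m + (n + (2 * p + y + (1 + a + (1 + 2 * p)))) + 0
        arith = solve-∀
      arith₃ : ∀ p m b → 4 * b + (2 * (3 * m) + (4 * (2 * p) + 2 * (3 + suc p))) ≡ 4 * (1 + m) + (2 * (4 * p) + (4 * (1 + b) + 2 * (p + m))) + 0
      arith₃ = solve-∀
      arith₄ : ∀ p m n y a → a + (3 * m + 2 + (n + (y + 2 * suc p))) ≡ 2 + m + (n + (2 * p + y + (1 + a + 2 * m))) + 1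
      arith₄ = solve-∀

    -- Induction on r = m - p. A blue cycle of length 2p + 2 is refuted by climbing on, in the end
    -- by `noBlue`; without one, `grow` applies.
    ladder : ∀ r {p′ k′} → r + suc p′ ≡ m → 2 ≤ p′ → suc k′ ≤ p′ → ¬ HasCyc c red (2 * (2 + k′) + 1) → HasCyc c blue (2 * suc p′) → ⊥
    ladder r {p′} {k′} r+p≡m 2≤p′ k≤p noRed h = Grow.grow c k≤p C (up r r+p≡m) noRed Y (Unique-outside C) (outside∉ C)
        (conclude 0 (3m+2≤n ⊕ n≤ ⊕ 3 ⊛ p≤m) (arith (suc p′) m n (length Y)))
        (inj₁ (s≤s 2≤p′))
        (λ A B uA uB d co cl yA pB → conclusion (s≤s 2≤p′) p≤m n≤ uA uB d co
          (ℕ.≮⇒≥ (λ big → up r r+p≡m (cliqueCycle (2 * suc p′) cl uA big))) yA pB)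
      where
      C : Cyc c blue (2 * suc p′)
      C = toCyc h
      Y : List (Fin n)
      Y = outside C
      n≤ : n ≤ 2 * suc p′ + length Y
      n≤ = length-outside C
      p≤m : suc p′ ≤ m
      p≤m = ≤-trans (ℕ.m≤n+m _ r) (≤-reflexive r+p≡m)
      arith : ∀ p m n y → y + (3 * m + 2 + (n + 3 * p)) ≡ 2 + p + (n + (2 * p + y + 3 * m)) + 0
      arith = solve-∀
      arith′ : ∀ p → 2 + 2 * suc p ≡ 2 * suc (suc p)
      arith′ = solve-∀
      up : ∀ r → r + suc p′ ≡ m → ¬ HasCyc c blue (2 + 2 * suc p′)
      up zero refl = noBlue
      up (suc r) e h′ = ladder r (≡-trans (ℕ.+-suc r (suc p′)) e) (ℕ.m≤n⇒m≤1+n 2≤p′) (ℕ.m≤n⇒m≤1+n k≤p) noRed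
        (subst (HasCyc c blue) (arith′ p′) h′)

    -- Induction on k = 2 + i. A red cycle of length 2k - 1 yields through `descend` a blue one of
    -- length 2k, where the ladder begins; if there is none, the case of k - 1 applies. For k = 2
    -- the first blue cycle is a quadrilateral.
    start : ∀ i → 2 + i ≤ m → ¬ HasCyc c red (2 * (2 + i) + 1) → ⊥
    start zero _ noRed = fourCycle c 11≤n noRed λ four → grow₂ (toCyc four)
      where
      11≤n : 11 ≤ n
      11≤n = ≤-trans (ℕ.+-monoˡ-≤ 2 (ℕ.*-monoʳ-≤ 3 3≤m)) 3m+2≤n
      ladder₃ : ¬ HasCyc c blue 6
      ladder₃ with ℕ.m≤n⇒∃[o]m+o≡n 3≤m
      ... | r , e = ladder r {2} {0} (≡-trans (ℕ.+-comm r 3) e) ≤-refl (s≤s z≤n) noRed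
      -- Below the range p ≥ 3 of `ladder`. Here the blue clique found by `grow` has six vertices
      -- and thus contains a blue hexagon.
      grow₂ : Cyc c blue 4 → ⊥
      grow₂ C = Grow.grow c {1} {0} ≤-refl C ladder₃ noRed (outside C) (Unique-outside C) (outside∉ C)
          (≤-trans (s≤s (s≤s (s≤s (s≤s z≤n)))) 7≤Y) (inj₂ (≤-trans (s≤s (s≤s (s≤s (s≤s (s≤s z≤n))))) 7≤Y))
          λ A _ uA _ _ _ cl yA _ → ladder₃ (cliqueCycle 4 cl uA (ℕ.+-cancelˡ-≤ 1 _ _ (≤-trans 7≤Y yA)))
        where
        7≤Y : 7 ≤ length (outside C)
        7≤Y = ℕ.+-cancelˡ-≤ 4 _ _ (≤-trans 11≤n (length-outside C))
    start (suc i) le noRed = start i (≤-trans (ℕ.n≤1+n _) le) λ h → down (toCyc (subst (HasCyc c red) (arith₁ i) h))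
      where
      arith₁ : ∀ i → 2 * (2 + i) + 1 ≡ 5 + 2 * i
      arith₁ = solve-∀
      arith₂ : ∀ i → 2 + (5 + 2 * i) ≡ 2 * (3 + i) + 1
      arith₂ = solve-∀
      arith₃ : ∀ i → 6 + 2 * i ≡ 2 * (3 + i)
      arith₃ = solve-∀
      arith₄ : ∀ i m n y → y + (3 * m + 2 + (n + 3 * (3 + i))) ≡ 6 + i + (n + (5 + 2 * i + y + 3 * m)) + 0
      arith₄ = solve-∀
      next : ¬ HasCyc c blue (6 + 2 * i)
      next h with ℕ.m≤n⇒∃[o]m+o≡n le
      ... | r , e = ladder r {2 + i} {1 + i} (≡-trans (ℕ.+-comm r _) e) (s≤s (s≤s z≤n)) ≤-refl noRed (subst (HasCyc c blue) (arith₃ i) h)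
      down : Cyc c red (5 + 2 * i) → ⊥
      down C = Descend.descend c {i} C (λ h → noRed (subst (HasCyc c red) (arith₂ i) h)) next (outside C) (Unique-outside C) (outside∉ C)
        (conclude 0 (3m+2≤n ⊕ length-outside C ⊕ 3 ⊛ le) (arith₄ i m n (length (outside C))))

  -- Wheels around a bipartite red subgraph

  Spoke : Colouring n → Fin n → Fin n → Set
  Spoke c h v = Edge c blue h v × h ≢ v

  HasWheel : Colouring n → ℕ → Set
  HasWheel {n} c L = Σ (Fin n) λ h → CycIn c blue (Spoke c h) L

  wheel : ∀ {c : Colouring n} {P : Fin n → Set} {L} h → CycIn c blue P L → (∀ {v} → P v → Spoke c h v) → HasWheel c L
  wheel h (cycIn sp e) spoke = h , cycIn (weaken spoke sp) e

  -- The two edges inside O make up for K being one short of half the cycle.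
  twoEdgesCycIn : ∀ {c : Colouring n} {b K O m′} → Complete c b K O → Unique K → Unique O → K # O → TwoEdges c b O →
    3 + m′ ≤ length K → 5 + m′ ≤ length O → CycIn c b (λ v → v ∈ K ⊎ v ∈ O) (8 + 2 * m′)
  twoEdgesCycIn {K = []} _ _ _ _ _ () _
  twoEdgesCycIn {K = _ ∷ []} _ _ _ _ _ (s≤s ()) _
  twoEdgesCycIn {K = _ ∷ _ ∷ []} _ _ _ _ _ (s≤s (s≤s ())) _
  twoEdgesCycIn {n} {c} {b} {K = k₁ ∷ k₂ ∷ K} {O} {m′} co uK uO d (cherry {x} {y} {z} x∈ y∈ z∈ u xy yz) sK sO
    with pick1 {K = O} (x ∷ y ∷ z ∷ []) uO (≤-trans (ℕ.m≤m+n 4 (1 + m′)) sO)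
  ... | o , o∈ , o∉ = cycIn (resize (arith m′) (weaken wk
      (join {Q = k₁ ≡_} (join {P = _∈ x ∷ y ∷ z ∷ []} (spath (cons xy (cons yz (one _))) u refl (λ q → q))
          (symE {c = c} (co (there (here refl)) z∈))
          (zigzag {A = k₂ ∷ K} {B = O ∖ (x ∷ y ∷ z ∷ [])} [] (1 + m′) (λ p q → co (there p) (proj₁ (∈-∖⁻ (x ∷ y ∷ z ∷ []) q)))
            (Unique-tail uK) (Unique-∖ (x ∷ y ∷ z ∷ []) uO) (λ p q → d (there p) (proj₁ (∈-∖⁻ (x ∷ y ∷ z ∷ []) q)))
            (here refl) (∈-∖⁺ (x ∷ y ∷ z ∷ []) o∈ o∉) (λ ()) (λ ())
            (ℕ.≤-pred sK) (ℕ.+-cancelˡ-≤ 3 _ _ (≤-trans sO (length-∖ (x ∷ y ∷ z ∷ []) uO))))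
          (λ { p (inj₁ q , _) → d (there q) (trio p) ; p (inj₂ q , _) → proj₂ (∈-∖⁻ {ys = O} (x ∷ y ∷ z ∷ []) q) p }))
        (symE {c = c} (co (here refl) o∈)) (point refl)
        (λ { (inj₁ p) refl → d (here refl) (trio p) ; (inj₂ (inj₁ q , _)) refl → Unique[x∷xs]⇒x∉xs uK q
           ; (inj₂ (inj₂ q , _)) refl → d (here refl) (proj₁ (∈-∖⁻ (x ∷ y ∷ z ∷ []) q)) }))))
      (co (here refl) x∈)
    where
    arith : ∀ m → 3 + (2 + 2 * (1 + m)) + 1 ≡ 8 + 2 * m
    arith = solve-∀
    trio : ∀ {v} → v ∈ x ∷ y ∷ z ∷ [] → v ∈ O
    trio (here refl) = x∈
    trio (there (here refl)) = y∈
    trio (there (there (here refl))) = z∈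
    wk : ∀ {v} → (v ∈ x ∷ y ∷ z ∷ [] ⊎ ((v ∈ k₂ ∷ K ⊎ v ∈ O ∖ (x ∷ y ∷ z ∷ [])) × v ∉ [])) ⊎ k₁ ≡ v → v ∈ k₁ ∷ k₂ ∷ K ⊎ v ∈ O
    wk (inj₁ (inj₁ p)) = inj₂ (trio p)
    wk (inj₁ (inj₂ (inj₁ q , _))) = inj₁ (there q)
    wk (inj₁ (inj₂ (inj₂ q , _))) = inj₂ (proj₁ (∈-∖⁻ (x ∷ y ∷ z ∷ []) q))
    wk (inj₂ refl) = inj₁ (here refl)
  twoEdgesCycIn {n} {c} {b} {K = k₁ ∷ k₂ ∷ k₃ ∷ K} {O} {m′} co uK uO d (matching {x} {y} {z} {w} x∈ y∈ z∈ w∈ u xy zw) sK sO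
    with pick1 {K = O} (x ∷ y ∷ z ∷ w ∷ []) uO (≤-trans (ℕ.m≤m+n 5 m′) sO)
  ... | o , o∈ , o∉ = cycIn (resize (arith m′) (weaken wk
      (join {Q = k₁ ≡_} (join (four u)
          (symE {c = c} (co (there (there (here refl))) w∈))
          (zigzag {A = k₃ ∷ K} {B = O ∖ xyzw} [] m′ (λ p q → co (there (there p)) (proj₁ (∈-∖⁻ xyzw q)))
            (Unique-tail (Unique-tail uK)) (Unique-∖ xyzw uO) (λ p q → d (there (there p)) (proj₁ (∈-∖⁻ xyzw q)))
            (here refl) (∈-∖⁺ xyzw o∈ o∉) (λ ()) (λ ())
            (ℕ.≤-pred (ℕ.≤-pred sK)) (ℕ.+-cancelˡ-≤ 4 _ _ (≤-trans sO (length-∖ xyzw uO))))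
          (λ { (inj₁ p) (inj₁ q , _) → d (there (there q)) (quad p) ; (inj₁ p) (inj₂ q , _) → proj₂ (∈-∖⁻ {ys = O} xyzw q) p
             ; (inj₂ refl) (inj₁ q , _) → Unique[x∷xs]⇒x∉xs (Unique-tail uK) q
             ; (inj₂ refl) (inj₂ q , _) → d (there (here refl)) (proj₁ (∈-∖⁻ xyzw q)) }))
        (symE {c = c} (co (here refl) o∈)) (point refl)
        (λ { (inj₁ (inj₁ p)) refl → d (here refl) (quad p) ; (inj₁ (inj₂ refl)) refl → Unique[x∷xs]⇒x∉xs uK (here refl)
           ; (inj₂ (inj₁ q , _)) refl → Unique[x∷xs]⇒x∉xs uK (there q)
           ; (inj₂ (inj₂ q , _)) refl → d (here refl) (proj₁ (∈-∖⁻ xyzw q)) }))))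
      (co (here refl) x∈)
    where
    xyzw : List (Fin n)
    xyzw = x ∷ y ∷ z ∷ w ∷ []
    arith : ∀ m → 5 + (2 + 2 * m) + 1 ≡ 8 + 2 * m
    arith = solve-∀
    quad : ∀ {v} → v ∈ xyzw → v ∈ O
    quad (here refl) = x∈
    quad (there (here refl)) = y∈
    quad (there (there (here refl))) = z∈
    quad (there (there (there (here refl)))) = w∈
    four : Unique xyzw → SPath c b (λ v → v ∈ xyzw ⊎ k₂ ≡ v) x w 5
    four ((x≢y ∷ x≢z ∷ x≢w ∷ []) ∷ (y≢z ∷ y≢w ∷ []) ∷ (z≢w ∷ []) ∷ _) = spath
      (cons xy (cons (symE {c = c} (co (there (here refl)) y∈)) (cons (co (there (here refl)) z∈) (cons zw (one _)))))
      ((x≢y ∷ (λ r → k₂≢ x∈ (≡-sym r)) ∷ x≢z ∷ x≢w ∷ []) ∷ ((λ r → k₂≢ y∈ (≡-sym r)) ∷ y≢z ∷ y≢w ∷ [])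
        ∷ (k₂≢ z∈ ∷ k₂≢ w∈ ∷ []) ∷ (z≢w ∷ []) ∷ [] ∷ []) refl
      (λ { (here e) → inj₁ (here e) ; (there (here e)) → inj₁ (there (here e)) ; (there (there (here e))) → inj₂ (≡-sym e)
         ; (there (there (there (here e)))) → inj₁ (there (there (here e)))
         ; (there (there (there (there (here e))))) → inj₁ (there (there (there (here e)))) })
      where
      k₂≢ : ∀ {v} → v ∈ O → k₂ ≢ v
      k₂≢ v∈ refl = d (there (here refl)) v∈
    wk : ∀ {v} → ((v ∈ xyzw ⊎ k₂ ≡ v) ⊎ ((v ∈ k₃ ∷ K ⊎ v ∈ O ∖ xyzw) × v ∉ [])) ⊎ k₁ ≡ v → v ∈ k₁ ∷ k₂ ∷ k₃ ∷ K ⊎ v ∈ O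
    wk (inj₁ (inj₁ (inj₁ p))) = inj₂ (quad p)
    wk (inj₁ (inj₁ (inj₂ refl))) = inj₁ (there (here refl))
    wk (inj₁ (inj₂ (inj₁ q , _))) = inj₁ (there (there q))
    wk (inj₁ (inj₂ (inj₂ q , _))) = inj₂ (proj₁ (∈-∖⁻ xyzw q))
    wk (inj₂ refl) = inj₁ (here refl)

  -- Here j = 4 + `m′`, k = 2 + `k′`, and there are at least 4j + 1 vertices.
  module Extend (c : Colouring n) {m′ k′ : ℕ} (k≤m : 2 + k′ ≤ 3 + m′) (size : 17 + 4 * m′ ≤ n)
    (noRed : ¬ HasCyc c red (2 * (2 + k′) + 1)) (noWheel : ¬ HasWheel c (8 + 2 * m′)) where

    bipWheel : ∀ {A B} h → Complete c blue A B → Unique A → Unique B → A # B → 4 + m′ ≤ length A → 4 + m′ ≤ length B →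
      (∀ {v} → v ∈ A → Spoke c h v) → (∀ {v} → v ∈ B → Spoke c h v) → ⊥
    bipWheel h co uA uB d la lb sA sB = noWheel (subst (HasWheel c) (arith m′)
      (wheel h (bipCycIn (3 + m′) co uA uB d la lb) [ sA , sB ]′))
      where
      arith : ∀ m → 2 + 2 * (3 + m) ≡ 8 + 2 * m
      arith = solve-∀

    twoEdgesWheel : ∀ {K O} h → Complete c blue K O → Unique K → Unique O → K # O → TwoEdges c blue O →
      3 + m′ ≤ length K → 5 + m′ ≤ length O → (∀ {v} → v ∈ K → Spoke c h v) → (∀ {v} → v ∈ O → Spoke c h v) → ⊥
    twoEdgesWheel h co uK uO d two lK lO sK sO = noWheel (wheel h (twoEdgesCycIn co uK uO d two lK lO) [ sK , sO ]′)

    private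
      arith₀ : ∀ k → 2 + 2 * suc k + 1 ≡ 2 * (2 + k) + 1
      arith₀ = solve-∀

    module Exact (A B : List (Fin n)) (uA : Unique A) (uB : Unique B) (A#B : A # B) (redAB : Complete c red A B)
      (lA : length A ≡ 4 + m′) (lB : length B ≡ 5 + m′) where

      private
        kA : 2 + k′ ≤ length A
        kA = ≤-trans k≤m (≤-trans (ℕ.n≤1+n _) (≤-reflexive (≡-sym lA)))
        kB : 3 + k′ ≤ length B
        kB = ≤-trans (s≤s k≤m) (≤-trans (ℕ.n≤1+n _) (≤-reflexive (≡-sym lB)))
        kA′ : 3 + k′ ≤ length A
        kA′ = ≤-trans (s≤s k≤m) (≤-reflexive (≡-sym lA))

        blueB : Clique c blue B
        blueB x∈ y∈ x≢y = ¬red⇒blue c λ e → noRed (subst (HasCyc c red) (arith₀ k′)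
          (bipCycle+edge (suc k′) redAB uA uB A#B x∈ y∈ x≢y e kA kB))

        blueA : Clique c blue A
        blueA x∈ y∈ x≢y = ¬red⇒blue c λ e → noRed (subst (HasCyc c red) (arith₀ k′)
          (bipCycle+edge (suc k′) (Complete-sym {c = c} redAB) uB uA (λ p q → A#B q p) x∈ y∈ x≢y e (≤-trans (ℕ.n≤1+n _) kB) kA′))

        blueToB? : ∀ v → Dec (All.All (λ b → col c v b ≡ blue) B)
        blueToB? v = All.all? (λ b → col c v b Bool.≟ blue) B

        -- The vertices outside `A` and `B`: those of `O` are blue to all of `B`; those of `X` have
        -- a red neighbour in `B` and are therefore blue to all of `A`.
        O X : List (Fin n)
        O = filter blueToB? (allFin n ∖ B)
        X = allFin n ∖ (A ++ B ++ O)

        uO : Unique O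
        uO = Uniq.filter⁺ blueToB? (Unique-∖ B (allFin⁺ n))

        O⇒ : ∀ {v} → v ∈ O → v ∉ B × (∀ {b} → b ∈ B → Edge c blue v b)
        O⇒ v∈ with ∈-filter⁻ blueToB? {xs = allFin n ∖ B} v∈
        ... | p , al = proj₂ (∈-∖⁻ {ys = allFin n} B p) , All.lookup al

        uX : Unique X
        uX = Unique-∖ (A ++ B ++ O) (allFin⁺ n)

        X∉A : ∀ {v} → v ∈ X → v ∉ A
        X∉A v∈ q = proj₂ (∈-∖⁻ {ys = allFin n} (A ++ B ++ O) v∈) (∈-++⁺ˡ q)

        X∉B : ∀ {v} → v ∈ X → v ∉ B
        X∉B v∈ q = proj₂ (∈-∖⁻ {ys = allFin n} (A ++ B ++ O) v∈) (∈-++⁺ʳ A (∈-++⁺ˡ q))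

        redNbr : ∀ {v} → v ∈ X → ∃ λ b → b ∈ B × Edge c red v b
        redNbr {v} v∈ with find (¬All⇒Any¬ (λ b → col c v b Bool.≟ blue) B λ al →
          proj₂ (∈-∖⁻ {ys = allFin n} (A ++ B ++ O) v∈)
            (∈-++⁺ʳ A (∈-++⁺ʳ B (∈-filter⁺ blueToB? (∈-∖⁺ B (∈-allFin v) (X∉B v∈)) al))))
        ... | b , b∈ , ¬e = b , b∈ , ¬blue⇒red c ¬e

        blueToA : ∀ {v a} → v ∈ X → a ∈ A → Edge c blue v a
        blueToA v∈ a∈ = ¬red⇒blue c λ e → noRed (subst (HasCyc c red) (arith₀ k′) (bipCycle+vertex (suc k′) redAB uA uB A#B
          a∈ (proj₁ (proj₂ (redNbr v∈))) (X∉A v∈) (X∉B v∈) e (proj₂ (proj₂ (redNbr v∈))) kA (≤-trans (ℕ.n≤1+n _) kB)))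

        -- x , x′ , b′ , … , b closes up through the red bipartite graph.
        redPair : ∀ {x x′ b b′} → x ∈ X → x′ ∈ X → x ≢ x′ → Edge c red x x′ → b ∈ B → b′ ∈ B →
          Edge c red x b → Edge c red x′ b′ → b ≡ b′
        redPair {x} {x′} {b} {b′} x∈ x′∈ x≢x′ xx′ b∈ b′∈ xb x′b′ with b ≟ b′
        ... | yes e = e
        ... | no b≢b′ with pick1 [] uA (≤-trans (s≤s z≤n) kA)
        ... | a , a∈ , _ = ⊥-elim (noRed (subst (HasCyc c red) (arith k′) (hasCyc
            (join (spath {P = _∈ x ∷ x′ ∷ b′ ∷ []} (cons xx′ (cons x′b′ (one _)))
                ((x≢x′ ∷ (λ { refl → X∉B x∈ b′∈ }) ∷ []) ∷ ((λ { refl → X∉B x′∈ b′∈ }) ∷ []) ∷ [] ∷ []) refl (λ q → q))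
              (symE {c = c} (redAB a∈ b′∈))
              (zigzag {B = B ∖ (b′ ∷ [])} [] k′ (λ p q → redAB p (proj₁ (∈-∖⁻ (b′ ∷ []) q))) uA (Unique-∖ (b′ ∷ []) uB)
                (λ p q → A#B p (proj₁ (∈-∖⁻ (b′ ∷ []) q))) a∈ (∈-∖⁺ (b′ ∷ []) b∈ (λ { (here e) → b≢b′ e })) (λ ()) (λ ())
                (≤-trans (ℕ.n≤1+n _) kA) (≤-trans (ℕ.n≤1+n _) (ℕ.+-cancelˡ-≤ 1 _ _ (≤-trans kB (length-∖ (b′ ∷ []) uB)))))
              (λ { (here refl) (inj₁ q , _) → X∉A x∈ q ; (here refl) (inj₂ q , _) → X∉B x∈ (proj₁ (∈-∖⁻ (b′ ∷ []) q))
                 ; (there (here refl)) (inj₁ q , _) → X∉A x′∈ q ; (there (here refl)) (inj₂ q , _) → X∉B x′∈ (proj₁ (∈-∖⁻ (b′ ∷ []) q))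
                 ; (there (there (here refl))) (inj₁ q , _) → A#B q b′∈
                 ; (there (there (here refl))) (inj₂ q , _) → proj₂ (∈-∖⁻ {ys = B} (b′ ∷ []) q) (here refl) }))
            (symE {c = c} xb))))
          where
          arith : ∀ k → 3 + (2 + 2 * k) ≡ 2 * (2 + k) + 1
          arith = solve-∀

        -- Otherwise a vertex of `B` is a hub, with a rim alternating between j other vertices of
        -- `B` and j vertices of `O`.
        fewO : length O ≤ 3 + m′
        fewO with ℕ.≤-<-connex (4 + m′) (length O)
        ... | inj₂ lt = ℕ.≤-pred lt
        ... | inj₁ le with pick1 [] uB (≤-trans (s≤s z≤n) kB)
        ... | b , b∈ , _ = ⊥-elim (bipWheel {B ∖ (b ∷ [])} {O} b
            (λ p q → symE {c = c} (proj₂ (O⇒ q) (proj₁ (∈-∖⁻ (b ∷ []) p)))) (Unique-∖ (b ∷ []) uB) uO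
            (λ p q → proj₁ (O⇒ q) (proj₁ (∈-∖⁻ (b ∷ []) p)))
            (ℕ.+-cancelˡ-≤ 1 _ _ (≤-trans (≤-reflexive (≡-sym lB)) (length-∖ (b ∷ []) uB))) le
            (λ p → blueB b∈ (proj₁ (∈-∖⁻ (b ∷ []) p)) (b≢ p) , b≢ p)
            (λ q → symE {c = c} (proj₂ (O⇒ q) b∈) , λ { refl → proj₁ (O⇒ q) b∈ }))
          where
          b≢ : ∀ {v} → v ∈ B ∖ (b ∷ []) → b ≢ v
          b≢ p refl = proj₂ (∈-∖⁻ {ys = B} (b ∷ []) p) (here refl)

        total : n ≤ 9 + 2 * m′ + length O + length X
        total = conclude 0 (≤-trans (≤-reflexive (≡-sym (length-allFin n))) (length-∖ (A ++ B ++ O) (allFin⁺ n))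
            ⊕ ≤-reflexive (≡-trans (length-++ A) (cong₂ _+_ lA (≡-trans (length-++ B) (cong (_+ length O) lB)))))
          (arith n m′ (length O) (length X) (length (A ++ B ++ O)))
          where
          arith : ∀ n m o x s → 9 + 2 * m + o + x + (n + s) ≡ n + (s + x + (4 + m + (5 + m + o))) + 0
          arith = solve-∀

        manyX : 5 + m′ ≤ length X
        manyX = conclude 0 (size ⊕ total ⊕ fewO) (arith n m′ (length O) (length X))
          where
          arith : ∀ n m o x → x + (17 + 4 * m + (n + o)) ≡ 5 + m + (n + (9 + 2 * m + o + x + (3 + m))) + 0
          arith = solve-∀

        noTwo : TwoEdges c blue X → ⊥
        noTwo two with pick1 [] uA (≤-trans (s≤s z≤n) kA)
        ... | a , a∈ , _ = twoEdgesWheel {A ∖ (a ∷ [])} {X} a (λ p q → symE {c = c} (blueToA q (proj₁ (∈-∖⁻ (a ∷ []) p))))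
            (Unique-∖ (a ∷ []) uA) uX (λ p q → X∉A q (proj₁ (∈-∖⁻ (a ∷ []) p))) two
            (ℕ.+-cancelˡ-≤ 1 _ _ (≤-trans (≤-reflexive (≡-sym lA)) (length-∖ (a ∷ []) uA))) manyX
            (λ p → blueA a∈ (proj₁ (∈-∖⁻ (a ∷ []) p)) (a≢ p) , a≢ p)
            (λ q → symE {c = c} (blueToA q a∈) , λ { refl → X∉A q a∈ })
          where
          a≢ : ∀ {v} → v ∈ A ∖ (a ∷ []) → a ≢ v
          a≢ p refl = proj₂ (∈-∖⁻ {ys = A} (a ∷ []) p) (here refl)

        -- By `redPair` all of `X₁` has the same single red neighbour `b₀` in `B`. If `O` has at
        -- most one vertex, then `X₁` is so large that with `b₀` it contains a red cycle of length
        -- 2k + 1. Otherwise two vertices of `O` with `b₀` between them give the two blue edges for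
        -- a wheel with its hub in `B`.
        redX : ∀ X₁ → Unique X₁ → (∀ {v} → v ∈ X₁ → v ∈ X) → length X ≤ 1 + length X₁ → Clique c red X₁ →
          ∀ {x x′} → x ∈ X₁ → x′ ∈ X₁ → x ≢ x′ → ⊥
        redX X₁ u₁ sub le cl {x} {x′} x∈ x′∈ x≢x′ = split (ℕ.≤-<-connex 2 (length O))
          where
          b₀ : Fin n
          b₀ = proj₁ (redNbr (sub x∈))
          b∈ : b₀ ∈ B
          b∈ = proj₁ (proj₂ (redNbr (sub x∈)))
          xb : Edge c red x b₀
          xb = proj₂ (proj₂ (redNbr (sub x∈)))
          onlyB : ∀ {y b′} → y ∈ X₁ → y ≢ x → b′ ∈ B → Edge c red y b′ → b′ ≡ b₀
          onlyB y∈ y≢x b′∈ e = redPair (sub y∈) (sub x∈) y≢x (cl y∈ x∈ y≢x) b′∈ b∈ e xb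
          toB : ∀ {y} → y ∈ X₁ → Edge c red y b₀
          toB {y} y∈ with y ≟ x
          ... | yes refl = xb
          ... | no y≢x with redNbr (sub y∈)
          ... | b′ , b′∈ , e = subst (Edge c red y) (onlyB y∈ y≢x b′∈ e) e
          awayB : ∀ {y b′} → y ∈ X₁ → b′ ∈ B → b′ ≢ b₀ → Edge c blue y b′
          awayB {y} y∈ b′∈ b′≢b with y ≟ x
          ... | no y≢x = ¬red⇒blue c λ e → b′≢b (onlyB y∈ y≢x b′∈ e)
          ... | yes refl = ¬red⇒blue c λ e → b′≢b (redPair (sub x∈) (sub x′∈) x≢x′ (cl x∈ x′∈ x≢x′)
                b′∈ b∈ e (toB x′∈))
          split : 2 ≤ length O ⊎ length O < 2 → ⊥
          split (inj₂ few) = noRed (subst (HasCyc c red) (arith₁ k′) (cliqueCycle {K = b₀ ∷ X₁} (3 + 2 * k′) redK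
              (Unique-∷ (λ q → X∉B (sub q) b∈) u₁)
              (conclude 0 (size ⊕ total ⊕ few ⊕ le ⊕ 2 ⊛ k≤m) (arith₂ n m′ k′ (length O) (length X) (length X₁)))))
            where
            arith₁ : ∀ k → 2 + (3 + 2 * k) ≡ 2 * (2 + k) + 1
            arith₁ = solve-∀
            arith₂ : ∀ n m k o x y → 1 + y + (17 + 4 * m + (n + (suc o + (x + 2 * (2 + k))))) ≡
              2 + (3 + 2 * k) + (n + (9 + 2 * m + o + x + (2 + (1 + y + 2 * (3 + m))))) + 0
            arith₂ = solve-∀
            redK : Clique c red (b₀ ∷ X₁)
            redK (here refl) (here refl) ne = ⊥-elim (ne refl)
            redK (here refl) (there q) _ = symE {c = c} (toB q)
            redK (there q) (here refl) _ = toB q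
            redK (there q) (there r) ne = cl q r ne
          split (inj₁ two) with pick2 [] uO two | pick1 {K = B} (b₀ ∷ []) uB (≤-trans (s≤s (s≤s z≤n)) kB)
          ... | o₁ , o₂ , (o₁∈ , _) , (o₂∈ , _) , o₁≢o₂ | h , h∈ , h∉ =
            twoEdgesWheel {B ∖ (h ∷ b₀ ∷ [])} {o₁ ∷ b₀ ∷ o₂ ∷ X₁} h
              (λ p q → symE {c = c} (toRim (proj₁ (∈-∖⁻ (h ∷ b₀ ∷ []) p)) (λ { refl → proj₂ (∈-∖⁻ {ys = B} (h ∷ b₀ ∷ []) p) (there (here refl)) }) q))
              (Unique-∖ (h ∷ b₀ ∷ []) uB)
              (((≢b o₁∈) ∷ o₁≢o₂ ∷ All.tabulate (λ q → λ { refl → O∉X o₁∈ (sub q) }))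
                ∷ ((λ r → ≢b o₂∈ (≡-sym r)) ∷ All.tabulate (λ q → λ { refl → X∉B (sub q) b∈ }))
                ∷ All.tabulate (λ q → λ { refl → O∉X o₂∈ (sub q) }) ∷ u₁)
              (λ { p (here refl) → proj₁ (O⇒ o₁∈) (proj₁ (∈-∖⁻ (h ∷ b₀ ∷ []) p))
                 ; p (there (here refl)) → proj₂ (∈-∖⁻ {ys = B} (h ∷ b₀ ∷ []) p) (there (here refl))
                 ; p (there (there (here refl))) → proj₁ (O⇒ o₂∈) (proj₁ (∈-∖⁻ (h ∷ b₀ ∷ []) p))
                 ; p (there (there (there q))) → X∉B (sub q) (proj₁ (∈-∖⁻ (h ∷ b₀ ∷ []) p)) })
              (cherry (here refl) (there (here refl)) (there (there (here refl)))
                ((≢b o₁∈ ∷ o₁≢o₂ ∷ []) ∷ ((λ r → ≢b o₂∈ (≡-sym r)) ∷ []) ∷ [] ∷ [])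
                (proj₂ (O⇒ o₁∈) b∈) (symE {c = c} (proj₂ (O⇒ o₂∈) b∈)))
              (ℕ.+-cancelˡ-≤ 2 _ _ (≤-trans (≤-reflexive (≡-sym lB)) (length-∖ (h ∷ b₀ ∷ []) uB)))
              (≤-trans (ℕ.≤-trans manyX le) (s≤s (ℕ.m≤n+m (length X₁) 2)))
              (λ p → blueB h∈ (proj₁ (∈-∖⁻ (h ∷ b₀ ∷ []) p)) (h≢ p) , h≢ p)
              (λ q → symE {c = c} (toRim h∈ (λ r → h∉ (here r)) q) , λ { refl → rim∉ q })
            where
            ≢b : ∀ {o} → o ∈ O → o ≢ b₀
            ≢b o∈ refl = proj₁ (O⇒ o∈) b∈
            O∉X : ∀ {v} → v ∈ O → v ∈ X → ⊥
            O∉X o∈ q = proj₂ (∈-∖⁻ {ys = allFin n} (A ++ B ++ O) q) (∈-++⁺ʳ A (∈-++⁺ʳ B o∈))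
            h≢ : ∀ {v} → v ∈ B ∖ (h ∷ b₀ ∷ []) → h ≢ v
            h≢ p refl = proj₂ (∈-∖⁻ {ys = B} (h ∷ b₀ ∷ []) p) (here refl)
            toRim : ∀ {u v} → u ∈ B → u ≢ b₀ → v ∈ o₁ ∷ b₀ ∷ o₂ ∷ X₁ → Edge c blue v u
            toRim u∈ u≢b (here refl) = proj₂ (O⇒ o₁∈) u∈
            toRim u∈ u≢b (there (here refl)) = blueB b∈ u∈ (λ r → u≢b (≡-sym r))
            toRim u∈ u≢b (there (there (here refl))) = proj₂ (O⇒ o₂∈) u∈
            toRim u∈ u≢b (there (there (there q))) = awayB q u∈ u≢b
            rim∉ : h ∈ o₁ ∷ b₀ ∷ o₂ ∷ X₁ → ⊥
            rim∉ (here refl) = proj₁ (O⇒ o₁∈) h∈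
            rim∉ (there (here r)) = h∉ (here r)
            rim∉ (there (there (here refl))) = proj₁ (O⇒ o₂∈) h∈
            rim∉ (there (there (there q))) = X∉B (sub q) h∈

      exact : ⊥
      exact = fewEdges blue X uX noTwo λ X₁ u₁ sub le cl →
        apart X₁ u₁ sub le cl (pick2 [] u₁ (≤-trans (s≤s (s≤s z≤n)) (ℕ.+-cancelˡ-≤ 1 _ _ (≤-trans manyX le))))
        where
        apart : ∀ X₁ → Unique X₁ → (∀ {v} → v ∈ X₁ → v ∈ X) → length X ≤ 1 + length X₁ → Clique c red X₁ →
          (∃ λ x → ∃ λ x′ → (x ∈ X₁ × x ∉ []) × (x′ ∈ X₁ × x′ ∉ []) × x ≢ x′) → ⊥
        apart X₁ u₁ sub le cl (_ , _ , (x∈ , _) , (x′∈ , _) , x≢x′) = redX X₁ u₁ sub le cl x∈ x′∈ x≢x′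

    extend : ∀ A B → Unique A → Unique B → A # B → Complete c red A B → 4 + m′ ≤ length A → 5 + m′ ≤ length B → ⊥
    extend A B uA uB d co la lb with pick [] (4 + m′) uA la | pick [] (5 + m′) uB lb
    ... | mkPick A₁ u₁ s₁ _ l₁ | mkPick B₁ u₂ s₂ _ l₂ = Exact.exact A₁ B₁ u₁ u₂ (λ p q → d (s₁ p) (s₂ q)) (λ p q → co (s₁ p) (s₂ q)) l₁ l₂

  -- Rotations of a longest path

  -- The predicate need not be decidable, so a largest element is available only for a proof of `⊥`.
  -- The fuel `f` covers the distance to the bound.
  maximise : ∀ (P : ℕ → Set₁) B → (∀ {l} → P l → l ≤ B) → ∀ {l} → P l → (∀ {l} → P l → (∀ {l′} → l < l′ → ¬ P l′) → ⊥) → ⊥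
  maximise P B bounded {l} p k = go B l (ℕ.m≤n+m B l) p
    where
    go : ∀ f l → B ≤ l + f → P l → ⊥
    go zero l le p = k p λ lt q → ℕ.<-irrefl refl (≤-trans lt (≤-trans (bounded q) (≤-trans le (≤-reflexive (ℕ.+-identityʳ l)))))
    go (suc f) l le p = k p λ {l′} lt q → go f l′ (≤-trans le (≤-trans (≤-reflexive (ℕ.+-suc l f)) (ℕ.+-monoˡ-≤ f lt))) q

  -- The continuation of a path that has reached y.
  data Tail (c : Colouring n) (b : Bool) (y : Fin n) : List (Fin n) → Set where
    stop : Tail c b y []
    go   : ∀ {r rest z} → Edge c b y r → Path c b r rest z → Tail c b y rest

  extendTail : ∀ {a xs y rest} → Path c b a xs y → Tail c b y rest → ∃ λ z → Path c b a (xs ++ rest) z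
  extendTail {xs = xs} p stop = _ , subst (λ l → Path _ _ _ l _) (≡-sym (++-identityʳ xs)) p
  extendTail p (go e q) = _ , Path-++ p e q

  record Reach (c : Colouring n) (b : Bool) (a y : Fin n) (xs : List (Fin n)) : Set where
    constructor reach
    field
      {upto rest} : List (Fin n)
      path : Path c b a upto y
      tail : Tail c b y rest
      eq   : xs ≡ upto ++ rest

  reachIn : ∀ {a xs z y} → Path c b a xs z → y ∈ xs → Reach c b a y xs
  reachIn (one a) (here refl) = reach (one a) stop refl
  reachIn (cons {a} e p) (here refl) = reach (one a) (go e p) refl
  reachIn (cons {a} e p) (there q) with reachIn p q
  ... | reach p′ t refl = reach (cons e p′) t refl

  reachTail : ∀ {y rest v} → Tail c b y rest → v ∈ rest → ∃ λ r → Edge c b y r × Reach c b r v rest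
  reachTail (go e p) q = _ , e , reachIn p q

  nonempty : ∀ {a xs z} → Path c b a xs z → 1 ≤ length xs
  nonempty (one _) = s≤s z≤n
  nonempty (cons _ _) = s≤s z≤n

  -- The list meant is w ∷ r; a vertex is taken when its successor is a red neighbour of a.
  preds : Colouring n → Fin n → Fin n → List (Fin n) → List (Fin n)
  preds c a w [] = []
  preds c a w (w′ ∷ r) with col c a w′
  ... | true = w ∷ preds c a w′ r
  ... | false = preds c a w′ r

  length-preds : ∀ (c : Colouring n) a w r → length (preds c a w r) ≡ length (nbrsIn c red a r)
  length-preds c a w [] = refl
  length-preds c a w (w′ ∷ r) with col c a w′
  ... | true = cong suc (length-preds c a w′ r)
  ... | false = length-preds c a w′ r

  preds⊆ : ∀ (c : Colouring n) a w r {v} → v ∈ preds c a w r → v ∈ w ∷ r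
  preds⊆ c a w (w′ ∷ r) p with col c a w′
  preds⊆ c a w (w′ ∷ r) (here e) | true = here e
  preds⊆ c a w (w′ ∷ r) (there p) | true = there (preds⊆ c a w′ r p)
  preds⊆ c a w (w′ ∷ r) p | false = there (preds⊆ c a w′ r p)

  Unique-preds : ∀ (c : Colouring n) a w r → Unique (w ∷ r) → Unique (preds c a w r)
  Unique-preds c a w [] u = []
  Unique-preds c a w (w′ ∷ r) u with col c a w′
  ... | true = Unique-∷ (λ p → Unique[x∷xs]⇒x∉xs u (preds⊆ c a w′ r p)) (Unique-preds c a w′ r (Unique-tail u))
  ... | false = Unique-preds c a w′ r (Unique-tail u)

  record Pivot (c : Colouring n) (a x y w : Fin n) (xs : List (Fin n)) : Set where
    constructor pivot
    field
      {before after} : List (Fin n)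
      {w′} : Fin n
      left  : Path c red x before w
      right : Path c red w′ after y
      chord : Edge c red a w′
      eq    : xs ≡ before ++ after

  headed : ∀ {a xs z} → Path c b a xs z → ∃ λ r → xs ≡ a ∷ r
  headed (one a) = [] , refl
  headed (cons {xs = xs} e p) = xs , refl

  pivotAt : ∀ {a x y w} r → Path c red x (x ∷ r) y → w ∈ preds c a x r → Pivot c a x y w (x ∷ r)
  pivotAt {c = c} {a = a} (w′ ∷ r) (cons e p) q with headed p
  ... | _ , refl with col c a w′ in chord
  pivotAt (w′ ∷ r) (cons e p) (here refl) | _ , refl | true = pivot (one _) p chord refl
  pivotAt {a = a} (w′ ∷ r) (cons {x} e p) (there q) | _ , refl | true with pivotAt {a = a} r p q
  ... | pivot l r′ ch eq = pivot (cons e l) r′ ch (cong (x ∷_) eq)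
  pivotAt {a = a} (w′ ∷ r) (cons {x} e p) q | _ , refl | false with pivotAt {a = a} r p q
  ... | pivot l r′ ch eq = pivot (cons e l) r′ ch (cong (x ∷_) eq)

  module Rotate (c : Colouring n) (W : List (Fin n)) (uW : Unique W) {d L : ℕ}
    (degree : ∀ {x} → x ∈ W → 1 + d ≤ length (nbrsIn c red x (W ∖ (x ∷ []))))
    (noLong : ∀ {l} → L < l → ¬ HasCyc c red l) where

    record LongPath (l : ℕ) : Set₁ where
      constructor longPath
      field
        {a z} : Fin n
        {xs} : List (Fin n)
        path : Path c red a xs z
        uniq : Unique xs
        sub  : ∀ {v} → v ∈ xs → v ∈ W
        len  : length xs ≡ l

    -- A path whose first vertex has a red edge to a later vertex y: the part up to y closes into a
    -- cycle, and the rest hangs from y. Among the longest paths the loop is maximised.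
    record Lollipop (l s : ℕ) : Set₁ where
      constructor lollipop
      field
        {a y} : Fin n
        {loop rest} : List (Fin n)
        path : Path c red a loop y
        closing : Edge c red y a
        tail : Tail c red y rest
        uniq : Unique (loop ++ rest)
        sub : ∀ {v} → v ∈ loop ++ rest → v ∈ W
        len : length (loop ++ rest) ≡ l
        len-loop : length loop ≡ s

    -- `F` will be the vertex set of the largest loop, hence at most `L`, and `I` the set of new
    -- starting vertices that rotations of the loop produce.
    Result : Set
    Result = ∀ I F → Unique I → Unique F → (∀ {v} → v ∈ I → v ∈ F) → (∀ {v} → v ∈ F → v ∈ W) → 1 + d ≤ length I → length F ≤ L →
      (∀ {w v} → w ∈ I → v ∈ W → v ≢ w → Edge c red w v → v ∈ F) → ⊥

    module _ (k : Result) {l : ℕ} (longest : ∀ {l′} → l < l′ → ¬ LongPath l′) where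

      onPath : ∀ {a xs z v} → Path c red a xs z → Unique xs → (∀ {v} → v ∈ xs → v ∈ W) → length xs ≡ l → v ∈ W → Edge c red a v → ¬ (v ∉ xs)
      onPath p u sub len v∈ e v∉ = longest ≤-refl (longPath (cons (symE {c = c} e) p) (Unique-∷ v∉ u)
        (λ { (here refl) → v∈ ; (there q) → sub q }) (cong suc len))

      module _ {s : ℕ} (lol : Lollipop l s) (largest : ∀ {s′} → s < s′ → ¬ Lollipop l s′) where
        open Lollipop lol

        private
          inLoop : ∀ {v} → v ∈ loop ++ rest → v ∉ rest → v ∈ loop
          inLoop q v∉ = [ (λ r → r) , (λ r → ⊥-elim (v∉ r)) ]′ (∈-++⁻ loop q)

          decide : ∀ {v} (xs : List (Fin n)) → ¬ (v ∉ xs) → v ∈ xs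
          decide {v} xs f with v ∈? xs
            where open import Data.List.Membership.DecPropositional (_≟_ {n}) using (_∈?_)
          ... | yes q = q
          ... | no q = ⊥-elim (f q)

          -- A rotation keeps the vertex set of the loop, so an edge from its new end into the rest would enlarge the loop.
          noChord : ∀ {w loop′ v} → Path c red w loop′ y → Unique (loop′ ++ rest) → (∀ {v} → v ∈ loop′ ++ rest → v ∈ W) →
            length loop′ ≡ s → v ∈ rest → Edge c red w v → ⊥
          noChord {loop′ = loop′} p u sub′ len′ v∈ e with reachTail tail v∈
          ... | r , yr , reach {upto} {rest′} q t refl = largest
            (subst (s <_) (≡-sym (length-++ loop′)) (≤-trans (≤-reflexive (≡-trans (cong suc (≡-sym len′)) (ℕ.+-comm 1 _))) (ℕ.+-monoʳ-≤ (length loop′) (nonempty q))))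
            (lollipop (Path-++ p yr q) (symE {c = c} e) t (subst Unique (≡-sym assoc) u)
              (λ {x} x∈ → sub′ (subst (x ∈_) assoc x∈))
              (≡-trans (cong length assoc) (≡-trans (length-++ loop′) (≡-trans (cong (_+ length (upto ++ rest′)) (≡-trans len′ (≡-sym len-loop))) (≡-trans (≡-sym (length-++ loop)) len))))
              refl)
            where
            assoc : (loop′ ++ upto) ++ rest′ ≡ loop′ ++ upto ++ rest′
            assoc = ++-assoc loop′ upto rest′

          uLoop : Unique loop
          uLoop = Unique-++⁻ˡ loop uniq

          startNbrs : ∀ {v} → v ∈ W → Edge c red a v → v ∈ loop
          startNbrs {v} v∈ e = inLoop (decide (loop ++ rest) (onPath (proj₂ (extendTail path tail)) uniq sub len v∈ e))
            λ q → noChord path uniq sub len-loop q e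

          -- The rotated path runs from w back to a, over the chord to w′ and on to y. It has the
          -- same loop vertices and the same rest, so both maximality arguments made for a hold for
          -- w.
          predNbrs : ∀ {w v} → Pivot c a a y w loop → v ∈ W → Edge c red w v → v ∈ loop
          predNbrs {w} {v} (pivot {before} {after} left right chord eq) v∈ e with reversePath left
          ... | before′ , back , lenB , subB , uB =
            fromNew (decide (loop′ ++ rest) (onPath (proj₂ (extendTail turn tail)) u′ sub′
                (≡-trans (length-++ loop′) (≡-trans (cong (_+ length rest) len′) (≡-trans (≡-sym (length-++ loop)) len))) v∈ e))
            where
            loop′ : List (Fin n)
            loop′ = before′ ++ after
            turn : Path c red w loop′ y
            turn = Path-++ back chord right
            toOld : ∀ {x} → x ∈ loop′ → x ∈ loop
            toOld {x} q = subst (x ∈_) (≡-sym eq) ([ (λ r → ∈-++⁺ˡ (subB r)) , (λ r → ∈-++⁺ʳ before r) ]′ (∈-++⁻ before′ q))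
            u₀ : Unique (before ++ after)
            u₀ = subst Unique eq uLoop
            u′ : Unique (loop′ ++ rest)
            u′ = Unique-++ (Unique-++ (uB (Unique-++⁻ˡ before u₀)) (Unique-++⁻ʳ before u₀) (λ p q → Unique-++⁻# before u₀ (subB p) q))
              (Unique-++⁻ʳ loop uniq) (λ p q → Unique-++⁻# loop uniq (toOld p) q)
            sub′ : ∀ {x} → x ∈ loop′ ++ rest → x ∈ W
            sub′ q = [ (λ r → sub (∈-++⁺ˡ (toOld r))) , (λ r → sub (∈-++⁺ʳ loop r)) ]′ (∈-++⁻ loop′ q)
            len′ : length loop′ ≡ length loop
            len′ = ≡-trans (length-++ before′) (≡-trans (cong (_+ length after) lenB) (≡-trans (≡-sym (length-++ before)) (cong length (≡-sym eq))))
            fromNew : v ∈ loop′ ++ rest → v ∈ loop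
            fromNew q = [ toOld , (λ r → ⊥-elim (noChord turn u′ sub′ (≡-trans len′ len-loop) r e)) ]′ (∈-++⁻ loop′ q)

          manyPreds : ∀ r → loop ≡ a ∷ r → 1 + d ≤ length (preds c a a r)
          manyPreds r eq = ≤-trans (degree a∈W) (≤-trans (Unique-⊆-length (Unique-nbrsIn c red a (Unique-∖ (a ∷ []) uW)) into)
              (≤-reflexive (≡-sym (length-preds c a a r))))
            where
            a∈W : a ∈ W
            a∈W = sub (∈-++⁺ˡ (start∈ path))
            into : ∀ {v} → v ∈ nbrsIn c red a (W ∖ (a ∷ [])) → v ∈ nbrsIn c red a r
            into {v} q with nbrsIn⊆ c red a (W ∖ (a ∷ [])) q
            ... | v∈ , e with ∈-∖⁻ {ys = W} (a ∷ []) v∈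
            ... | v∈W , v∉ with subst (v ∈_) eq (startNbrs v∈W e)
            ... | here r = ⊥-elim (v∉ (here r))
            ... | there p = ∈-filter⁺ (λ v → col c a v Bool.≟ red) p e

          finishAt : ∀ r → loop ≡ a ∷ r → ⊥
          finishAt r eq = k (preds c a a r) loop (Unique-preds c a a r (subst Unique eq uLoop)) uLoop
            (λ q → subst (_ ∈_) (≡-sym eq) (preds⊆ c a a r q)) (λ q → sub (∈-++⁺ˡ q)) (manyPreds r eq)
            (ℕ.≮⇒≥ (λ big → noLong big (hasCyc (spath {P = _∈ loop} path uLoop refl (λ q → q)) closing)))
            (λ w∈ v∈ _ e → predNbrs (subst (Pivot c a a y _) (≡-sym eq) (pivotAt r (subst (λ xs → Path c red a xs y) eq path) w∈)) v∈ e)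

        finish : ⊥
        finish = finishAt (proj₁ (headed path)) (proj₂ (headed path))

      private
        fromPath : LongPath l → ⊥
        fromPath (longPath {a} {z} {xs} p u sub len) = onward (pick1 [] (Unique-nbrsIn c red a (Unique-∖ (a ∷ []) uW)) (≤-trans (s≤s z≤n) (degree (sub (start∈ p)))))
          where
          open import Data.List.Membership.DecPropositional (_≟_ {n}) using (_∈?_)
          maximal : ∀ {y} → y ∈ xs → Edge c red a y → ⊥
          maximal y∈ e with reachIn p y∈
          ... | reach {upto} q t refl = maximise (Lollipop l) (length W)
            (λ lol → ≤-trans (≤-reflexive (≡-sym (Lollipop.len-loop lol)))
               (Unique-⊆-length (Unique-++⁻ˡ (Lollipop.loop lol) (Lollipop.uniq lol)) (λ r → Lollipop.sub lol (∈-++⁺ˡ r))))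
            (lollipop q (symE {c = c} e) t u sub len refl) finish
          onward : (∃ λ y → y ∈ nbrsIn c red a (W ∖ (a ∷ [])) × y ∉ []) → ⊥
          onward (y , y∈ , _) with nbrsIn⊆ c red a (W ∖ (a ∷ [])) y∈
          ... | y∈′ , e with y ∈? xs
          ... | yes q = maximal q e
          ... | no q = onPath p u sub len (proj₁ (∈-∖⁻ (a ∷ []) y∈′)) e q

      fromLongest : LongPath l → ⊥
      fromLongest = fromPath

    rotate : ∀ {x} → x ∈ W → Result → ⊥
    rotate {x} x∈ k = maximise LongPath (length W)
      (λ p → ≤-trans (≤-reflexive (≡-sym (LongPath.len p))) (Unique-⊆-length (LongPath.uniq p) (LongPath.sub p)))
      (longPath (one x) ([] ∷ []) (λ { (here refl) → x∈ }) refl)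
      (λ p longest → fromLongest k longest p)

  -- Copies, restrictions and the red graph

  lookup-injective : ∀ {A : Set} {xs : List A} → Unique xs → ∀ i j → lookup xs i ≡ lookup xs j → i ≡ j
  lookup-injective {xs = x ∷ xs} u Fin.zero Fin.zero _ = refl
  lookup-injective {xs = x ∷ xs} u Fin.zero (Fin.suc j) e = ⊥-elim (Unique[x∷xs]⇒x∉xs u (subst (_∈ xs) (≡-sym e) (∈-lookup j)))
  lookup-injective {xs = x ∷ xs} u (Fin.suc i) Fin.zero e = ⊥-elim (Unique[x∷xs]⇒x∉xs u (subst (_∈ xs) e (∈-lookup i)))
  lookup-injective {xs = x ∷ xs} u (Fin.suc i) (Fin.suc j) e = cong Fin.suc (lookup-injective (Unique-tail u) i j e)

  data Next {t : ℕ} (i j : Fin t) : Set where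
    succ : suc (toℕ i) ≡ toℕ j → Next i j
    wrap : toℕ j ≡ 0 → suc (toℕ i) ≡ t → Next i j

  ≡ᵇ-true : ∀ {m n} → (m ≡ᵇ n) ≡ true → m ≡ n
  ≡ᵇ-true {m} {n} e = ℕ.≡ᵇ⇒≡ m n (subst T (≡-sym e) _)

  cycAdj-true : ∀ {t} (i j : Fin t) → cycAdj t i j ≡ true → Next i j ⊎ Next j i
  cycAdj-true {t} i j e = [ (λ p → inj₁ (next i j p)) , (λ p → inj₂ (next j i p)) ]′ (∨-true e)
    where
    next : ∀ (a b : Fin t) → ((suc (toℕ a) ≡ᵇ toℕ b) ∨ ((toℕ b ≡ᵇ 0) ∧ (suc (toℕ a) ≡ᵇ t))) ≡ true → Next a b
    next a b e = [ (λ p → succ (≡ᵇ-true p)) , (λ p → wrap (≡ᵇ-true (proj₁ (∧-true {toℕ b ≡ᵇ 0} p))) (≡ᵇ-true (proj₂ (∧-true {toℕ b ≡ᵇ 0} p)))) ]′ (∨-true e)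

  cycAdj-irrefl : ∀ {t} → 3 ≤ t → ∀ (i j : Fin t) → cycAdj t i j ≡ true → i ≢ j
  cycAdj-irrefl {t} le i .i e refl = [ loop , loop ]′ (cycAdj-true i i e)
    where
    loop : Next i i → ⊥
    loop (succ q) = ℕ.1+n≢n q
    loop (wrap p q) = ℕ.<⇒≢ (≤-trans (s≤s (s≤s z≤n)) le) (≡-trans (cong suc (≡-sym p)) q)

  first-vertex : ∀ {a xs z} → Path c b a xs z → ∀ j → toℕ j ≡ 0 → lookup xs j ≡ a
  first-vertex (one a) Fin.zero _ = refl
  first-vertex (cons _ _) Fin.zero _ = refl

  step-edge : ∀ {a xs z} → Path c b a xs z → ∀ i j → suc (toℕ i) ≡ toℕ j → Edge c b (lookup xs i) (lookup xs j)
  step-edge (one a) Fin.zero Fin.zero ()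
  step-edge {c = c} {b = b} (cons {a} e p) Fin.zero (Fin.suc j) q = subst (Edge c b a) (≡-sym (first-vertex p j (ℕ.suc-injective (≡-sym q)))) e
  step-edge (cons e p) (Fin.suc i) (Fin.suc j) q = step-edge p i j (ℕ.suc-injective q)

  last-vertex : ∀ {a xs z} → Path c b a xs z → ∀ j → suc (toℕ j) ≡ length xs → lookup xs j ≡ z
  last-vertex (one a) Fin.zero _ = refl
  last-vertex (cons e p) Fin.zero q with p
  last-vertex (cons e p) Fin.zero () | one _
  last-vertex (cons e p) Fin.zero () | cons _ (one _)
  last-vertex (cons e p) Fin.zero () | cons _ (cons _ _)
  last-vertex (cons e p) (Fin.suc j) q = last-vertex p j (ℕ.suc-injective q)

  record Copy (c : Colouring n) (b : Bool) (P : Fin n → Set) (L : ℕ) : Set where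
    field
      f : Fin L → Fin n
      inj : Injective _≡_ _≡_ f
      adj⇒ : ∀ i j → cycAdj L i j ≡ true → Edge c b (f i) (f j)
      in-P : ∀ i → P (f i)

  toCopy : ∀ {P : Fin n → Set} {L} → CycIn c b P L → Copy c b P L
  toCopy {n = n} {c = c} {b = b} (cycIn {a} {z} (spath {xs} p u refl al) e) = record
    { f = lookup xs ; inj = λ {i} {j} → lookup-injective u i j
    ; adj⇒ = λ i j q → [ edge-of i j , (λ r → symE {c = c} (edge-of j i r)) ]′ (cycAdj-true i j q)
    ; in-P = λ i → al (∈-lookup i) }
    where
    edge-of : ∀ i j → Next i j → Edge c b (lookup xs i) (lookup xs j)
    edge-of i j (succ q) = step-edge p i j q
    edge-of i j (wrap q r) = subst (λ v → Edge c b v (lookup xs j)) (≡-sym (last-vertex p i r))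
      (subst (Edge c b z) (≡-sym (first-vertex p j q)) e)

  cycleCopy : ∀ {L} → HasCyc c b L → ContainsCopy (cycAdj L) (λ u v → col c u v ≡ b)
  cycleCopy (hasCyc sp e) = f , inj , adj⇒
    where open Copy (toCopy (cycIn sp e))

  wheelCopy : ∀ {L} → HasWheel c L → ContainsCopy (wheelAdj L) (λ u v → col c u v ≡ false)
  wheelCopy {n} {c} {L} (h , cyc) = g , g-inj , g-adj
    where
    open Copy (toCopy cyc)
    g : Fin (suc L) → Fin n
    g Fin.zero = h
    g (Fin.suc i) = f i
    g-inj : Injective _≡_ _≡_ g
    g-inj {Fin.zero} {Fin.zero} _ = refl
    g-inj {Fin.zero} {Fin.suc j} e = ⊥-elim (proj₂ (in-P j) e)
    g-inj {Fin.suc i} {Fin.zero} e = ⊥-elim (proj₂ (in-P i) (≡-sym e))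
    g-inj {Fin.suc i} {Fin.suc j} e = cong Fin.suc (inj e)
    g-adj : ∀ i j → wheelAdj L i j ≡ true → col c (g i) (g j) ≡ false
    g-adj Fin.zero (Fin.suc j) _ = proj₁ (in-P j)
    g-adj (Fin.suc i) Fin.zero _ = symE {c = c} (proj₁ (in-P i))
    g-adj (Fin.suc i) (Fin.suc j) e = adj⇒ i j e

  restrict : Colouring n → (U : List (Fin n)) → Colouring (length U)
  restrict c U = record { col = λ i j → col c (lookup U i) (lookup U j) ; colSym = λ i j → colSym c (lookup U i) (lookup U j) }

  mapPath : ∀ (U : List (Fin n)) {a xs z} → Path (restrict c U) b a xs z → Path c b (lookup U a) (map (lookup U) xs) (lookup U z)
  mapPath U (one a) = one (lookup U a)
  mapPath U (cons e p) = cons e (mapPath U p)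

  Unique-map : ∀ {U : List (Fin n)} {xs} → Unique U → Unique xs → Unique (map (lookup U) xs)
  Unique-map uU = Uniq.map⁺ (λ {i} {j} → lookup-injective uU i j)

  ∈-map-lookup : ∀ {U : List (Fin n)} {xs v} → v ∈ map (lookup U) xs → v ∈ U
  ∈-map-lookup {U = U} q with ∈-map⁻ (lookup U) q
  ... | i , _ , refl = ∈-lookup i

  mapCyc : ∀ {U : List (Fin n)} {L} → Unique U → HasCyc (restrict c U) b L → CycIn c b (_∈ U) L
  mapCyc {U = U} uU (hasCyc (spath {xs} p u l _) e) = cycIn (spath (mapPath U p) (Unique-map uU u) (≡-trans (length-map (lookup U) xs) l) ∈-map-lookup) e

  -- A colouring also assigns values on the diagonal, which must not become loops.
  redGraph : Colouring n → Graph n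
  redGraph {n} c = record
    { adj = λ u v → ⌊ ¬? (u ≟ v) ⌋ ∧ col c u v
    ; sym = λ u v → cong₂ _∧_ (flip u v) (colSym c u v)
    ; irrefl = loop }
    where
    flip : ∀ u v → ⌊ ¬? (u ≟ v) ⌋ ≡ ⌊ ¬? (v ≟ u) ⌋
    flip u v with u ≟ v | v ≟ u
    ... | yes _ | yes _ = refl
    ... | no _ | no _ = refl
    ... | yes p | no q = ⊥-elim (q (≡-sym p))
    ... | no p | yes q = ⊥-elim (p (≡-sym q))
    loop : ∀ v → ⌊ ¬? (v ≟ v) ⌋ ∧ col c v v ≡ false
    loop v with v ≟ v
    ... | yes _ = refl
    ... | no q = ⊥-elim (q refl)

  Adj⁻ : ∀ {c : Colouring n} {u v} → Adj (redGraph c) u v → u ≢ v × Edge c red u v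
  Adj⁻ {u = u} {v} e with u ≟ v
  Adj⁻ () | yes _
  Adj⁻ e | no q = q , e

  Adj⁺ : ∀ {c : Colouring n} {u v} → u ≢ v → Edge c red u v → Adj (redGraph c) u v
  Adj⁺ {u = u} {v} q e with u ≟ v
  ... | yes p = ⊥-elim (q p)
  ... | no _ = e

  redCycle : ∀ {c : Colouring n} {L} → 3 ≤ L → HasCyc c red L → HasCycle (redGraph c) L
  redCycle {c = c} 3≤L (hasCyc sp e) = 3≤L , f , inj ,
      λ i j q → Adj⁺ {c = c} (λ r → cycAdj-irrefl 3≤L i j q (inj r)) (adj⇒ i j q)
    where open Copy (toCopy (cycIn sp e))

  redDegree : Colouring n → Fin n → ℕ
  redDegree {n} c v = length (nbrsIn c red v (allFin n ∖ (v ∷ [])))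

  redDegree≤deg : ∀ (c : Colouring n) v → redDegree c v ≤ deg (redGraph c) v
  redDegree≤deg {n} c v = ≤-trans
    (Unique-⊆-length (Unique-nbrsIn c red v (Unique-∖ (v ∷ []) (allFin⁺ n))) into)
    (≤-reflexive (tally (allFin n)))
    where
    adjacent? : ∀ u → Dec (adj (redGraph c) v u ≡ true)
    adjacent? u = adj (redGraph c) v u Bool.≟ true
    into : ∀ {u} → u ∈ nbrsIn c red v (allFin n ∖ (v ∷ [])) → u ∈ filter adjacent? (allFin n)
    into {u} q with nbrsIn⊆ c red v (allFin n ∖ (v ∷ [])) q
    ... | u∈ , e = ∈-filter⁺ adjacent? (∈-allFin u) (Adj⁺ {c = c} (λ { refl → proj₂ (∈-∖⁻ {ys = allFin n} (v ∷ []) u∈) (here refl) }) e)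
    tally : ∀ xs → length (filter adjacent? xs) ≡ sum (map (λ u → if adj (redGraph c) v u then 1 else 0) xs)
    tally [] = refl
    tally (u ∷ xs) with adj (redGraph c) v u
    ... | true = cong suc (tally xs)
    ... | false = tally xs

  avoiding⇒twoConnected : (G : Graph n) → 3 ≤ n → (∀ x u v → u ≢ x → v ≢ x → PathIn G (λ w → w ≢ x) u v) → TwoConnected G
  avoiding⇒twoConnected {n} G le avoiding = le , through , avoiding
    where
    forget : ∀ {P : Fin n → Set} {u v} → PathIn G P u v → PathIn G (λ _ → ⊤) u v
    forget (PathIn.here _) = PathIn.here tt
    forget (PathIn.step _ e p) = PathIn.step tt e (forget p)
    through : Connected G
    through u v with pick1 (u ∷ v ∷ []) (allFin⁺ n) (≤-trans le (≤-reflexive (≡-sym (length-allFin n))))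
    ... | x , _ , x∉ = forget (avoiding x u v (λ { refl → x∉ (here refl) }) (λ { refl → x∉ (there (here refl)) }))

  -- In terms of j = 4 + m′ the sizes are 4j + 1, 2j and 3j − 1.
  module BigBlueDegree (c : Colouring n) {m′ i : ℕ} (k≤m : 2 + i ≤ 3 + m′) (size : 17 + 4 * m′ ≤ n)
    (noRed : ¬ HasCyc c red (2 * (2 + i) + 1)) (noWheel : ¬ HasWheel c (8 + 2 * m′)) where

    -- A blue cycle of length 2j inside `U` would be the rim of a wheel with hub `v`. So
    -- `Stable.start` applies inside `U`, and the red bipartite graph it finds is refuted by
    -- `extend` in the whole colouring.
    bigBlueDegree : ∀ v U → Unique U → 11 + 3 * m′ ≤ length U → (∀ {u} → u ∈ U → Spoke c v u) → ⊥
    bigBlueDegree v U uU le spoke = Stable.start (restrict c U) {3 + m′} (s≤s (s≤s (s≤s z≤n))) (subst (_≤ length U) (arith₁ m′) le)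
        (λ h → noWheel (subst (HasWheel c) (arith₂ m′) (wheel v (mapCyc uU h) spoke)))
        (λ A B uA uB d co la lb → Extend.extend c k≤m size noRed noWheel (map (lookup U) A) (map (lookup U) B)
          (Unique-map uU uA) (Unique-map uU uB)
          (λ p q → disjoint d (∈-map⁻ (lookup U) p) (∈-map⁻ (lookup U) q))
          (λ p q → complete co (∈-map⁻ (lookup U) p) (∈-map⁻ (lookup U) q))
          (≤-trans la (≤-reflexive (≡-sym (length-map (lookup U) A)))) (≤-trans lb (≤-reflexive (≡-sym (length-map (lookup U) B)))))
        i k≤m (λ h → noRed (toHasCyc (mapCyc uU h)))
      where
      arith₁ : ∀ m → 11 + 3 * m ≡ 3 * (3 + m) + 2
      arith₁ = solve-∀
      arith₂ : ∀ m → 2 + 2 * (3 + m) ≡ 8 + 2 * m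
      arith₂ = solve-∀
      disjoint : ∀ {A B w} → A # B → (∃ λ x → x ∈ A × w ≡ lookup U x) → (∃ λ y → y ∈ B × w ≡ lookup U y) → ⊥
      disjoint d (x , x∈ , refl) (y , y∈ , e) with lookup-injective uU x y e
      ... | refl = d x∈ y∈
      complete : ∀ {A B w w′} → Complete (restrict c U) red A B → (∃ λ x → x ∈ A × w ≡ lookup U x) →
        (∃ λ y → y ∈ B × w′ ≡ lookup U y) → Edge c red w w′
      complete co (x , x∈ , refl) (y , y∈ , refl) = co x∈ y∈

  -- Small blue degrees

  -- Double negation passes through finite quantifiers. In a proof of `⊥` reachability may therefore
  -- be treated as decided.
  ¬¬∀ : ∀ {n} {P : Fin n → Set} → (∀ i → ¬ ¬ P i) → ¬ ¬ (∀ i → P i)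
  ¬¬∀ {zero} h k = k λ ()
  ¬¬∀ {suc n} h k = h Fin.zero λ p → ¬¬∀ (λ i → h (Fin.suc i)) λ q → k λ { Fin.zero → p ; (Fin.suc i) → q i }

  ¬¬dec : ∀ {n} (P : Fin n → Set) → ¬ ¬ (∀ i → Dec (P i))
  ¬¬dec P = ¬¬∀ λ i k → k (no λ p → k (yes p))

  length-∖⁻ : ∀ {ys : List (Fin n)} xs → Unique xs → Unique ys → (∀ {v} → v ∈ xs → v ∈ ys) → length xs + length (ys ∖ xs) ≤ length ys
  length-∖⁻ {ys = ys} xs ux uy sub = ≤-trans (≤-reflexive (≡-sym (length-++ xs)))
    (Unique-⊆-length (Unique-++ ux (Unique-∖ xs uy) (λ p q → proj₂ (∈-∖⁻ {ys = ys} xs q) p))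
      (λ q → [ sub , (λ r → proj₁ (∈-∖⁻ xs r)) ]′ (∈-++⁻ xs q)))

  suc-pred-allFin : ∀ {n} (v : Fin n) → n ≤ 1 + length (allFin n ∖ (v ∷ []))
  suc-pred-allFin {n} v = ≤-trans (≤-reflexive (≡-sym (length-allFin n))) (length-∖ (v ∷ []) (allFin⁺ n))

  module Dense (c : Colouring n) {m L : ℕ} (noLong : ∀ {l} → L < l → ¬ HasCyc c red l) (L≤2m : L ≤ 2 * m) where

    -- Write the size of `W` as 2 + m + d; then d ≥ m, and red degrees are at least 1 + d. Rotation
    -- gives `I` and `F` with room for a vertex z outside `F`, whose red neighbours avoid `I`. So z,
    -- its red neighbours and `I` need 2d + 3 places, more than `W` has.
    dense : ∀ W → Unique W → 2 * m + 2 ≤ length W → (∀ {z} → z ∈ W → length (nbrsIn c blue z (W ∖ (z ∷ []))) ≤ m) → ⊥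
    dense W uW le few with ℕ.m≤n⇒∃[o]m+o≡n (≤-trans (conclude m (z≤n {0}) (arith₀ m)) le)
      where
      arith₀ : ∀ m → 2 * m + 2 + 0 ≡ 2 + m + 0 + m
      arith₀ = solve-∀
    ... | d , eq with pick1 [] uW (≤-trans (s≤s z≤n) (≤-reflexive eq))
    ... | x , x∈ , _ = Rotate.rotate c W uW degree noLong x∈ escape
      where
      degree : ∀ {x} → x ∈ W → 1 + d ≤ length (nbrsIn c red x (W ∖ (x ∷ [])))
      degree {x} x∈ = conclude 0 (few x∈ ⊕ length-∖ (x ∷ []) uW ⊕ ≤-reflexive (≡-sym (nbrsIn-split c x (W ∖ (x ∷ [])))) ⊕ ≤-reflexive eq)
        (arith m d (length (nbrsIn c red x (W ∖ (x ∷ [])))) (length (nbrsIn c blue x (W ∖ (x ∷ [])))) (length W) (length (W ∖ (x ∷ []))))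
        where
        arith : ∀ m d r b w w′ → r + (b + (w + (w′ + (2 + m + d)))) ≡ 1 + d + (m + (1 + w′ + (r + b + w))) + 0
        arith = solve-∀
      escape : Rotate.Result c W uW degree noLong
      escape I F uI uF I⊆F F⊆W sI sF closed with pick1 F uW (≤-trans (s≤s (≤-trans sF L≤2m)) (≤-trans (ℕ.n≤1+n _) (≤-trans (≤-reflexive (ℕ.+-comm 2 (2 * m))) le)))
      ... | z , z∈ , z∉F = refute 0 (le ⊕ ≤-reflexive (≡-sym eq) ⊕ degree z∈ ⊕ sI ⊕ ≤-trans (≤-reflexive (≡-sym (length-++ R))) fits)
          (arith m d (length R) (length I) (length W))
        where
        R : List (Fin n)
        R = nbrsIn c red z (W ∖ (z ∷ []))
        R⊆ : ∀ {v} → v ∈ R → (v ∈ W × v ∉ z ∷ []) × Edge c red z v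
        R⊆ q with nbrsIn⊆ c red z (W ∖ (z ∷ [])) q
        ... | p , e = ∈-∖⁻ {ys = W} (z ∷ []) p , e
        R#I : R # I
        R#I q i = z∉F (closed i z∈ (λ r → proj₂ (proj₁ (R⊆ q)) (here (≡-sym r))) (symE {c = c} (proj₂ (R⊆ q))))
        z∉ : z ∉ R ++ I
        z∉ q = [ (λ r → proj₂ (proj₁ (R⊆ r)) (here refl)) , (λ i → z∉F (I⊆F i)) ]′ (∈-++⁻ R q)
        fits : length (R ++ I) ≤ 1 + m + d
        fits = ℕ.≤-pred (≤-trans (Unique-⊆-length (Unique-∷ z∉ (Unique-++ (Unique-nbrsIn c red z (Unique-∖ (z ∷ []) uW)) uI R#I))
          (λ { (here refl) → z∈ ; (there q) → [ (λ r → proj₁ (proj₁ (R⊆ r))) , (λ i → F⊆W (I⊆F i)) ]′ (∈-++⁻ R q) }))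
          (≤-reflexive (≡-sym eq)))
        arith : ∀ m d r i w → 2 * m + 2 + (w + (1 + d + (1 + d + (r + i)))) ≡ w + (2 + m + d + (r + (i + (1 + m + d)))) + suc 0
        arith = solve-∀

  -- `Enough h e` stands for αh + β ≤ e. Passing only two consequences keeps rational numbers out of
  -- the combinatorics.
  module SmallBlueDegree (c : Colouring n) {m′ k′ d : ℕ} (k≤m : 2 + k′ ≤ 3 + m′) (1≤k : 1 ≤ k′) (size : 17 + 4 * m′ ≤ n) (n≡ : n ≡ 3 * (4 + m′) + d)
    (degree : ∀ v → 1 + d ≤ redDegree c v)
    (noRed : ¬ HasCyc c red (2 * (2 + k′) + 1)) (noRedCopy : ¬ ContainsCopy (cycAdj (2 * (2 + k′) + 1)) (λ u v → col c u v ≡ true))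
    (noWheel : ¬ HasWheel c (8 + 2 * m′))
    (Enough : ℕ → ℕ → Set)
    (enough-all : ∀ {e} → 1 + d ≤ e → Enough n e)
    (enough-part : ∀ {h e} → h + 4 ≤ n → d ≤ e → Enough h e)
    (admissible : ∀ h (G : Graph h) → TwoConnected G → ¬ Bipartite G → (∀ v → Enough h (deg G v)) →
       ∀ t s → 6 ≤ t → t ≤ s → HasCycle G s → HasCycle G t) where

    private
      j≤d : 5 + m′ ≤ d
      j≤d = conclude 0 (size ⊕ ≤-reflexive n≡) (arith n m′ d)
        where
        arith : ∀ n m d → d + (17 + 4 * m + n) ≡ 5 + m + (n + (3 * (4 + m) + d)) + 0
        arith = solve-∀

      L : ℕ
      L = 2 * (2 + k′)

      L≤ : L ≤ 2 * (3 + m′)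
      L≤ = 2 ⊛ k≤m

      6≤t : 6 ≤ L + 1
      6≤t = ≤-trans (2 ⊛ s≤s (s≤s 1≤k)) (ℕ.m≤m+n L 1)

      cycle≤ : ∀ {h} (c′ : Colouring h) → TwoConnected (redGraph c′) → ¬ Bipartite (redGraph c′) →
        (∀ v → Enough h (deg (redGraph c′) v)) → ¬ HasCycle (redGraph c′) (L + 1) → ∀ {l} → L < l → ¬ HasCyc c′ red l
      cycle≤ c′ 2conn ¬bip enough none {l} lt h = none (admissible _ (redGraph c′) 2conn ¬bip enough (L + 1) l 6≤t
        (subst (_≤ l) (ℕ.+-comm 1 L) lt)
        (redCycle {c = c′} (≤-trans (s≤s (s≤s (s≤s z≤n))) (≤-trans 6≤t (subst (_≤ l) (ℕ.+-comm 1 L) lt))) h))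

      bipWheel : ∀ {A B} h → Complete c blue A B → Unique A → Unique B → A # B → 4 + m′ ≤ length A → 4 + m′ ≤ length B →
        (∀ {v} → v ∈ A → Spoke c h v) → (∀ {v} → v ∈ B → Spoke c h v) → ⊥
      bipWheel = Extend.bipWheel c k≤m size noRed noWheel

    module _ (A B : List (Fin n)) (uA : Unique A) (uB : Unique B) (A#B : A # B) (blueAB : Complete c blue A B) (big : 4 + m′ ≤ length A) where

      -- Together with `A`, too many blue neighbours of z inside `B` would contain the rim of a
      -- wheel with hub z.
      fewBlue : ∀ {z} → z ∈ B → length (nbrsIn c blue z (B ∖ (z ∷ []))) ≤ 3 + m′
      fewBlue {z} z∈ = ℕ.≤-pred (ℕ.≰⇒> λ le → bipWheel {A} {nbrsIn c blue z (B ∖ (z ∷ []))} z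
        (λ p q → blueAB p (proj₁ (inB q))) uA (Unique-nbrsIn c blue z (Unique-∖ (z ∷ []) uB)) (λ p q → A#B p (proj₁ (inB q))) big le
        (λ p → symE {c = c} (blueAB p z∈) , λ { refl → A#B p z∈ })
        (λ q → proj₂ (nbrsIn⊆ c blue z (B ∖ (z ∷ [])) q) , λ { refl → proj₂ (inB q) (here refl) }))
        where
        inB : ∀ {v} → v ∈ nbrsIn c blue z (B ∖ (z ∷ [])) → v ∈ B × v ∉ z ∷ []
        inB q = ∈-∖⁻ {ys = B} (z ∷ []) (proj₁ (nbrsIn⊆ c blue z (B ∖ (z ∷ [])) q))

    -- Rotation is used twice. The first one yields `I` and `F`, and the complement of `F` is joined
    -- to `I` in blue; by `fewBlue` its blue degrees are small, so `dense` rotates again inside this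
    -- complement.
    connected : TwoConnected (redGraph c) → ¬ Bipartite (redGraph c) → ⊥
    connected 2conn ¬bip with pick1 [] (allFin⁺ n) (≤-trans (s≤s z≤n) (≤-trans size (≤-reflexive (≡-sym (length-allFin n)))))
    ... | x , x∈ , _ = Rotate.rotate c (allFin n) (allFin⁺ n) (λ {v} _ → degree v) noLong x∈ λ I F uI uF I⊆F F⊆ sI sF closed →
        Dense.dense c noLong L≤ (allFin n ∖ F) (Unique-∖ F (allFin⁺ n))
          (conclude 3 (size ⊕ ≤-trans (≤-reflexive (≡-sym (length-allFin n))) (length-∖ F (allFin⁺ n)) ⊕ ≤-trans sF L≤)
            (arith n m′ (length F) (length (allFin n ∖ F))))
          (fewBlue I (allFin n ∖ F) uI (Unique-∖ F (allFin⁺ n)) (λ p q → proj₂ (∈-∖⁻ {ys = allFin n} F q) (I⊆F p))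
            (λ {w} {v} p q → ¬red⇒blue c λ e → proj₂ (∈-∖⁻ {ys = allFin n} F q)
              (closed p (∈-allFin v) (λ { refl → proj₂ (∈-∖⁻ {ys = allFin n} F q) (I⊆F p) }) e))
            (≤-trans (≤-trans (ℕ.n≤1+n _) j≤d) (≤-trans (ℕ.n≤1+n _) sI)))
      where
      noLong : ∀ {l} → L < l → ¬ HasCyc c red l
      noLong = cycle≤ c 2conn ¬bip (λ v → enough-all (≤-trans (degree v) (redDegree≤deg c v)))
        λ (_ , f , inj , h) → noRedCopy (f , inj , λ a b e → proj₂ (Adj⁻ {c = c} (h a b e)))
      arith : ∀ n m f w → w + (17 + 4 * m + (n + f)) ≡ 2 * (3 + m) + 2 + (n + (f + w + 2 * (3 + m))) + 3
      arith = solve-∀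

    bipartite : Bipartite (redGraph c) → ⊥
    bipartite (side , proper) = [ large , large ]′ half
      where
      class : Bool → List (Fin n)
      class b = filter (λ v → side v Bool.≟ b) (allFin n)
      half : 9 + 2 * m′ ≤ length (class true) ⊎ 9 + 2 * m′ ≤ length (class false)
      half with ℕ.≤-<-connex (9 + 2 * m′) (length (class true)) | ℕ.≤-<-connex (9 + 2 * m′) (length (class false))
      ... | inj₁ le | _ = inj₁ le
      ... | inj₂ _ | inj₁ le = inj₂ le
      ... | inj₂ lt | inj₂ lt′ = ⊥-elim (refute 0 (size ⊕ ≤-reflexive (≡-sym (≡-trans (filter-split side (allFin n)) (length-allFin n))) ⊕ lt ⊕ lt′)
          (arith n m′ (length (class true)) (length (class false))))
        where
        arith : ∀ n m a b → 17 + 4 * m + (n + (suc a + suc b)) ≡ n + (a + b + (9 + 2 * m + (9 + 2 * m))) + suc 0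
        arith = solve-∀
      large : ∀ {b} → 9 + 2 * m′ ≤ length (class b) → ⊥
      large {b} le with pick1 [] (Uniq.filter⁺ (λ v → side v Bool.≟ b) (allFin⁺ n)) (≤-trans (s≤s z≤n) le)
      ... | h , h∈ , _ = noWheel (wheel h (cliqueCycIn (6 + 2 * m′) (λ p q → blueClass (proj₁ (∈-∖⁻ (h ∷ []) p)) (proj₁ (∈-∖⁻ (h ∷ []) q)))
          (Unique-∖ (h ∷ []) uClass) (ℕ.+-cancelˡ-≤ 1 _ _ (≤-trans le (length-∖ (h ∷ []) uClass))))
          λ p → blueClass h∈ (proj₁ (∈-∖⁻ (h ∷ []) p)) (h≢ p) , h≢ p)
        where
        uClass : Unique (class b)
        uClass = Uniq.filter⁺ (λ v → side v Bool.≟ b) (allFin⁺ n)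
        h≢ : ∀ {v} → v ∈ class b ∖ (h ∷ []) → h ≢ v
        h≢ p refl = proj₂ (∈-∖⁻ {ys = class b} (h ∷ []) p) (here refl)
        blueClass : Clique c blue (class b)
        blueClass {u} {v} p q u≢v = ¬red⇒blue c λ e → proper u v (Adj⁺ {c = c} u≢v e)
          (≡-trans (proj₂ (∈-filter⁻ (λ v → side v Bool.≟ b) {xs = allFin n} p)) (≡-sym (proj₂ (∈-filter⁻ (λ v → side v Bool.≟ b) {xs = allFin n} q))))

    -- One side of a separation: in its restriction every vertex keeps all but one of its red neighbours.
    module Side (H : List (Fin n)) (uH : Unique H) (x : Fin n) (small : length H + 4 ≤ n)
      (inside : ∀ {u v} → u ∈ H → v ≢ x → Edge c red u v → v ∈ H)
      (few : ∀ {z} → z ∈ H → length (nbrsIn c blue z (H ∖ (z ∷ []))) ≤ 3 + m′) (large : 8 + 2 * m′ ≤ length H) where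

      private
        h : ℕ
        h = length H

        c′ : Colouring h
        c′ = restrict c H

        others : Fin h → List (Fin h)
        others i = allFin h ∖ (i ∷ [])

        lookup-others : ∀ {i j} → j ∈ others i → lookup H j ∈ H ∖ (lookup H i ∷ [])
        lookup-others {i} {j} q = ∈-∖⁺ {ys = H} (lookup H i ∷ []) (∈-lookup {xs = H} j) λ { (here e) →
          proj₂ (∈-∖⁻ {ys = allFin h} (i ∷ []) q) (here (lookup-injective uH j i e)) }

        few′ : ∀ i → length (nbrsIn c′ blue i (others i)) ≤ 3 + m′
        few′ i = ≤-trans (≤-trans (≤-reflexive (≡-sym (length-map (lookup H) (nbrsIn c′ blue i (others i)))))
            (Unique-⊆-length (Unique-map uH (Unique-nbrsIn c′ blue i (Unique-∖ (i ∷ []) (allFin⁺ h)))) λ q → into (∈-map⁻ (lookup H) q)))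
          (few (∈-lookup i))
          where
          into : ∀ {v} → (∃ λ j → j ∈ nbrsIn c′ blue i (others i) × v ≡ lookup H j) → v ∈ nbrsIn c blue (lookup H i) (H ∖ (lookup H i ∷ []))
          into (j , q , refl) with nbrsIn⊆ c′ blue i (others i) q
          ... | p , e = ∈-filter⁺ (λ v → col c (lookup H i) v Bool.≟ blue) (lookup-others p) e

        reds : Fin h → List (Fin h)
        reds i = nbrsIn c′ red i (others i)

        uReds : ∀ i → Unique (reds i)
        uReds i = Unique-nbrsIn c′ red i (Unique-∖ (i ∷ []) (allFin⁺ h))

        manyReds : ∀ i → h ≤ length (reds i) + (4 + m′)
        manyReds i = conclude 0 (suc-pred-allFin i ⊕ few′ i ⊕ ≤-reflexive (≡-sym (nbrsIn-split c′ i (others i))))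
          (arith h m′ (length (others i)) (length (reds i)) (length (nbrsIn c′ blue i (others i))))
          where
          arith : ∀ h m o r b → r + (4 + m) + (h + (b + o)) ≡ h + (1 + o + (3 + m + (r + b))) + 0
          arith = solve-∀

        degree′ : ∀ i → d ≤ redDegree c′ i
        degree′ i = ℕ.+-cancelˡ-≤ 1 _ _ (≤-trans (degree v) (≤-trans
            (Unique-⊆-length (Unique-nbrsIn c red v (Unique-∖ (v ∷ []) (allFin⁺ n))) into)
            (≤-reflexive (cong suc (length-map (lookup H) (reds i))))))
          where
          v : Fin n
          v = lookup H i
          into : ∀ {w} → w ∈ nbrsIn c red v (allFin n ∖ (v ∷ [])) → w ∈ x ∷ map (lookup H) (reds i)
          into {w} q with nbrsIn⊆ c red v (allFin n ∖ (v ∷ [])) q | w ≟ x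
          ... | _ | yes e = here e
          ... | p , e | no w≢x = there (listed (inside (∈-lookup i) w≢x e))
            where
            w≢v : w ≢ v
            w≢v r = proj₂ (∈-∖⁻ {ys = allFin n} (v ∷ []) p) (here r)
            position : w ∈ H → ∃ λ j → w ≡ lookup H j
            position r = Any.index r , lookup-index r
            listed : w ∈ H → w ∈ map (lookup H) (reds i)
            listed w∈ with position w∈
            ... | j , refl = ∈-map⁺ (lookup H) (∈-filter⁺ (λ k → col c′ i k Bool.≟ red)
                  (∈-∖⁺ (i ∷ []) (∈-allFin j) (λ { (here refl) → w≢v refl })) e)

        -- Vertices that are not adjacent have two common neighbours, one of which survives the deletion of y.
        detour : ∀ y u v → u ≢ v → Edge c′ blue u v → ∃ λ w → w ≢ y × w ≢ u × w ≢ v × Edge c′ red u w × Edge c′ red w v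
        detour y u v u≢v uv = found (pick1 (y ∷ missing) (uReds u) bound)
          where
          pair : List (Fin h)
          pair = allFin h ∖ (u ∷ v ∷ [])
          missing : List (Fin h)
          missing = pair ∖ reds v
          uPair : Unique pair
          uPair = Unique-∖ (u ∷ v ∷ []) (allFin⁺ h)
          redsV⊆ : ∀ {w} → w ∈ reds v → w ∈ pair
          redsV⊆ {w} q with nbrsIn⊆ c′ red v (others v) q
          ... | p , e = ∈-∖⁺ (u ∷ v ∷ []) (∈-allFin w) λ
            { (here refl) → clash (≡-trans (≡-sym (symE {c = c′} uv)) e)
            ; (there (here refl)) → proj₂ (∈-∖⁻ {ys = allFin h} (v ∷ []) p) (here refl) }
            where
            clash : false ≡ true → ⊥
            clash ()
          pair≤ : 2 + length pair ≤ h
          pair≤ = subst (2 + length pair ≤_) (length-allFin h) (length-∖⁻ (u ∷ v ∷ []) ((u≢v ∷ []) ∷ [] ∷ []) (allFin⁺ h) (λ {w} _ → ∈-allFin w))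
          -- Two sets of at least h - j elements among h - 2 vertices share at least two as soon as
          -- h ≥ 2j.
          bound : 1 + length missing < length (reds u)
          bound = conclude 0 (manyReds u ⊕ manyReds v ⊕ length-∖⁻ (reds v) (uReds v) uPair redsV⊆ ⊕ pair≤ ⊕ large)
            (arith h m′ (length (reds u)) (length (reds v)) (length missing) (length pair))
            where
            arith : ∀ h m a b s p → a + (h + (h + (b + s + (2 + p + (8 + 2 * m))))) ≡ 2 + s + (a + (4 + m) + (b + (4 + m) + (p + (h + h)))) + 0
            arith = solve-∀
          found : (∃ λ w → w ∈ reds u × w ∉ y ∷ missing) → _
          found (w , w∈ , w∉) with nbrsIn⊆ c′ red u (others u) w∈
          ... | p , uw = w , (λ r → w∉ (here r)) , w≢u , w≢v , uw , symE {c = c′} (vw (w ∈? reds v))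
            where
            open import Data.List.Membership.DecPropositional (_≟_ {h}) using (_∈?_)
            w≢u : w ≢ u
            w≢u r = proj₂ (∈-∖⁻ {ys = allFin h} (u ∷ []) p) (here r)
            w≢v : w ≢ v
            w≢v refl with ≡-trans (≡-sym uv) uw
            ... | ()
            vw : Dec (w ∈ reds v) → Edge c′ red v w
            vw (yes q) = proj₂ (nbrsIn⊆ c′ red v (others v) q)
            vw (no q) = ⊥-elim (w∉ (there (∈-∖⁺ (reds v) (∈-∖⁺ (u ∷ v ∷ []) (∈-allFin w)
              (λ { (here r) → w≢u r ; (there (here r)) → w≢v r })) q)))

        avoiding : ∀ y u v → u ≢ y → v ≢ y → PathIn (redGraph c′) (λ w → w ≢ y) u v
        avoiding y u v u≢y v≢y = decide (u ≟ v)
          where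
          Target : Set
          Target = PathIn (redGraph c′) (λ w → w ≢ y) u v
          around : u ≢ v → (∃ λ w → w ≢ y × w ≢ u × w ≢ v × Edge c′ red u w × Edge c′ red w v) → Target
          around u≢v (w , w≢y , w≢u , w≢v , uw , wv) = PathIn.step u≢y (Adj⁺ {c = c′} (λ r → w≢u (≡-sym r)) uw)
            (PathIn.step w≢y (Adj⁺ {c = c′} w≢v wv) (PathIn.here v≢y))
          byColour : u ≢ v → Edge c′ red u v ⊎ Edge c′ blue u v → Target
          byColour u≢v (inj₁ e) = PathIn.step u≢y (Adj⁺ {c = c′} u≢v e) (PathIn.here v≢y)
          byColour u≢v (inj₂ e) = around u≢v (detour y u v u≢v e)
          decide : Dec (u ≡ v) → Target
          decide (yes refl) = PathIn.here u≢y
          decide (no u≢v) = byColour u≢v (red? c′ u v)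

        twoConnected : TwoConnected (redGraph c′)
        twoConnected = avoiding⇒twoConnected (redGraph c′) (≤-trans (s≤s (s≤s (s≤s z≤n))) large) avoiding

      sideBipartite : ¬ Bipartite (redGraph c′) → ⊥
      sideBipartite ¬bip = Dense.dense c′ noLong L≤ (allFin h) (allFin⁺ h)
          (≤-trans (≤-reflexive (arith m′)) (≤-trans large (≤-reflexive (≡-sym (length-allFin h))))) (λ {z} _ → few′ z)
        where
        arith : ∀ m → 2 * (3 + m) + 2 ≡ 8 + 2 * m
        arith = solve-∀
        noLong : ∀ {l} → L < l → ¬ HasCyc c′ red l
        noLong = cycle≤ c′ twoConnected ¬bip (λ v → enough-part small (≤-trans (degree′ v) (redDegree≤deg c′ v)))
          λ (_ , f , inj , g) → noRedCopy ((λ i → lookup H (f i)) , (λ {i} {j} e → inj (lookup-injective uH (f i) (f j) e)) ,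
            λ a b e → proj₂ (Adj⁻ {c = c′} (g a b e)))

      -- The red graph of a side is 2-connected, so unless it is bipartite `dense` refutes it. Its
      -- classes are blue cliques, of at most j vertices because blue degrees are at most j - 1. So
      -- `H` has at most 2j vertices, and as it has at least 2j some class has j.
      halfClique : (∀ Q → Unique Q → (∀ {v} → v ∈ Q → v ∈ H) → Clique c blue Q → 4 + m′ ≤ length Q → length H ≤ 8 + 2 * m′ → ⊥) → ⊥
      halfClique k = sideBipartite λ (side , proper) → classes side proper
        where
        module _ (side : Fin h → Bool) (proper : ∀ u v → Adj (redGraph c′) u v → side u ≢ side v) where
          class : Bool → List (Fin h)
          class b = filter (λ v → side v Bool.≟ b) (allFin h)
          uClass : ∀ b → Unique (class b)
          uClass b = Uniq.filter⁺ (λ v → side v Bool.≟ b) (allFin⁺ h)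
          total : length (class true) + length (class false) ≡ h
          total = ≡-trans (filter-split side (allFin h)) (length-allFin h)
          blueClass : ∀ b → Clique c′ blue (class b)
          blueClass b {u} {v} p q u≢v = ¬red⇒blue c′ λ e → proper u v (Adj⁺ {c = c′} u≢v e)
            (≡-trans (proj₂ (∈-filter⁻ (λ v → side v Bool.≟ b) {xs = allFin h} p)) (≡-sym (proj₂ (∈-filter⁻ (λ v → side v Bool.≟ b) {xs = allFin h} q))))
          class≤ : ∀ b → length (class b) ≤ 4 + m′
          class≤ b = bounded (class b) (uClass b) (blueClass b)
            where
            bounded : ∀ K → Unique K → Clique c′ blue K → length K ≤ 4 + m′
            bounded [] _ _ = z≤n
            bounded (z ∷ K) u cl = s≤s (≤-trans (Unique-⊆-length (Unique-tail u) into) (few′ z))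
              where
              into : ∀ {v} → v ∈ K → v ∈ nbrsIn c′ blue z (others z)
              into {v} q = ∈-filter⁺ (λ v → col c′ z v Bool.≟ blue) (∈-∖⁺ (z ∷ []) (∈-allFin v) (λ { (here refl) → Unique[x∷xs]⇒x∉xs u q }))
                (cl (here refl) (there q) (λ { refl → Unique[x∷xs]⇒x∉xs u q }))
          transport : ∀ b → 4 + m′ ≤ length (class b) → ⊥
          transport b le = k (map (lookup H) (class b)) (Unique-map uH (uClass b)) ∈-map-lookup
              (λ p q → cliqueMap (∈-map⁻ (lookup H) p) (∈-map⁻ (lookup H) q))
              (≤-trans le (≤-reflexive (≡-sym (length-map (lookup H) (class b)))))
              (conclude 0 (≤-reflexive (≡-sym total) ⊕ class≤ true ⊕ class≤ false) (arith h m′ (length (class true)) (length (class false))))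
            where
            cliqueMap : ∀ {w w′} → (∃ λ i → i ∈ class b × w ≡ lookup H i) → (∃ λ j → j ∈ class b × w′ ≡ lookup H j) → w ≢ w′ → Edge c blue w w′
            cliqueMap (i , i∈ , refl) (j , j∈ , refl) ne = blueClass b i∈ j∈ (λ { refl → ne refl })
            arith : ∀ h m a b → 8 + 2 * m + (h + (a + b)) ≡ h + (a + b + (4 + m + (4 + m))) + 0
            arith = solve-∀
          classes : ⊥
          classes with ℕ.≤-<-connex (4 + m′) (length (class true))
          ... | inj₁ le = transport true le
          ... | inj₂ lt = transport false (conclude 1 (large ⊕ ≤-reflexive (≡-sym total) ⊕ lt) (arith h m′ (length (class true)) (length (class false))))
            where
            arith : ∀ h m a b → b + (8 + 2 * m + (h + suc a)) ≡ 4 + m + (h + (a + b + (4 + m))) + 1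
            arith = solve-∀

    private
      snoc : ∀ {P : Fin n → Set} {u w z} → PathIn (redGraph c) P u w → Adj (redGraph c) w z → P z → PathIn (redGraph c) P u z
      snoc (PathIn.here p) e q = PathIn.step p e (PathIn.here q)
      snoc (PathIn.step p e r) e′ q = PathIn.step p e (snoc r e′ q)

      reach-split : ∀ {P : Fin n → Set} (P? : ∀ v → Dec (P v)) xs → length (filter P? xs) + length (filter (λ v → ¬? (P? v)) xs) ≡ length xs
      reach-split P? [] = refl
      reach-split P? (x ∷ xs) with P? x
      ... | yes _ = cong suc (reach-split P? xs)
      ... | no _ = ≡-trans (ℕ.+-suc _ _) (cong suc (reach-split P? xs))

    module Separation (x u v : Fin n) (u≢x : u ≢ x) (v≢x : v ≢ x)
      (reach? : ∀ w → Dec (PathIn (redGraph c) (λ y → y ≢ x) u w)) (apart : ¬ PathIn (redGraph c) (λ y → y ≢ x) u v) where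

      private
        rest A B : List (Fin n)
        rest = allFin n ∖ (x ∷ [])
        A = filter reach? rest
        B = filter (λ w → ¬? (reach? w)) rest

        uRest : Unique rest
        uRest = Unique-∖ (x ∷ []) (allFin⁺ n)
        uA : Unique A
        uA = Uniq.filter⁺ reach? uRest
        uB : Unique B
        uB = Uniq.filter⁺ (λ w → ¬? (reach? w)) uRest

        inRest : ∀ {w} → w ≢ x → w ∈ rest
        inRest {w} w≢x = ∈-∖⁺ (x ∷ []) (∈-allFin w) (λ { (here e) → w≢x e })

        A⁻ : ∀ {w} → w ∈ A → PathIn (redGraph c) (λ y → y ≢ x) u w
        A⁻ q = proj₂ (∈-filter⁻ reach? {xs = rest} q)
        B⁻ : ∀ {w} → w ∈ B → w ≢ x × ¬ PathIn (redGraph c) (λ y → y ≢ x) u w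
        B⁻ q with ∈-filter⁻ (λ w → ¬? (reach? w)) {xs = rest} q
        ... | p , no-path = (λ r → proj₂ (∈-∖⁻ {ys = allFin n} (x ∷ []) p) (here r)) , no-path
        A⁺ : ∀ {w} → w ≢ x → PathIn (redGraph c) (λ y → y ≢ x) u w → w ∈ A
        A⁺ w≢x p = ∈-filter⁺ reach? (inRest w≢x) p
        B⁺ : ∀ {w} → w ≢ x → ¬ PathIn (redGraph c) (λ y → y ≢ x) u w → w ∈ B
        B⁺ w≢x p = ∈-filter⁺ (λ w → ¬? (reach? w)) (inRest w≢x) p

        A#B : A # B
        A#B p q = proj₂ (B⁻ q) (A⁻ p)

        blueAB : Complete c blue A B
        blueAB p q = ¬red⇒blue c λ e → proj₂ (B⁻ q) (snoc (A⁻ p) (Adj⁺ {c = c} (λ { refl → A#B p q }) e) (proj₁ (B⁻ q)))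

        insideA : ∀ {a w} → a ∈ A → w ≢ x → Edge c red a w → w ∈ A
        insideA {a} {w} a∈ w≢x e with a ≟ w
        ... | yes refl = a∈
        ... | no a≢w = A⁺ w≢x (snoc (A⁻ a∈) (Adj⁺ {c = c} a≢w e) w≢x)

        insideB : ∀ {b w} → b ∈ B → w ≢ x → Edge c red b w → w ∈ B
        insideB {b} {w} b∈ w≢x e = B⁺ w≢x λ p → proj₂ (B⁻ b∈)
          (snoc p (Adj⁺ {c = c} (λ { refl → proj₂ (B⁻ b∈) p }) (symE {c = c} e)) (proj₁ (B⁻ b∈)))

        degree≤ : ∀ {H a} → a ∈ H → (∀ {w} → w ≢ x → Edge c red a w → w ∈ H) → 1 + d ≤ length H
        degree≤ {H} {a} a∈ closed = ℕ.+-cancelˡ-≤ 1 _ _ (≤-trans (s≤s (degree a))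
          (Unique-⊆-length {ys = x ∷ H} (Unique-∷ (λ q → proj₂ (nbr q) (here refl)) (Unique-nbrsIn c red a (Unique-∖ (a ∷ []) (allFin⁺ n))))
            λ { (here refl) → there a∈ ; (there q) → into q }))
          where
          nbr : ∀ {w} → w ∈ nbrsIn c red a (allFin n ∖ (a ∷ [])) → w ∈ allFin n × w ∉ a ∷ []
          nbr q = ∈-∖⁻ {ys = allFin n} (a ∷ []) (proj₁ (nbrsIn⊆ c red a (allFin n ∖ (a ∷ [])) q))
          into : ∀ {w} → w ∈ nbrsIn c red a (allFin n ∖ (a ∷ [])) → w ∈ x ∷ H
          into {w} q with w ≟ x
          ... | yes e = here e
          ... | no w≢x = there (closed w≢x (proj₂ (nbrsIn⊆ c red a (allFin n ∖ (a ∷ [])) q)))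

        sizeA : 1 + d ≤ length A
        sizeA = degree≤ (A⁺ u≢x (PathIn.here u≢x)) (insideA (A⁺ u≢x (PathIn.here u≢x)))
        sizeB : 1 + d ≤ length B
        sizeB = degree≤ (B⁺ v≢x apart) (insideB (B⁺ v≢x apart))

        sum≥ : n ≤ 1 + (length A + length B)
        sum≥ = ≤-trans (suc-pred-allFin x) (≤-reflexive (cong suc (≡-sym (reach-split reach? rest))))
        sum≤ : 1 + (length A + length B) ≤ n
        sum≤ = ≤-trans (≤-reflexive (cong suc (reach-split reach? rest)))
          (≤-trans (length-∖⁻ (x ∷ []) ([] ∷ []) (allFin⁺ n) (λ {w} _ → ∈-allFin w)) (≤-reflexive (length-allFin n)))

        smallA : length A + 4 ≤ n
        smallA = conclude (3 + m′) (sum≤ ⊕ sizeB ⊕ j≤d) (arith n m′ d (length A) (length B))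
          where
          arith : ∀ n m d a b → n + (1 + (a + b) + (1 + d + (5 + m))) ≡ a + 4 + (n + (b + d)) + (3 + m)
          arith = solve-∀
        smallB : length B + 4 ≤ n
        smallB = conclude (3 + m′) (sum≤ ⊕ sizeA ⊕ j≤d) (arith n m′ d (length A) (length B))
          where
          arith : ∀ n m d a b → n + (1 + (a + b) + (1 + d + (5 + m))) ≡ b + 4 + (n + (a + d)) + (3 + m)
          arith = solve-∀

        4≤A : 4 + m′ ≤ length A
        4≤A = ≤-trans (ℕ.n≤1+n _) (≤-trans j≤d (≤-trans (ℕ.n≤1+n _) sizeA))
        4≤B : 4 + m′ ≤ length B
        4≤B = ≤-trans (ℕ.n≤1+n _) (≤-trans j≤d (≤-trans (ℕ.n≤1+n _) sizeB))

        halfA : 8 + 2 * m′ ≤ length A → (∀ Q → Unique Q → (∀ {v} → v ∈ Q → v ∈ A) → Clique c blue Q → 4 + m′ ≤ length Q → length A ≤ 8 + 2 * m′ → ⊥) → ⊥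
        halfA = Side.halfClique A uA x smallA insideA
          (fewBlue B A uB uA (λ p q → A#B q p) (Complete-sym {c = c} blueAB) 4≤B)
        halfB : 8 + 2 * m′ ≤ length B → (∀ Q → Unique Q → (∀ {v} → v ∈ Q → v ∈ B) → Clique c blue Q → 4 + m′ ≤ length Q → length B ≤ 8 + 2 * m′ → ⊥) → ⊥
        halfB = Side.halfClique B uB x smallB insideB (fewBlue A B uA uB A#B blueAB 4≤A)

        -- The hub is in `Q`, and the rim alternates between the j - 1 other vertices of `Q` and the
        -- side `B`. The missing vertex is compensated by two consecutive blue edges inside `R`.
        twoCliques : ∀ Q R → Unique Q → Unique R → (∀ {v} → v ∈ Q → v ∈ A) → (∀ {v} → v ∈ R → v ∈ B) → Clique c blue Q → Clique c blue R →
          4 + m′ ≤ length Q → 4 + m′ ≤ length R → ⊥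
        twoCliques Q R uQ uR Q⊆ R⊆ clQ clR lQ lR with pick1 [] uQ (≤-trans (s≤s z≤n) lQ) | pick [] 3 uR (≤-trans (ℕ.m≤m+n 3 (1 + m′)) lR)
        ... | h , h∈ , _ | mkPick [] _ _ _ ()
        ... | h , h∈ , _ | mkPick (_ ∷ []) _ _ _ ()
        ... | h , h∈ , _ | mkPick (_ ∷ _ ∷ []) _ _ _ ()
        ... | h , h∈ , _ | mkPick (_ ∷ _ ∷ _ ∷ _ ∷ _) _ _ _ ()
        ... | h , h∈ , _ | mkPick (r₁ ∷ r₂ ∷ r₃ ∷ []) u₃@((n₁₂ ∷ _ ∷ []) ∷ (n₂₃ ∷ []) ∷ _) sub _ _ =
          Extend.twoEdgesWheel c k≤m size noRed noWheel {Q ∖ (h ∷ [])} {B} h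
            (λ p q → blueAB (Q⊆ (proj₁ (∈-∖⁻ (h ∷ []) p))) q) (Unique-∖ (h ∷ []) uQ) uB (λ p q → A#B (Q⊆ (proj₁ (∈-∖⁻ (h ∷ []) p))) q)
            (cherry (R⊆ (sub (here refl))) (R⊆ (sub (there (here refl)))) (R⊆ (sub (there (there (here refl))))) u₃
              (clR (sub (here refl)) (sub (there (here refl))) n₁₂) (clR (sub (there (here refl))) (sub (there (there (here refl)))) n₂₃))
            (ℕ.+-cancelˡ-≤ 1 _ _ (≤-trans lQ (length-∖ (h ∷ []) uQ))) (≤-trans j≤d (≤-trans (ℕ.n≤1+n _) sizeB))
            (λ p → clQ h∈ (proj₁ (∈-∖⁻ (h ∷ []) p)) (h≢ p) , h≢ p)
            (λ q → blueAB (Q⊆ h∈) q , λ { refl → A#B (Q⊆ h∈) q })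
          where
          h≢ : ∀ {w} → w ∈ Q ∖ (h ∷ []) → h ≢ w
          h≢ p refl = proj₂ (∈-∖⁻ {ys = Q} (h ∷ []) p) (here refl)

      -- The two sides have at least 4j vertices together, and `halfClique` allows no side more than
      -- 2j. So both have exactly 2j and contain blue cliques of size j.
      separated : ⊥
      separated with ℕ.≤-<-connex (8 + 2 * m′) (length A)
      ... | inj₂ lt = halfB (≤-trans (ℕ.n≤1+n _) largeB) λ _ _ _ _ _ le → ℕ.<-irrefl refl (≤-trans largeB le)
        where
        arith : ∀ n m a b → b + (17 + 4 * m + (n + suc a)) ≡ 9 + 2 * m + (n + (1 + (a + b) + (8 + 2 * m))) + 0
        arith = solve-∀
        largeB : 9 + 2 * m′ ≤ length B
        largeB = conclude 0 (size ⊕ sum≥ ⊕ lt) (arith n m′ (length A) (length B))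
      ... | inj₁ le = halfA le λ Q uQ Q⊆ clQ lQ A≤ →
        halfB (conclude 0 (size ⊕ sum≥ ⊕ A≤) (arith n m′ (length A) (length B)))
          λ R uR R⊆ clR lR _ → twoCliques Q R uQ uR Q⊆ R⊆ clQ clR lQ lR
        where
        arith : ∀ n m a b → b + (17 + 4 * m + (n + a)) ≡ 8 + 2 * m + (n + (1 + (a + b) + (8 + 2 * m))) + 0
        arith = solve-∀

    smallBlueDegree : ⊥
    smallBlueDegree = ¬¬∀ {P = λ x → ∀ u v → u ≢ x → v ≢ x → PathIn (redGraph c) (λ y → y ≢ x) u v}
        (λ x → ¬¬∀ λ u → ¬¬∀ λ v k → k λ u≢x v≢x → ⊥-elim (¬¬dec (PathIn (redGraph c) (λ y → y ≢ x) u) λ reach? →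
          Separation.separated x u v u≢x v≢x reach? λ p → k λ _ _ → p))
        λ avoiding → connected (avoiding⇒twoConnected (redGraph c) (≤-trans (s≤s (s≤s (s≤s z≤n))) size) avoiding) bipartite

-- A graph on 13 vertices that bounds admissible pairs from below

module Ring where
  open Combinatorics using (avoiding⇒twoConnected; ≡ᵇ-true; ∧-true; not-true)
  open import Data.Bool using (Bool; true; false; not; _∧_; _∨_; T; T?)
  import Data.Bool.Properties as Bool
  open import Data.Nat using (ℕ; zero; suc; _+_; _≤_; z≤n; s≤s; _≡ᵇ_)
  import Data.Nat.Properties as ℕ
  open import Data.Fin using (Fin; toℕ; #_; fromℕ<)
  open import Data.Fin.Properties using (_≟_; all?; toℕ-injective)
  import Data.List as List
  open import Data.List.Relation.Unary.All as All using (All; []; _∷_)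
  open import Data.List using (List; []; _∷_)
  open import Data.Nat.DivMod using (m%n<n)
  open import Data.Maybe using (Maybe; just; nothing; is-just; map; to-witness-T)
  open import Data.Product using (_×_; _,_; proj₁; proj₂)
  open import Data.Empty using (⊥; ⊥-elim)
  open import Data.Unit using (tt)
  open import Relation.Nullary using (¬_; Dec; yes; no; does)
  open import Relation.Nullary.Decidable using (_×-dec_; _→-dec_; ¬?; toWitness)
  open import Relation.Binary.PropositionalEquality using (_≡_; _≢_; refl) renaming (sym to ≡-sym; trans to ≡-trans)

  elem : ℕ → List ℕ → Bool
  elem v [] = false
  elem v (x ∷ xs) = (v ≡ᵇ x) ∨ elem v xs

  -- Three copies of K₅ minus an edge, on 0 … 4, on 4 … 8 and on 9 … 12 , 0, arranged in a ring: a cycle inside a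
  -- copy has at most five vertices, and one through all the copies has at least seven.
  row : ℕ → List ℕ
  row 0 = 1 ∷ 2 ∷ 3 ∷ 10 ∷ 11 ∷ 12 ∷ []
  row 1 = 0 ∷ 2 ∷ 3 ∷ 4 ∷ []
  row 2 = 0 ∷ 1 ∷ 3 ∷ 4 ∷ []
  row 3 = 0 ∷ 1 ∷ 2 ∷ 4 ∷ []
  row 4 = 1 ∷ 2 ∷ 3 ∷ 5 ∷ 6 ∷ 7 ∷ []
  row 5 = 4 ∷ 6 ∷ 7 ∷ 8 ∷ []
  row 6 = 4 ∷ 5 ∷ 7 ∷ 8 ∷ []
  row 7 = 4 ∷ 5 ∷ 6 ∷ 8 ∷ []
  row 8 = 5 ∷ 6 ∷ 7 ∷ 9 ∷ []
  row 9 = 8 ∷ 10 ∷ 11 ∷ 12 ∷ []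
  row 10 = 0 ∷ 9 ∷ 11 ∷ 12 ∷ []
  row 11 = 0 ∷ 9 ∷ 10 ∷ 12 ∷ []
  row 12 = 0 ∷ 9 ∷ 10 ∷ 11 ∷ []
  row _ = []

  adjacent : Fin 13 → Fin 13 → Bool
  adjacent u v = elem (toℕ v) (row (toℕ u))

  ring : Graph 13
  ring = record
    { adj = adjacent
    ; sym = toWitness {a? = all? λ u → all? λ v → adjacent u v Bool.≟ adjacent v u} tt
    ; irrefl = toWitness {a? = all? λ v → adjacent v v Bool.≟ false} tt }

  ring-degree : ∀ v → 4 ≤ deg ring v
  ring-degree = toWitness {a? = all? λ v → 4 ℕ.≤? deg ring v} tt

  ring-hamiltonian : HasCycle ring 13
  ring-hamiltonian = s≤s (s≤s (s≤s z≤n)) , (λ v → v) , (λ e → e) ,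
    toWitness {a? = all? λ u → all? λ v → (cycAdj 13 u v Bool.≟ true) →-dec (adjacent u v Bool.≟ true)} tt

  ring-odd : ¬ Bipartite ring
  ring-odd (side , proper) with side (# 0) | side (# 1) | side (# 2) | proper (# 0) (# 1) refl | proper (# 1) (# 2) refl | proper (# 0) (# 2) refl
  ... | true | true | _ | p | _ | _ = p refl
  ... | true | false | true | _ | _ | p = p refl
  ... | true | false | false | _ | p | _ = p refl
  ... | false | false | _ | p | _ | _ = p refl
  ... | false | true | false | _ | _ | p = p refl
  ... | false | true | true | _ | p | _ = p refl

  shift : ℕ → Fin 13 → Fin 13
  shift k v = fromℕ< (m%n<n (k + toℕ v) 13)

  -- Iterates `f` from u until v is met. Nothing is proved about its success, which is tested by
  -- evaluation for all pairs that matter.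
  follow : (Fin 13 → Fin 13) → ℕ → ∀ x u v → Maybe (PathIn ring (λ w → w ≢ x) u v)
  follow f zero x u v = nothing
  follow f (suc fuel) x u v with u ≟ x | u ≟ v | adjacent u (f u) Bool.≟ true
  ... | yes _ | _ | _ = nothing
  ... | no u≢x | yes refl | _ = just (here u≢x)
  ... | no _ | no _ | no _ = nothing
  ... | no u≢x | no _ | yes e = map (step u≢x e) (follow f fuel x (f u) v)

  _⁀_ : ∀ {P : Fin 13 → Set} {u v w} → PathIn ring P u v → PathIn ring P v w → PathIn ring P u w
  here _ ⁀ q = q
  step p e r ⁀ q = step p e (r ⁀ q)

  -- After the removal of x everything can be reached from its successor x + 1 on the Hamiltonian cycle.
  ring-avoiding : ∀ x u v → u ≢ x → v ≢ x → PathIn ring (λ w → w ≢ x) u v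
  ring-avoiding x u v u≢x v≢x = to-witness-T (back x u) (proj₁ (found x u) u≢x) ⁀ to-witness-T (forth x v) (proj₂ (found x v) v≢x)
    where
    back : ∀ x u → Maybe (PathIn ring (λ w → w ≢ x) u (shift 1 x))
    back x u = follow (shift 12) 13 x u (shift 1 x)
    forth : ∀ x v → Maybe (PathIn ring (λ w → w ≢ x) (shift 1 x) v)
    forth x v = follow (shift 1) 13 x (shift 1 x) v
    found : ∀ x u → (u ≢ x → T (is-just (back x u))) × (u ≢ x → T (is-just (forth x u)))
    found = toWitness {a? = all? λ x → all? λ u → (¬? (u ≟ x) →-dec T? (is-just (back x u))) ×-dec (¬? (u ≟ x) →-dec T? (is-just (forth x u)))} tt

  every : (ℕ → Bool) → List ℕ → Bool
  every p [] = true
  every p (x ∷ xs) = p x ∧ every p xs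

  every-elem : ∀ p xs v → every p xs ≡ true → elem v xs ≡ true → p v ≡ true
  every-elem p (x ∷ xs) v h e with v ≡ᵇ x in eq
  ... | true rewrite ≡ᵇ-true {v} {x} eq = proj₁ (∧-true h)
  ... | false = every-elem p xs v (proj₂ (∧-true {p x} h)) e

  -- No path of k further vertices from u, avoiding vs, ends in a neighbour of s.
  never : ℕ → ℕ → List ℕ → ℕ → Bool
  never zero s vs u = not (elem s (row u))
  never (suc k) s vs u = every (λ v → elem v vs ∨ never k s (v ∷ vs) v) (row u)

  never-step : ∀ k s vs u v → never (suc k) s vs u ≡ true → elem v (row u) ≡ true → elem v vs ≡ false → never k s (v ∷ vs) v ≡ true
  never-step k s vs u v h e new with every-elem _ (row u) v h e
  ... | q rewrite new = q

  -- The exhaustive search is evaluated once for every starting vertex. A supposed hexagon is then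
  -- followed through the search tree edge by edge, until its closing edge contradicts the outcome.
  ring-no-hexagon : ¬ HasCycle ring 6
  ring-no-hexagon (_ , f , inj , h) = closed (not-true p₅)
    where
    at : Fin 6 → ℕ
    at i = toℕ (f i)
    start : ∀ v → never 5 (toℕ v) (toℕ v ∷ []) (toℕ v) ≡ true
    start = toWitness {a? = all? λ v → never 5 (toℕ v) (toℕ v ∷ []) (toℕ v) Bool.≟ true} tt
    new : ∀ i js → All (λ j → i ≢ j) js → elem (at i) (List.map at js) ≡ false
    new i [] [] = refl
    new i (j ∷ js) (i≢j ∷ rest) with at i ≡ᵇ at j in eq
    ... | true = ⊥-elim (i≢j (inj (toℕ-injective (≡ᵇ-true {at i} {at j} eq))))
    ... | false = new i js rest
    advance : ∀ k i j js → never (suc k) (at (# 0)) (List.map at js) (at i) ≡ true → elem (at j) (row (at i)) ≡ true →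
      does (All.all? (λ x → ¬? (j ≟ x)) js) ≡ true → never k (at (# 0)) (List.map at (j ∷ js)) (at j) ≡ true
    advance k i j js p e d = never-step k (at (# 0)) (List.map at js) (at i) (at j) p e (new j js (distinct (All.all? (λ x → ¬? (j ≟ x)) js) d))
      where
      distinct : ∀ {P : Set} (P? : Dec P) → does P? ≡ true → P
      distinct (yes q) _ = q
    p₁ : never 4 (at (# 0)) (List.map at (# 1 ∷ # 0 ∷ [])) (at (# 1)) ≡ true
    p₁ = advance 4 (# 0) (# 1) (# 0 ∷ []) (start (f (# 0))) (h _ _ refl) refl
    p₂ : never 3 (at (# 0)) (List.map at (# 2 ∷ # 1 ∷ # 0 ∷ [])) (at (# 2)) ≡ true
    p₂ = advance 3 (# 1) (# 2) (# 1 ∷ # 0 ∷ []) p₁ (h _ _ refl) refl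
    p₃ : never 2 (at (# 0)) (List.map at (# 3 ∷ # 2 ∷ # 1 ∷ # 0 ∷ [])) (at (# 3)) ≡ true
    p₃ = advance 2 (# 2) (# 3) (# 2 ∷ # 1 ∷ # 0 ∷ []) p₂ (h _ _ refl) refl
    p₄ : never 1 (at (# 0)) (List.map at (# 4 ∷ # 3 ∷ # 2 ∷ # 1 ∷ # 0 ∷ [])) (at (# 4)) ≡ true
    p₄ = advance 1 (# 3) (# 4) (# 3 ∷ # 2 ∷ # 1 ∷ # 0 ∷ []) p₃ (h _ _ refl) refl
    p₅ : never 0 (at (# 0)) (List.map at (# 5 ∷ # 4 ∷ # 3 ∷ # 2 ∷ # 1 ∷ # 0 ∷ [])) (at (# 5)) ≡ true
    p₅ = advance 0 (# 4) (# 5) (# 4 ∷ # 3 ∷ # 2 ∷ # 1 ∷ # 0 ∷ []) p₄ (h _ _ refl) refl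
    closed : elem (at (# 0)) (row (at (# 5))) ≡ false → ⊥
    closed e = clash (≡-trans (≡-sym e) (h (# 5) (# 0) refl))
      where
      clash : false ≡ true → ⊥
      clash ()

  ring-twoConnected : TwoConnected ring
  ring-twoConnected = avoiding⇒twoConnected ring (s≤s (s≤s (s≤s z≤n))) ring-avoiding

-- Estimates for α and β

module Rationals where
  open Ring
  open import Data.Nat as ℕ using (ℕ; zero; suc; z≤n)
  import Data.Nat.Properties as ℕ
  open import Data.Integer as ℤ using (ℤ; +_; +≤+)
  import Data.Integer.Properties as ℤ
  open import Data.Rational
  open import Data.Rational.Properties as ℚ using (module ≤-Reasoning)
  open import Data.Rational.Solver using (module +-*-Solver)
  open +-*-Solver using (solve; _:=_; _:+_; _:*_; :-_; con)
  open import Data.Rational.Unnormalised as ℚᵘ using (mkℚᵘ; *≡*; *<*; *≤*)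
  import Data.Rational.Unnormalised.Properties as ℚᵘ
  open import Data.Product using (∃; _×_; _,_; proj₁; proj₂)
  open import Data.Empty using (⊥-elim)
  open import Relation.Nullary using (¬_; Dec; yes; no)
  open import Relation.Binary.PropositionalEquality using (_≡_; refl; cong; cong₂; subst) renaming (sym to ≡-sym; trans to ≡-trans)

  ι : ℕ → ℚ
  ι m = (+ m) / 1

  toℚᵘ-ι : ∀ m → toℚᵘ (ι m) ℚᵘ.≃ mkℚᵘ (+ m) 0
  toℚᵘ-ι m = ℚ.toℚᵘ-fromℚᵘ (mkℚᵘ (+ m) 0)

  ι-+ : ∀ m n → ι (m ℕ.+ n) ≡ ι m + ι n
  ι-+ m n = ℚ.toℚᵘ-injective (ℚᵘ.≃-trans (toℚᵘ-ι (m ℕ.+ n)) (ℚᵘ.≃-trans (*≡* (cong (ℤ._* (+ 1)) sum))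
      (ℚᵘ.≃-trans (ℚᵘ.+-cong (ℚᵘ.≃-sym (toℚᵘ-ι m)) (ℚᵘ.≃-sym (toℚᵘ-ι n))) (ℚᵘ.≃-sym (ℚ.toℚᵘ-homo-+ (ι m) (ι n))))))
    where
    sum : + (m ℕ.+ n) ≡ + m ℤ.* + 1 ℤ.+ + n ℤ.* + 1
    sum = ≡-sym (cong₂ ℤ._+_ (ℤ.*-identityʳ (+ m)) (ℤ.*-identityʳ (+ n)))

  ι-mono : ∀ {m n} → m ℕ.≤ n → ι m ≤ ι n
  ι-mono {m} {n} le = ℚ.toℚᵘ-cancel-≤ (ℚᵘ.≤-respˡ-≃ (ℚᵘ.≃-sym (toℚᵘ-ι m)) (ℚᵘ.≤-respʳ-≃ (ℚᵘ.≃-sym (toℚᵘ-ι n))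
    (*≤* (ℤ.*-monoʳ-≤-nonNeg (+ 1) (+≤+ le)))))

  archimedean : ∀ q → ∃ λ m → q < ι m
  archimedean q@record{} = m , ℚ.toℚᵘ-cancel-< (ℚᵘ.<-respʳ-≃ (ℚᵘ.≃-sym (toℚᵘ-ι m)) (*<* (begin-strict
      ↥ q ℤ.* + 1          ≡⟨ ℤ.*-identityʳ (↥ q) ⟩
      ↥ q                  ≤⟨ below (↥ q) ⟩
      + ℤ.∣ ↥ q ∣          <⟨ ℤ.+<+ (ℕ.n<1+n ℤ.∣ ↥ q ∣) ⟩
      + m                  ≤⟨ +≤+ (ℕ.m≤m*n m (↧ₙ q)) ⟩
      + (m ℕ.* ↧ₙ q)       ≡⟨ ℤ.pos-* m (↧ₙ q) ⟩
      + m ℤ.* ↧ q          ∎)))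
    where
    open ℤ.≤-Reasoning
    m : ℕ
    m = suc ℤ.∣ ↥ q ∣
    below : ∀ i → i ℤ.≤ + ℤ.∣ i ∣
    below (+ n) = ℤ.≤-refl
    below (ℤ.-[1+ n ]) = ℤ.-≤+

  concludeℚ : ∀ {l r a b} → l ≤ r → b + l ≡ a + r → a ≤ b
  concludeℚ {l} {r} {a} {b} le eq = begin
    a               ≡⟨ solve 2 (λ a r → a := (a :+ r) :+ :- r) refl a r ⟩
    (a + r) + - r   ≡⟨ cong (_+ - r) eq ⟨
    (b + l) + - r   ≤⟨ ℚ.+-monoˡ-≤ (- r) (ℚ.+-monoʳ-≤ b le) ⟩
    (b + r) + - r   ≡⟨ solve 2 (λ b r → (b :+ r) :+ :- r := b) refl b r ⟩
    b               ∎
    where open ≤-Reasoning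

  -- With `ι i ≤ X` as the predicate, the number found is the integral part of X; `f` is the fuel of
  -- the upward search.
  greatest : ∀ {P : ℕ → Set} → (∀ m → Dec (P m)) → ∀ f m → P m → ¬ P (m ℕ.+ f) → ∃ λ k → m ℕ.≤ k × P k × ¬ P (suc k)
  greatest {P} P? zero m p ¬p = ⊥-elim (¬p (subst P (≡-sym (ℕ.+-identityʳ m)) p))
  greatest {P} P? (suc f) m p ¬p with P? (suc m)
  ... | no ¬q = m , ℕ.≤-refl , p , ¬q
  ... | yes q with greatest P? f (suc m) q (λ r → ¬p (subst P (≡-sym (ℕ.+-suc m f)) r))
  ... | k , le , pk , ¬pk = k , ℕ.≤-trans (ℕ.n≤1+n m) le , pk , ¬pk

  module Bounds {α β : ℚ} (adm : Admissible α β) where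
    private
      ¼≤α : (+ 1) / 4 ≤ α
      ¼≤α = proj₁ adm
      α<1 : α < 1ℚ
      α<1 = proj₁ (proj₂ adm)

    Enough : ℕ → ℕ → Set
    Enough n e = α * ι n + β ≤ ι e

    admissible : ∀ h (G : Graph h) → TwoConnected G → ¬ Bipartite G → (∀ v → Enough h (deg G v)) →
       ∀ t s → 6 ℕ.≤ t → t ℕ.≤ s → HasCycle G s → HasCycle G t
    admissible = proj₂ (proj₂ (proj₂ adm))

    0≤α : 0ℚ ≤ α
    0≤α = ℚ.≤-trans (toWitness {a? = 0ℚ ℚ.≤? (+ 1) / 4} _) ¼≤α
      where open import Relation.Nullary.Decidable using (toWitness)

    1≤4α : ι 1 ≤ α * ι 4
    1≤4α = ℚ.*-monoʳ-≤-nonNeg (ι 4) ¼≤α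

    0<1-α : 0ℚ < 1ℚ - α
    0<1-α = subst (_< 1ℚ - α) (ℚ.+-inverseʳ α) (ℚ.+-monoˡ-< (- α) α<1)

    -- Otherwise the ring on 13 vertices would contradict admissibility.
    4≤13α+β : ι 4 ≤ α * ι 13 + β
    4≤13α+β with α * ι 13 + β ℚ.≤? ι 4
    ... | no ¬le = ℚ.<⇒≤ (ℚ.≰⇒> ¬le)
    ... | yes le = ⊥-elim (ring-no-hexagon (admissible 13 ring ring-twoConnected ring-odd
          (λ v → ℚ.≤-trans le (ι-mono (ring-degree v))) 6 13 ℕ.≤-refl (ℕ.m≤m+n 6 7) ring-hamiltonian))

    module _ .{{_ : NonZero (1ℚ - α)}} (p : ℚ) where
      private
        instance
          positive-1-α : Positive (1ℚ - α)
          positive-1-α = positive 0<1-α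
          nonNegative-1-α : NonNegative (1ℚ - α)
          nonNegative-1-α = nonNegative (ℚ.<⇒≤ 0<1-α)

        ÷-* : p ÷ (1ℚ - α) * (1ℚ - α) ≡ p
        ÷-* = ≡-trans (ℚ.*-assoc p (1/ (1ℚ - α)) (1ℚ - α)) (≡-trans (cong (p *_) (ℚ.*-inverseˡ (1ℚ - α))) (ℚ.*-identityʳ p))

      ≤÷ : ∀ {q} → q * (1ℚ - α) ≤ p → q ≤ p ÷ (1ℚ - α)
      ≤÷ {q} le = ℚ.*-cancelʳ-≤-pos (1ℚ - α) (subst (q * (1ℚ - α) ≤_) (≡-sym ÷-*) le)

      ≰÷ : ∀ {q} → ¬ (q ≤ p ÷ (1ℚ - α)) → p ≤ q * (1ℚ - α)
      ≰÷ {q} ¬le = subst (_≤ q * (1ℚ - α)) ÷-* (ℚ.*-monoʳ-≤-nonNeg (1ℚ - α) (ℚ.<⇒≤ (ℚ.≰⇒> ¬le)))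

    -- 4j + 1 with j = 4 + m
    lower : ∀ m → ι (17 ℕ.+ 4 ℕ.* m) * (1ℚ - α) ≤ ι (3 ℕ.* (4 ℕ.+ m)) + β
    -- The claim amounts to j + 1 ≤ α(4j + 1) + β. For j = 3 this is `4≤13α+β`, the reason for 13
    -- vertices of degree 4; each further unit of j is paid by 4α ≥ 1.
    lower m = concludeℚ (ℚ.+-mono-≤ 4≤13α+β (ℚ.+-mono-≤ (ℚ.*-monoʳ-≤-nonNeg M {{nonNegative (ι-mono (z≤n {m}))}} 1≤4α) 1≤4α)) (begin-equality
        ι (3 ℕ.* (4 ℕ.+ m)) + β + (ι 4 + (ι 1 * M + ι 1))
          ≡⟨ cong (λ x → x + β + (ι 4 + (ι 1 * M + ι 1))) three ⟩
        (ι 12 + (M + (M + M))) + β + (ι 4 + (ι 1 * M + ι 1))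
          ≡⟨ solve 3 (λ α β M → (con (ι 12) :+ (M :+ (M :+ M))) :+ β :+ (con (ι 4) :+ (con (ι 1) :* M :+ con (ι 1)))
               := (con (ι 17) :+ (M :+ (M :+ (M :+ M)))) :* (con 1ℚ :+ :- α) :+ (α :* con (ι 13) :+ β :+ (α :* con (ι 4) :* M :+ α :* con (ι 4)))) refl α β M ⟩
        (ι 17 + (M + (M + (M + M)))) * (1ℚ - α) + (α * ι 13 + β + (α * ι 4 * M + α * ι 4))
          ≡⟨ cong (λ x → x * (1ℚ - α) + (α * ι 13 + β + (α * ι 4 * M + α * ι 4))) four ⟨
        ι (17 ℕ.+ 4 ℕ.* m) * (1ℚ - α) + (α * ι 13 + β + (α * ι 4 * M + α * ι 4)) ∎)
      where
      open ≤-Reasoning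
      M : ℚ
      M = ι m
      two : ι (m ℕ.+ m) ≡ M + M
      two = ι-+ m m
      three : ι (3 ℕ.* (4 ℕ.+ m)) ≡ ι 12 + (M + (M + M))
      three = ≡-trans (cong ι (arith m)) (≡-trans (ι-+ 12 (m ℕ.+ (m ℕ.+ m))) (cong (λ x → ι 12 + x) (≡-trans (ι-+ m (m ℕ.+ m)) (cong (λ x → M + x) two))))
        where
        open import Data.Nat.Tactic.RingSolver using (solve-∀)
        arith : ∀ m → 3 ℕ.* (4 ℕ.+ m) ≡ 12 ℕ.+ (m ℕ.+ (m ℕ.+ m))
        arith = solve-∀
      four : ι (17 ℕ.+ 4 ℕ.* m) ≡ ι 17 + (M + (M + (M + M)))
      four = ≡-trans (cong ι (arith m)) (≡-trans (ι-+ 17 (m ℕ.+ (m ℕ.+ (m ℕ.+ m)))) (cong (λ x → ι 17 + x)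
          (≡-trans (ι-+ m (m ℕ.+ (m ℕ.+ m))) (cong (λ x → M + x) (≡-trans (ι-+ m (m ℕ.+ m)) (cong (λ x → M + x) two))))))
        where
        open import Data.Nat.Tactic.RingSolver using (solve-∀)
        arith : ∀ m → 17 ℕ.+ 4 ℕ.* m ≡ 17 ℕ.+ (m ℕ.+ (m ℕ.+ (m ℕ.+ m)))
        arith = solve-∀

    module _ {J d : ℕ} (upper : ι J + β ≤ ι (1 ℕ.+ (J ℕ.+ d)) * (1ℚ - α)) where
      private
        D : ℚ
        D = ι d
        upper′ : ι J + β ≤ (ι 1 + (ι J + D)) * (1ℚ - α)
        upper′ = subst (λ x → ι J + β ≤ x * (1ℚ - α)) (≡-trans (ι-+ 1 (J ℕ.+ d)) (cong (λ x → ι 1 + x) (ι-+ J d))) upper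

      -- Expanding `upper` gives 1 + d ≥ α(J + d + 1) + β, which exceeds the requirement by α.
      enough-all : ∀ {e} → 1 ℕ.+ d ℕ.≤ e → Enough (J ℕ.+ d) e
      enough-all {e} le = ℚ.≤-trans (concludeℚ (ℚ.+-mono-≤ upper′ 0≤α) (begin-equality
          ι (1 ℕ.+ d) + (ι J + β + 0ℚ)
            ≡⟨ cong (_+ (ι J + β + 0ℚ)) (ι-+ 1 d) ⟩
          ι 1 + D + (ι J + β + 0ℚ)
            ≡⟨ solve 4 (λ α β J D → con (ι 1) :+ D :+ (J :+ β :+ con 0ℚ)
                 := α :* (J :+ D) :+ β :+ ((con (ι 1) :+ (J :+ D)) :* (con 1ℚ :+ :- α) :+ α)) refl α β (ι J) D ⟩
          α * (ι J + D) + β + ((ι 1 + (ι J + D)) * (1ℚ - α) + α)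
            ≡⟨ cong (λ x → α * x + β + ((ι 1 + (ι J + D)) * (1ℚ - α) + α)) (ι-+ J d) ⟨
          α * ι (J ℕ.+ d) + β + ((ι 1 + (ι J + D)) * (1ℚ - α) + α) ∎)) (ι-mono le)
        where open ≤-Reasoning

      -- The degree falls by one, and the requirement falls by at least 4α ≥ 1.
      enough-part : ∀ {h e} → h ℕ.+ 4 ℕ.≤ J ℕ.+ d → d ℕ.≤ e → Enough h e
      enough-part {h} {e} h+4≤ le = ℚ.≤-trans (concludeℚ
          (ℚ.+-mono-≤ upper′ (ℚ.+-mono-≤ shrink (ℚ.+-mono-≤ 1≤4α 0≤α))) (begin-equality
          D + (ι J + β + (α * (ι h + ι 4) + (ι 1 + 0ℚ)))
            ≡⟨ solve 5 (λ α β J D h → D :+ (J :+ β :+ (α :* (h :+ con (ι 4)) :+ (con (ι 1) :+ con 0ℚ)))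
                 := α :* h :+ β :+ ((con (ι 1) :+ (J :+ D)) :* (con 1ℚ :+ :- α) :+ (α :* (J :+ D) :+ (α :* con (ι 4) :+ α)))) refl α β (ι J) D (ι h) ⟩
          α * ι h + β + ((ι 1 + (ι J + D)) * (1ℚ - α) + (α * (ι J + D) + (α * ι 4 + α))) ∎)) (ι-mono le)
        where
        open ≤-Reasoning
        shrink : α * (ι h + ι 4) ≤ α * (ι J + D)
        shrink = ℚ.*-monoˡ-≤-nonNeg α {{nonNegative 0≤α}} (ℚ.≤-trans (ℚ.≤-reflexive (≡-sym (ι-+ h 4))) (ℚ.≤-trans (ι-mono h+4≤) (ℚ.≤-reflexive (ι-+ J d))))

-- Decidability of the Ramsey property and choice of the number of vertices

module Assembly where
  open LinearArithmetic
  open Combinatorics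
  open Rationals
  open import Data.Rational as ℚ using (ℚ; _/_; _÷_; NonZero; 1ℚ)
  import Data.Rational.Properties as ℚ
  open import Data.Integer using (+_)
  open import Data.Bool using (Bool; true; false)
  import Data.Bool.Properties as Bool
  open import Data.Nat using (ℕ; zero; suc; _+_; _*_; _≤_; _<_; z≤n; s≤s)
  open import Data.Nat.Properties as ℕ using (≤-trans; ≤-reflexive)
  open import Data.Nat.Tactic.RingSolver using (solve-∀)
  open import Data.Fin using (Fin)
  open import Data.Fin.Properties using (_≟_)
  open import Data.List using (List; []; _∷_; length; allFin)
  open import Data.List.Relation.Unary.Any using (here)
  open import Data.List.Relation.Unary.All using ([]; _∷_)
  open import Data.List.Relation.Unary.AllPairs using ([]; _∷_)
  open import Data.List.Relation.Unary.Unique.Propositional.Properties as Uniq using (allFin⁺)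
  open import Data.Product using (∃; _×_; _,_; proj₁; proj₂)
  open import Data.Sum using (inj₁; inj₂)
  open import Data.Empty using (⊥)
  open import Relation.Nullary using (¬_; Dec)
  open import Relation.Nullary.Decidable using (_×-dec_)
  open import Relation.Binary.PropositionalEquality using (_≡_; refl; subst) renaming (sym to ≡-sym; trans to ≡-trans)
  open import Data.Fin.Properties using (all?; any?)
  open import Function.Definitions using (Injective)
  open import Relation.Nullary.Decidable using (_→-dec_; _⊎-dec_; map′; decidable-stable)

  -- The search rebuilds a function from its values, which agrees with the original only pointwise;
  -- hence the predicate must respect pointwise equality.
  anyFunction? : ∀ {n} m {P : (Fin m → Fin n) → Set} → (∀ {f g} → (∀ i → f i ≡ g i) → P f → P g) → (∀ f → Dec (P f)) → Dec (∃ P)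
  anyFunction? {n} zero ext P? = map′ (λ p → none , p) (λ (f , p) → ext (λ ()) p) (P? none)
    where
    none : Fin 0 → Fin n
    none ()
  anyFunction? {n} (suc m) {P} ext P? = map′
      (λ (v , f , p) → prepend v f , p)
      (λ (f , p) → f Fin.zero , (λ i → f (Fin.suc i)) , ext (λ { Fin.zero → refl ; (Fin.suc i) → refl }) p)
      (any? λ v → anyFunction? m (λ {f} {g} e → ext (λ { Fin.zero → refl ; (Fin.suc i) → e i })) (λ f → P? (prepend v f)))
    where
    prepend : Fin n → (Fin m → Fin n) → Fin (suc m) → Fin n
    prepend v f Fin.zero = v
    prepend v f (Fin.suc i) = f i

  containsCopy? : ∀ {m n} (F : Fin m → Fin m → Bool) {E : Fin n → Fin n → Set} → (∀ u v → Dec (E u v)) → Dec (ContainsCopy F E)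
  containsCopy? {m} {n} F {E} E? = anyFunction? m
    (λ {f} {g} e (inj , h) → (λ {i} {j} r → inj (≡-trans (e i) (≡-trans r (≡-sym (e j))))) ,
      λ a b r → subst (λ v → E v (g b)) (e a) (subst (E (f a)) (e b) (h a b r)))
    (λ f → injective? f ×-dec all? λ a → all? λ b → (F a b Bool.≟ true) →-dec E? (f a) (f b))
    where
    injective? : ∀ f → Dec (Injective _≡_ _≡_ f)
    injective? f = map′ (λ h {i} {j} → h i j) (λ h i j → h) (all? λ i → all? λ j → (f i ≟ f j) →-dec (i ≟ j))

  ramsey : ∀ {α β} (adm : Admissible α β) {m k} → 1 ≤ k → 2 + k ≤ 3 + m → ∀ {n d} → n ≡ 3 * (4 + m) + d → 17 + 4 * m ≤ n →
    ι (3 * (4 + m)) ℚ.+ β ℚ.≤ ι (1 + n) ℚ.* (1ℚ ℚ.- α) → RamseyProperty (cycAdj (2 * (2 + k) + 1)) (wheelAdj (2 * (4 + m))) n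
  ramsey adm {m} {k} 1≤k k≤m {n} {d} refl size upper c = decidable-stable
    (containsCopy? _ (λ u v → col c u v Bool.≟ true) ⊎-dec containsCopy? _ (λ u v → col c u v Bool.≟ false))
    λ none → cases (λ h → none (inj₁ h)) λ h → none (inj₂ h)
    where
    open Bounds adm
    arith₁ : ∀ m → 2 * (4 + m) ≡ 8 + 2 * m
    arith₁ = solve-∀
    arith₂ : ∀ m d r b o → r + (3 * (4 + m) + d + (suc b + (o + 0))) ≡ 1 + d + (1 + o + (11 + 3 * m + (r + b))) + 0
    arith₂ = solve-∀
    cases : ¬ ContainsCopy (cycAdj (2 * (2 + k) + 1)) (λ u v → col c u v ≡ true) →
      ¬ ContainsCopy (wheelAdj (2 * (4 + m))) (λ u v → col c u v ≡ false) → ⊥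
    cases noRedCopy noWheelCopy = SmallBlueDegree.smallBlueDegree c k≤m 1≤k size refl degree noRed noRedCopy noWheel
        Enough (enough-all {3 * (4 + m)} {d} upper) (enough-part {3 * (4 + m)} {d} upper) admissible
      where
      noRed : ¬ HasCyc c red (2 * (2 + k) + 1)
      noRed h = noRedCopy (cycleCopy h)
      noWheel : ¬ HasWheel c (8 + 2 * m)
      noWheel w = noWheelCopy (wheelCopy (subst (HasWheel c) (≡-sym (arith₁ m)) w))
      others : Fin n → List (Fin n)
      others v = allFin n ∖ (v ∷ [])
      fewBlueNbrs : ∀ v → length (nbrsIn c blue v (others v)) < 11 + 3 * m
      fewBlueNbrs v = ℕ.≰⇒> λ le → BigBlueDegree.bigBlueDegree c k≤m size noRed noWheel v (nbrsIn c blue v (others v))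
        (Unique-nbrsIn c blue v (Unique-∖ (v ∷ []) (allFin⁺ n))) le
        λ q → proj₂ (nbrsIn⊆ c blue v (others v) q) ,
          λ { refl → proj₂ (∈-∖⁻ {ys = allFin n} (v ∷ []) (proj₁ (nbrsIn⊆ c blue v (others v) q))) (here refl) }
      degree : ∀ v → 1 + d ≤ redDegree c v
      degree v = conclude 0 (suc-pred-allFin v ⊕ fewBlueNbrs v ⊕ ≤-reflexive (≡-trans (ℕ.+-identityʳ (length (others v))) (≡-sym (nbrsIn-split c v (others v)))))
        (arith₂ m d (redDegree c v) (length (nbrsIn c blue v (others v))) (length (others v)))

  -- The quotient enters as an opaque `X` with two implications: the first puts 4j + 1 below it, and
  -- the second extracts the degree condition from the number just above it.
  atMost : ∀ {α β} (adm : Admissible α β) {m k} → 1 ≤ k → 2 + k ≤ 3 + m → ∀ X →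
    (∀ {q} → q ℚ.* (1ℚ ℚ.- α) ℚ.≤ ι (3 * (4 + m)) ℚ.+ β → q ℚ.≤ X) →
    (∀ {q} → ¬ (q ℚ.≤ X) → ι (3 * (4 + m)) ℚ.+ β ℚ.≤ q ℚ.* (1ℚ ℚ.- α)) →
    RamseyAtMost (cycAdj (2 * (2 + k) + 1)) (wheelAdj (2 * (4 + m))) X
  atMost {α} {β} adm {m} {k} 1≤k k≤m X into outof = fromFloor (archimedean X)
    where
    Target : Set
    Target = RamseyAtMost (cycAdj (2 * (2 + k) + 1)) (wheelAdj (2 * (4 + m))) X
    arith : ∀ m → 17 + 4 * m + 0 ≡ 3 * (4 + m) + 0 + (5 + m)
    arith = solve-∀
    atFloor : ∀ i → 17 + 4 * m ≤ i → ι i ℚ.≤ X → ¬ (ι (suc i) ℚ.≤ X) → (∃ λ d → 3 * (4 + m) + d ≡ i) → Target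
    atFloor i size below above (d , e) = i , below , ramsey adm 1≤k k≤m (≡-sym e) size (outof above)
    fromFloor : (∃ λ M → X ℚ.< ι M) → Target
    fromFloor (M , X<M) = locate (greatest (λ i → ι i ℚ.≤? X) M (17 + 4 * m) (into (Bounds.lower adm m))
        λ le → ℚ.<-irrefl refl (ℚ.<-≤-trans X<M (ℚ.≤-trans (ι-mono (ℕ.m≤n+m M (17 + 4 * m))) le)))
      where
      locate : (∃ λ i → 17 + 4 * m ≤ i × ι i ℚ.≤ X × ¬ (ι (suc i) ℚ.≤ X)) → Target
      locate (i , size , below , above) =
        atFloor i size below above (ℕ.m≤n⇒∃[o]m+o≡n (≤-trans (conclude (5 + m) (z≤n {0}) (arith m)) size))

  ramseyAtMost : (α β : ℚ) → Admissible α β → (k j : ℕ) → 2 < k → k < j →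
      ∀ .{{_ : NonZero (1ℚ ℚ.- α)}} →
      RamseyAtMost (cycAdj (2 * k + 1)) (wheelAdj (2 * j))
      (((+ (3 * j)) / 1 ℚ.+ β) ÷ (1ℚ ℚ.- α))
  -- The patterns read the given integers as 3 + `k` and 4 + `m`; the former becomes 2 + `suc k` in
  -- `atMost`.
  ramseyAtMost α β adm _ _ (s≤s (s≤s (s≤s {n = k} _))) (s≤s (s≤s (s≤s (s≤s {n = m} k≤m)))) =
    atMost adm {m} {suc k} (s≤s z≤n) (s≤s (s≤s (s≤s k≤m))) _ (Bounds.≤÷ adm (ι (3 * (4 + m)) ℚ.+ β)) (Bounds.≰÷ adm (ι (3 * (4 + m)) ℚ.+ β))

open import Data.Nat as ℕ using (ℕ)
open import Data.Integer using (+_)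
open import Data.Rational using (ℚ; _/_; _+_; _-_; _÷_; NonZero; 1ℚ)

theorem25 : (α β : ℚ) → Admissible α β → (k j : ℕ) → 2 ℕ.< k → k ℕ.< j →
    ∀ .{{_ : NonZero (1ℚ - α)}} →
    RamseyAtMost (cycAdj (2 ℕ.* k ℕ.+ 1)) (wheelAdj (2 ℕ.* j))
    (((+ (3 ℕ.* j)) / 1 + β) ÷ (1ℚ - α))
theorem25 α β admissible k j 2<k k<j = Assembly.ramseyAtMost α β admissible k j 2<k k<j
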